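{- Let $m\ge 1$ and $k_1\geq k_2\geq\cdots\geq k_{m}\geq3$ be integers, let $F_m=P_{k_1}\cup P_{k_2}\cup\cdots\cup P_{k_m}$ (vertex-disjoint union of paths), and let $n\ge \sum_{i=1}^m k_i$. If at most one of $k_1,k_2,\ldots,k_m$ is odd, then $$ex(n,F_m)= \max\left\{[n,k_1,k_1],\,[n,k_1+k_2,k_2],\,\ldots,\,\Big[n,\sum_{i=1}^{m}k_{i},k_{m}\Big],\,\Big[n,\sum_{i=1}^{m}k_{i}\Big]\right\},$$ where the general term of the list is $[n,\sum_{i=1}^{j}k_i,k_j]$ for $j=1,\dots,m$.
   Context: All graphs are finite and simple. $P_k$ is the path on $k$ vertices. For a graph $H$, $ex(n,H)$ is the maximum number of edges of an $n$-vertex graph containing no subgraph isomorphic to $H$. Notation: for integers $n\ge m\ge l\ge 3$, write $n=(m-1)+t(l-1)+r$ with integers $t\ge 0$ and $0\le r<l-1$, and set $[n,m,l]={m-1\choose 2}+t{l-1\choose 2}+{r\choose 2}$ (if $n\le m-1$, set $[n,m,l]={n\choose 2}$). For integers $n\ge m\ge 3$, set $[n,m]={\lfloor m/2\rfloor-1\choose 2}+\lfloor (m-2)/2\rfloor\,(n-\lfloor m/2\rfloor+1)$ (this is the number of edges of $K_{\lfloor m/2\rfloor-1}+\overline{K}_{n-\lfloor m/2\rfloor+1}$, where $+$ denotes the join). -}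

module Defs where

open import Data.Nat using (ℕ; zero; suc; _+_; _*_; _∸_; _≤_; _<ᵇ_; _⊔_; _≤?_)
open import Data.Nat.DivMod using (_/_; _%_)
open import Data.Nat.Combinatorics using (_C_)
open import Data.Fin using (Fin; toℕ)
import Data.Fin as Fin
open import Data.Bool using (Bool; true; false; _∧_; if_then_else_)
open import Data.Nat.ListAction using (sum)
open import Data.List using (List; map; foldr; allFin; concatMap; _∷_; [])
open import Data.Product using (Σ; _×_; ∃)
open import Data.Sum using (_⊎_)
open import Relation.Binary.PropositionalEquality using (_≡_)
open import Relation.Nullary using (¬_; yes; no)
open import Function.Definitions using (Injective)

record Graph (n : ℕ) : Set where
  field
    adj    : Fin n → Fin n → Bool
    sym    : ∀ i j → adj i j ≡ adj j i
    irrefl : ∀ i → adj i i ≡ false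
open Graph public

edges : ∀ {n} → Graph n → ℕ
edges {n} G = sum (concatMap (λ i → map (λ j →
  if (toℕ i <ᵇ toℕ j) ∧ adj G i j then 1 else 0) (allFin n)) (allFin n))

record Pattern : Set₁ where
  field
    V   : Set
    Adj : V → V → Set

Contains : ∀ {n} → Graph n → Pattern → Set
Contains {n} G H = Σ (Pattern.V H → Fin n) λ f →
  Injective _≡_ _≡_ f × (∀ u v → Pattern.Adj H u v → adj G (f u) (f v) ≡ true)

IsEx : ℕ → Pattern → ℕ → Set
IsEx n H e =
  (Σ (Graph n) λ G → ¬ Contains G H × edges G ≡ e) ×
  (∀ (G : Graph n) → ¬ Contains G H → edges G ≤ e)

LinearForest : (m : ℕ) → (Fin m → ℕ) → Pattern
LinearForest m k = record
  { V   = Σ (Fin m) (λ i → Fin (k i))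
  ; Adj = λ { (i Data.Product., p) (j Data.Product., q) →
             (i ≡ j) × ((toℕ q ≡ suc (toℕ p)) ⊎ (toℕ p ≡ suc (toℕ q))) } }

-- psum k j = k 0 + … + k (j-1)  (sum of the first j terms, capped at m)
psum : ∀ {m} → (Fin m → ℕ) → ℕ → ℕ
psum {zero}  k _       = 0
psum {suc m} k zero    = 0
psum {suc m} k (suc j) = k Fin.zero + psum (λ i → k (Fin.suc i)) j

-- [n,m,l] as in the paper (only used with l ≥ 3; junk value n C 2 for l < 2).
bracket3 : ℕ → ℕ → ℕ → ℕ
bracket3 n m (suc (suc l)) with n ≤? m ∸ 1
... | yes _ = n C 2
... | no  _ = ((m ∸ 1) C 2) + ((q / suc l) * ((suc (suc l) ∸ 1) C 2)) + ((q % suc l) C 2)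
  where q = n ∸ (m ∸ 1)
bracket3 n m _ = n C 2

bracket2 : ℕ → ℕ → ℕ
bracket2 n m = (((m / 2) ∸ 1) C 2) + ((m ∸ 2) / 2) * ((n ∸ (m / 2)) + 1)

maximum : List ℕ → ℕ
maximum = foldr _⊔_ 0

exValue : (n m : ℕ) → (Fin m → ℕ) → ℕ
exValue n m k =
  maximum (map (λ j → bracket3 n (psum k (suc (toℕ j))) (k j)) (allFin m))
  ⊔ bracket2 n (psum k m)

{-# OPTIONS --safe #-}
module Submission where

-- Upper bound.  Take a longest path in each component of G and pack P_{k_1}, P_{k_2}, … greedily into these paths.  If
-- P_{k_j} no longer fits, then a component that received paths of total order S has no path on more than
-- P = S + k_j − 1 vertices.  Kopylov's method bounds its number of edges: in an edge-maximal such graph the core D left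
-- after deleting vertices of degree at most σ = ⌊(P − 1)/2⌋ is empty or complete (Pósa's rotation argument), and in the
-- latter case everything outside D can be deleted in steps of degree at most P − |D|.  By convexity in |D| the extreme
-- cases are K_P and the join of K_σ with an independent set, the latter with one more edge if P is even.  Convexity in
-- the component sizes merges the bounds of all components into one of the terms of the maximum.  The additional edge
-- can only survive for a single component with j = m and ∑ k_i odd; tightness then forces the join of K_σ with K_2 and
-- isolated vertices, which contains P_{2e} ∪ P_{∑ k_i − 2e} for every e, hence the linear forest, as some k_i is even.
--
-- Lower bound.  By the upper bound it is enough that the extremal graphs have at least the claimed number of edges.

open import Defs hiding (sym)
open import Data.Nat hiding (_≟_)
open import Data.Nat.Properties renaming (_≟_ to _≟ℕ_)
open import Data.Nat.DivMod using (m<n⇒m%n≡m; [m+n]%n≡m%n; m%n<n; m≡m%n+[m/n]*n; [m+kn]%n≡m%n; m*n/n≡m; m/n≡1+[m∸n]/n; m<n⇒m/n≡0; +-distrib-/-∣ʳ)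
open import Data.Nat.Divisibility using (divides-refl)
open import Data.Nat.Combinatorics using (nCk+nC[k+1]≡[n+1]C[k+1]; nC1≡n) renaming (_C_ to _choose_)
open import Data.Nat.ListAction using (sum)
open import Data.Nat.ListAction.Properties using (sum-++)
open import Data.Nat.Tactic.RingSolver using (solve-∀)
open import Data.Fin using (Fin; zero; suc; toℕ; fromℕ<; _≟_)
open import Data.Fin.Properties using (any?; toℕ<n; toℕ-injective; toℕ-fromℕ<)
open import Data.Bool using (Bool; true; false; _∧_; _∨_; not; if_then_else_)
import Data.Bool as Bool
open import Data.Bool.Properties using (∨-comm; ∧-comm)
open import Data.List using (List; []; _∷_; _++_; length; reverse; map; [_]; take; drop; allFin; tabulate; concatMap)
open import Data.List.Properties using (length-++; length-reverse; unfold-reverse; ++-assoc; ++-identityʳ; reverse-++; ∷-injectiveˡ; ∷ʳ-injectiveʳ; take++drop≡id; length-take; length-drop; length-tabulate)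
open import Data.Product using (Σ; ∃; ∃₂; _×_; _,_; proj₁; proj₂)
open import Data.Sum using (_⊎_; inj₁; inj₂; [_,_]′)
open import Data.Unit using (⊤; tt)
open import Data.Empty using (⊥; ⊥-elim)
open import Function using (_∘_; id; case_of_)
open import Relation.Nullary using (¬_; yes; no; does; Dec)
open import Relation.Nullary.Decidable using (¬¬-excluded-middle; _×-dec_; dec-true)
open import Relation.Binary.Definitions using (tri<; tri≈; tri>)
open import Relation.Binary.PropositionalEquality hiding ([_])
open import Algebra.Properties.CommutativeMonoid.Sum +-0-commutativeMonoid using (∑-distrib-+; ∑-comm; sum-cong-≗) renaming (sum to ∑)
open import Data.List.Relation.Unary.All as All using (All; []; _∷_)
import Data.List.Relation.Unary.All.Properties as All
open import Data.List.Relation.Unary.Any using (here; there)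
open import Data.List.Relation.Unary.Linked using (Linked; []; [-]; _∷_)
open import Data.List.Relation.Unary.AllPairs using ([]; _∷_)
open import Data.List.Relation.Unary.Unique.Propositional using (Unique)
import Data.List.Relation.Unary.Unique.Propositional.Properties as Unique
open import Data.List.Membership.Propositional using (_∈_; _∉_)
open import Data.List.Membership.Propositional.Properties using (∈-++⁺ˡ; ∈-++⁺ʳ; ∈-∃++; ∈-allFin; ∈-tabulate⁻)
open import Data.List.Relation.Binary.Permutation.Propositional using (_↭_; prep; swap; ↭-sym; ↭-trans; ↭-refl; ↭-reflexive)
import Data.List.Relation.Binary.Permutation.Propositional as ↭
open import Data.List.Relation.Binary.Permutation.Propositional.Properties using (All-resp-↭; ∈-resp-↭; ↭-length; shift; ++⁺; ++⁺ˡ; ++⁺ʳ; ↭-reverse) renaming (++-comm to ++-comm-↭)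

-- The value P = S + k_j - 1 arises because the longest path of a component consists of the S
-- vertices already used and a remainder on fewer than k_j vertices. The obstacle is the additional
-- edge for even P. It is absorbed as soon as something is left over: an edge that can still be
-- added without creating a longer path, a second used component, or a further path waiting to be
-- packed, since then σ can be raised by one. What remains is a saturated component attaining the
-- bound, and there the two paths must be found in the given graph, although the rigidity argument
-- passes through a saturation of a smaller vertex set. Longest paths, decompositions and
-- saturations are obtained only under double negation. This suffices because an inequality in ℕ is
-- stable.

-- Vertex subsets, degrees and doubled edge counts

⟦_⟧ : Bool → ℕ
⟦ b ⟧ = if b then 1 else 0

Sub : ℕ → Set
Sub n = Fin n → Bool

infix 4 _∈ₛ_ _⊆ₛ_
infixl 7 _∩_
infixl 6 _─_ _∖_

_∈ₛ_ : ∀ {n} → Fin n → Sub n → Set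
v ∈ₛ A = A v ≡ true

_⊆ₛ_ : ∀ {n} → Sub n → Sub n → Set
A ⊆ₛ B = ∀ v → v ∈ₛ A → v ∈ₛ B

_∩_ _∖_ : ∀ {n} → Sub n → Sub n → Sub n
(A ∩ B) v = A v ∧ B v
(A ∖ B) v = A v ∧ not (B v)

｛_｝ : ∀ {n} → Fin n → Sub n
｛ v ｝ j = does (j ≟ v)

_─_ : ∀ {n} → Sub n → Fin n → Sub n
A ─ v = A ∖ ｛ v ｝

full : ∀ {n} → Sub n
full _ = true

card : ∀ {n} → Sub n → ℕ
card A = ∑ λ v → ⟦ A v ⟧

deg : ∀ {n} → Graph n → Sub n → Fin n → ℕ
deg G A v = card (A ∩ adj G v)

-- Twice the number of edges, so that all bounds are polynomial.
edges₂ : ∀ {n} → Graph n → Sub n → ℕ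
edges₂ G A = ∑ λ i → ∑ λ j → ⟦ (A i ∧ A j) ∧ adj G i j ⟧

∧-true : ∀ {a b} → a ∧ b ≡ true → a ≡ true × b ≡ true
∧-true {true} {true} _ = refl , refl

true-∧ : ∀ {a b} → a ≡ true → b ≡ true → a ∧ b ≡ true
true-∧ refl refl = refl

true≢false : ∀ {b} → b ≡ true → b ≡ false → ⊥
true≢false refl ()

not-true : ∀ {b} → b ≡ false → not b ≡ true
not-true refl = refl

true-not : ∀ {b} → not b ≡ true → b ≡ false
true-not {false} _ = refl

bool-cases : ∀ b → b ≡ true ⊎ b ≡ false
bool-cases true = inj₁ refl
bool-cases false = inj₂ refl

¬true⇒false : ∀ {b} → ¬ b ≡ true → b ≡ false
¬true⇒false {true} h = ⊥-elim (h refl)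
¬true⇒false {false} h = refl

∈｛｝ : ∀ {n} (v : Fin n) → v ∈ₛ ｛ v ｝
∈｛｝ v with v ≟ v
... | yes _ = refl
... | no ¬p = ⊥-elim (¬p refl)

∈｛｝⇒≡ : ∀ {n} {v j : Fin n} → j ∈ₛ ｛ v ｝ → j ≡ v
∈｛｝⇒≡ {v = v} {j} p with j ≟ v
... | yes q = q
... | no _ = case p of λ ()

∉｛｝ : ∀ {n} {v j : Fin n} → ¬ j ≡ v → ｛ v ｝ j ≡ false
∉｛｝ {v = v} {j} p = ¬true⇒false (p ∘ ∈｛｝⇒≡)

∈-─ : ∀ {n} {A : Sub n} {v j} → j ∈ₛ A → ¬ j ≡ v → j ∈ₛ (A ─ v)
∈-─ p q = true-∧ p (not-true (∉｛｝ q))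

─⊆ : ∀ {n} {A : Sub n} {v} → (A ─ v) ⊆ₛ A
─⊆ {A = A} j p = proj₁ (∧-true {A j} p)

∈-─⇒≢ : ∀ {n} {A : Sub n} {v j} → j ∈ₛ (A ─ v) → ¬ j ≡ v
∈-─⇒≢ {A = A} {v} {j} p refl = true≢false (∈｛｝ v) (true-not (proj₂ (∧-true {A v} p)))

∑-mono : ∀ {n} {f g : Fin n → ℕ} → (∀ i → f i ≤ g i) → ∑ f ≤ ∑ g
∑-mono {zero} h = z≤n
∑-mono {suc n} h = +-mono-≤ (h zero) (∑-mono (h ∘ suc))

∑-zero : ∀ {n} (f : Fin n → ℕ) → (∀ i → f i ≡ 0) → ∑ f ≡ 0
∑-zero {zero} f h = refl
∑-zero {suc n} f h = cong₂ _+_ (h zero) (∑-zero (f ∘ suc) (h ∘ suc))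

∑-*ʳ : ∀ {n} (f : Fin n → ℕ) c → ∑ (λ i → f i * c) ≡ ∑ f * c
∑-*ʳ {zero} f c = refl
∑-*ʳ {suc n} f c = trans (cong (f zero * c +_) (∑-*ʳ (f ∘ suc) c)) (sym (*-distribʳ-+ c (f zero) _))

∑-split : ∀ {n} (f : Fin n → ℕ) v → ∑ f ≡ f v + ∑ (λ j → if ｛ v ｝ j then 0 else f j)
∑-split {suc n} f zero = refl
∑-split {suc n} f (suc v) = begin
  f zero + ∑ (f ∘ suc)                              ≡⟨ cong (f zero +_) (∑-split (f ∘ suc) v) ⟩
  f zero + (f (suc v) + ∑ g)                        ≡⟨ lem (f zero) (f (suc v)) (∑ g) ⟩
  f (suc v) + (f zero + ∑ g)                        ∎
  where
  open ≡-Reasoning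
  g = λ j → if ｛ v ｝ j then 0 else f (suc j)
  lem : ∀ a b c → a + (b + c) ≡ b + (a + c)
  lem = solve-∀

⟦⟧-mono : ∀ {a b} → (a ≡ true → b ≡ true) → ⟦ a ⟧ ≤ ⟦ b ⟧
⟦⟧-mono {false} h = z≤n
⟦⟧-mono {true} h rewrite h refl = ≤-refl

card-mono : ∀ {n} {A B : Sub n} → A ⊆ₛ B → card A ≤ card B
card-mono h = ∑-mono λ i → ⟦⟧-mono (h i)

card-cong : ∀ {n} {A B : Sub n} → (∀ v → A v ≡ B v) → card A ≡ card B
card-cong h = sum-cong-≗ (λ v → cong ⟦_⟧ (h v))

card-remove : ∀ {n} (A : Sub n) v → card A ≡ ⟦ A v ⟧ + card (A ─ v)
card-remove A v = trans (∑-split _ v) (cong (⟦ A v ⟧ +_) (sum-cong-≗ pt))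
  where
  pt : ∀ j → (if ｛ v ｝ j then 0 else ⟦ A j ⟧) ≡ ⟦ (A ─ v) j ⟧
  pt j with ｛ v ｝ j | A j
  ... | true  | true = refl
  ... | true  | false = refl
  ... | false | true = refl
  ... | false | false = refl

card-─ : ∀ {n} (A : Sub n) {v} → v ∈ₛ A → card A ≡ suc (card (A ─ v))
card-─ A {v} p = trans (card-remove A v) (cong (λ b → ⟦ b ⟧ + card (A ─ v)) p)

deg-mono : ∀ {n} (G : Graph n) {A B : Sub n} v → A ⊆ₛ B → deg G A v ≤ deg G B v
deg-mono G {A} v h = card-mono λ i p → let (a , b) = ∧-true {A i} p in true-∧ (h i a) b

card-split : ∀ {n} (A B : Sub n) → card A ≡ card (A ∩ B) + card (A ∖ B)
card-split A B = trans (sum-cong-≗ pt) (∑-distrib-+ (λ v → ⟦ (A ∩ B) v ⟧) (λ v → ⟦ (A ∖ B) v ⟧))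
  where
  pt : ∀ j → ⟦ A j ⟧ ≡ ⟦ (A ∩ B) j ⟧ + ⟦ (A ∖ B) j ⟧
  pt j with A j | B j
  ... | true  | true = refl
  ... | true  | false = refl
  ... | false | _ = refl

deg-remove-self : ∀ {n} (G : Graph n) (A : Sub n) v → deg G (A ─ v) v ≡ deg G A v
deg-remove-self G A v = card-cong pt
  where
  pt : ∀ j → (A j ∧ not (｛ v ｝ j)) ∧ adj G v j ≡ A j ∧ adj G v j
  pt j with j ≟ v
  ... | yes refl rewrite irrefl G v = trans (lem (A v ∧ false)) (sym (lem (A v)))
    where
    lem : ∀ b → b ∧ false ≡ false
    lem true = refl
    lem false = refl
  ... | no _ with A j
  ...   | true = refl
  ...   | false = refl

edges₂-remove : ∀ {n} (G : Graph n) (A : Sub n) {v} → v ∈ₛ A →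
  edges₂ G A ≡ edges₂ G (A ─ v) + 2 * deg G A v
edges₂-remove {n} G A {v} v∈A = begin
  ∑ g                                             ≡⟨ ∑-split g v ⟩
  g v + ∑ (λ i → if ｛ v ｝ i then 0 else g i)       ≡⟨ cong₂ _+_ row (sum-cong-≗ pt) ⟩
  deg G A v + ∑ (λ i → ⟦ (A ∩ adj G v) i ⟧ + h i)  ≡⟨ cong (deg G A v +_) (∑-distrib-+ _ h) ⟩
  deg G A v + (deg G A v + ∑ h)                   ≡⟨ lem (deg G A v) (∑ h) ⟩
  ∑ h + 2 * deg G A v                             ∎
  where
  open ≡-Reasoning
  g h : Fin n → ℕ
  g i = ∑ λ j → ⟦ (A i ∧ A j) ∧ adj G i j ⟧
  h i = ∑ λ j → ⟦ ((A ─ v) i ∧ (A ─ v) j) ∧ adj G i j ⟧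
  lem : ∀ a b → a + (a + b) ≡ b + 2 * a
  lem = solve-∀
  row : g v ≡ deg G A v
  row rewrite v∈A = refl
  pt : ∀ i → (if ｛ v ｝ i then 0 else g i) ≡ ⟦ (A ∩ adj G v) i ⟧ + h i
  pt i with i ≟ v
  ... | yes refl rewrite irrefl G v | v∈A = sym (∑-zero {n} _ λ j → refl)
  ... | no i≢v = trans (∑-split _ v) (cong₂ _+_ c0 (sum-cong-≗ pt2))
    where
    c0 : ⟦ (A i ∧ A v) ∧ adj G i v ⟧ ≡ ⟦ A i ∧ adj G v i ⟧
    c0 rewrite v∈A | Graph.sym G i v with A i
    ... | true = refl
    ... | false = refl
    pt2 : ∀ j → (if ｛ v ｝ j then 0 else ⟦ (A i ∧ A j) ∧ adj G i j ⟧) ≡ ⟦ ((A i ∧ true) ∧ (A j ∧ not (｛ v ｝ j))) ∧ adj G i j ⟧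
    pt2 j with ｛ v ｝ j | A i | A j
    ... | true  | true | true = refl
    ... | true  | true | false = refl
    ... | true  | false | _ = refl
    ... | false | true | true = refl
    ... | false | true | false = refl
    ... | false | false | _ = refl

edges₂≡∑deg : ∀ {n} (G : Graph n) A → edges₂ G A ≡ ∑ (λ i → ⟦ A i ⟧ * deg G A i)
edges₂≡∑deg {n} G A = sum-cong-≗ pt
  where
  pt : ∀ i → ∑ (λ j → ⟦ (A i ∧ A j) ∧ adj G i j ⟧) ≡ ⟦ A i ⟧ * deg G A i
  pt i with A i
  ... | true = sym (+-identityʳ _)
  ... | false = ∑-zero {n} _ λ _ → refl

deg<card : ∀ {n} (G : Graph n) {A : Sub n} {v} → v ∈ₛ A → deg G A v < card A
deg<card G {A} {v} p = subst (deg G A v <_) (sym (card-─ A p)) (s≤s (subst (_≤ card (A ─ v)) (deg-remove-self G A v)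
  (card-mono {A = (A ─ v) ∩ adj G v} {A ─ v} λ j q → proj₁ (∧-true {(A ─ v) j} q))))

edges₂≤ : ∀ {n} (G : Graph n) A → edges₂ G A ≤ card A * (card A ∸ 1)
edges₂≤ G A = begin
  edges₂ G A                            ≡⟨ edges₂≡∑deg G A ⟩
  ∑ (λ i → ⟦ A i ⟧ * deg G A i)         ≤⟨ ∑-mono pt ⟩
  ∑ (λ i → ⟦ A i ⟧ * (card A ∸ 1))      ≡⟨ ∑-*ʳ (λ i → ⟦ A i ⟧) (card A ∸ 1) ⟩
  card A * (card A ∸ 1)                 ∎
  where
  open ≤-Reasoning
  pt : ∀ i → ⟦ A i ⟧ * deg G A i ≤ ⟦ A i ⟧ * (card A ∸ 1)
  pt i with A i in eq
  ... | true = +-monoˡ-≤ 0 (<⇒≤pred (deg<card G eq))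
  ... | false = z≤n

edges₂-mono : ∀ {n} (G : Graph n) {A B : Sub n} → A ⊆ₛ B → edges₂ G A ≤ edges₂ G B
edges₂-mono G {A} h = ∑-mono λ i → ∑-mono λ j → ⟦⟧-mono λ p →
  let (ab , e) = ∧-true {A i ∧ A j} p ; (a , b) = ∧-true {A i} ab in true-∧ (true-∧ (h i a) (h j b)) e

edges₂-split : ∀ {n} (G : Graph n) (A S : Sub n) →
  (∀ i j → i ∈ₛ (A ∩ S) → j ∈ₛ (A ∖ S) → adj G i j ≡ false) →
  edges₂ G A ≡ edges₂ G (A ∩ S) + edges₂ G (A ∖ S)
edges₂-split G A S h = trans (sum-cong-≗ λ i → trans (sum-cong-≗ (pt i)) (∑-distrib-+ (λ j → ⟦ ((A ∩ S) i ∧ (A ∩ S) j) ∧ adj G i j ⟧) _))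
  (∑-distrib-+ (λ i → ∑ λ j → ⟦ ((A ∩ S) i ∧ (A ∩ S) j) ∧ adj G i j ⟧) _)
  where
  pt : ∀ i j → ⟦ (A i ∧ A j) ∧ adj G i j ⟧ ≡
    ⟦ ((A ∩ S) i ∧ (A ∩ S) j) ∧ adj G i j ⟧ + ⟦ ((A ∖ S) i ∧ (A ∖ S) j) ∧ adj G i j ⟧
  pt i j with A i in ai | A j in aj | S i in si | S j in sj
  ... | false | _ | _ | _ = refl
  ... | true | false | true | _ = refl
  ... | true | false | false | _ = refl
  ... | true | true | true | true = sym (+-identityʳ _)
  ... | true | true | false | false = refl
  ... | true | true | true | false rewrite h i j (true-∧ ai si) (true-∧ aj (not-true sj)) = refl
  ... | true | true | false | true rewrite Graph.sym G i j | h j i (true-∧ aj sj) (true-∧ ai (not-true si)) = refl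

card≤ : ∀ {n} (A : Sub n) → card A ≤ n
card≤ {zero} A = z≤n
card≤ {suc n} A with A zero
... | true = s≤s (card≤ (A ∘ suc))
... | false = m≤n⇒m≤1+n (card≤ (A ∘ suc))

card-full : ∀ n → card {n} full ≡ n
card-full zero = refl
card-full (suc n) = cong suc (card-full n)

card>0⇒∃ : ∀ {n} (A : Sub n) → 0 < card A → ∃ λ v → v ∈ₛ A
card>0⇒∃ {suc n} A h with A zero in eq
... | true = zero , eq
... | false = let (v , p) = card>0⇒∃ (A ∘ suc) h in suc v , p

∃⇒card>0 : ∀ {n} {A : Sub n} {v} → v ∈ₛ A → 0 < card A
∃⇒card>0 {A = A} {v} p = subst (0 <_) (sym (card-─ A p)) z<s

card<⇒∃ : ∀ {n} (A B : Sub n) → card A < card B → ∃ λ v → v ∈ₛ B × A v ≡ false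
card<⇒∃ A B h with card>0⇒∃ (B ∖ A) (≰⇒> λ z → <⇒≱ h (begin
      card B                        ≡⟨ card-split B A ⟩
      card (B ∩ A) + card (B ∖ A)   ≤⟨ +-mono-≤ (card-mono {A = B ∩ A} {A} λ i p → proj₂ (∧-true {B i} p)) z ⟩
      card A + 0                    ≡⟨ +-identityʳ _ ⟩
      card A                        ∎))
  where open ≤-Reasoning
... | v , p = v , proj₁ (∧-true {B v} p) , true-not (proj₂ (∧-true {B v} p))

⊆∧card≥⇒⊇ : ∀ {n} {A B : Sub n} → A ⊆ₛ B → card B ≤ card A → B ⊆ₛ A
⊆∧card≥⇒⊇ {A = A} {B} h c v v∈B with A v in eq
... | true = refl
... | false = ⊥-elim (<⇒≱ lt c)
  where
  A⊆ : A ⊆ₛ (B ─ v)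
  A⊆ j p = ∈-─ {A = B} (h j p) λ { refl → true≢false p eq }
  lt : card A < card B
  lt = subst (card A <_) (sym (card-─ B v∈B)) (s≤s (card-mono {A = A} {B ─ v} A⊆))

unique-length≤card : ∀ {n} (A : Sub n) l → Unique l → All (_∈ₛ A) l → length l ≤ card A
unique-length≤card A [] u a = z≤n
unique-length≤card A (v ∷ l) (v∉ ∷ u) (v∈ ∷ a) = subst (suc (length l) ≤_) (sym (card-─ A v∈))
  (s≤s (unique-length≤card (A ─ v) l u (All.zipWith (λ (p , q) → ∈-─ {A = A} p (q ∘ sym)) (a , v∉))))

count : ∀ {n} → Sub n → List (Fin n) → ℕ
count A [] = 0
count A (v ∷ l) = ⟦ A v ⟧ + count A l

card≤count : ∀ {n} (A : Sub n) l → (∀ v → v ∈ₛ A → v ∈ l) → card A ≤ count A l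
card≤count A [] h = ≤-reflexive (∑-zero _ λ i → cong ⟦_⟧ (¬true⇒false λ p → case h i p of λ ()))
card≤count A (v ∷ l) h = begin
  card A                     ≡⟨ card-remove A v ⟩
  ⟦ A v ⟧ + card (A ─ v)     ≤⟨ +-monoʳ-≤ ⟦ A v ⟧ (card≤count (A ─ v) l h′) ⟩
  ⟦ A v ⟧ + count (A ─ v) l  ≤⟨ +-monoʳ-≤ ⟦ A v ⟧ (cm l) ⟩
  ⟦ A v ⟧ + count A l        ∎
  where
  open ≤-Reasoning
  h′ : ∀ j → j ∈ₛ (A ─ v) → j ∈ l
  h′ j p with h j (─⊆ {A = A} {v} j p)
  ... | here q = ⊥-elim (∈-─⇒≢ {A = A} {v} {j} p q)
  ... | there q = q
  cm : ∀ l → count (A ─ v) l ≤ count A l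
  cm [] = z≤n
  cm (j ∷ l) = +-mono-≤ (⟦⟧-mono (─⊆ {A = A} {v} j)) (cm l)

_∪_ : ∀ {n} → Sub n → Sub n → Sub n
(A ∪ B) v = A v ∨ B v

∪-left : ∀ {a b} → a ≡ true → a ∨ b ≡ true
∪-left refl = refl

∪-right : ∀ {a b} → b ≡ true → a ∨ b ≡ true
∪-right {true} refl = refl
∪-right {false} refl = refl

∪-elim : ∀ {a b} → a ∨ b ≡ true → a ≡ true ⊎ b ≡ true
∪-elim {true} p = inj₁ refl
∪-elim {false} p = inj₂ p

setOf : ∀ {n} → List (Fin n) → Sub n
setOf [] j = false
setOf (v ∷ l) j = ｛ v ｝ j ∨ setOf l j

∈⇒∈setOf : ∀ {n} {l : List (Fin n)} {v} → v ∈ l → v ∈ₛ setOf l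
∈⇒∈setOf {v = v} (here refl) = ∪-left (∈｛｝ v)
∈⇒∈setOf {l = u ∷ l} {v} (there p) = ∪-right {｛ u ｝ v} (∈⇒∈setOf p)

∈setOf⇒∈ : ∀ {n} {l : List (Fin n)} {v} → v ∈ₛ setOf l → v ∈ l
∈setOf⇒∈ {l = u ∷ l} {v} p with ∪-elim {｛ u ｝ v} p
... | inj₁ q = here (∈｛｝⇒≡ q)
... | inj₂ q = there (∈setOf⇒∈ q)

-- Linked and duplicate-free lists, paths, connectivity

module _ {A : Set} {R : A → A → Set} where

  linked-++⁻ : ∀ xs {ys} → Linked R (xs ++ ys) → Linked R xs × Linked R ys
  linked-++⁻ [] l = [] , l
  linked-++⁻ (x ∷ []) [-] = [-] , []
  linked-++⁻ (x ∷ []) (_ ∷ l) = [-] , l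
  linked-++⁻ (x ∷ y ∷ xs) (r ∷ l) = let (a , b) = linked-++⁻ (y ∷ xs) l in r ∷ a , b

  linked-++⁺ : ∀ xs {u v ys} → Linked R (xs ++ [ u ]) → R u v → Linked R (v ∷ ys) → Linked R ((xs ++ [ u ]) ++ v ∷ ys)
  linked-++⁺ [] l r m = r ∷ m
  linked-++⁺ (x ∷ []) (a ∷ _) r m = a ∷ r ∷ m
  linked-++⁺ (x ∷ y ∷ xs) (a ∷ l) r m = a ∷ linked-++⁺ (y ∷ xs) l r m

  linked-reverse : (∀ {x y} → R x y → R y x) → ∀ {xs} → Linked R xs → Linked R (reverse xs)
  linked-reverse s [] = []
  linked-reverse s [-] = [-]
  linked-reverse s {x ∷ y ∷ xs} (r ∷ l) =
    subst (Linked R) (sym (trans (unfold-reverse x (y ∷ xs)) (cong (_++ [ x ]) (unfold-reverse y xs))))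
      (linked-++⁺ (reverse xs) (subst (Linked R) (unfold-reverse y xs) (linked-reverse s l)) (s r) [-])

module _ {A : Set} where

  unique-↭ : ∀ {xs ys : List A} → xs ↭ ys → Unique xs → Unique ys
  unique-↭ ↭.refl u = u
  unique-↭ (prep x p) (x∉ ∷ u) = All-resp-↭ p x∉ ∷ unique-↭ p u
  unique-↭ (swap x y p) ((x≢y ∷ x∉) ∷ y∉ ∷ u) = ((x≢y ∘ sym) ∷ All-resp-↭ p y∉) ∷ All-resp-↭ p x∉ ∷ unique-↭ p u
  unique-↭ (↭.trans p q) u = unique-↭ q (unique-↭ p u)

  unique-++⁻ʳ : ∀ (xs : List A) {ys} → Unique (xs ++ ys) → Unique ys
  unique-++⁻ʳ [] u = u
  unique-++⁻ʳ (x ∷ xs) (_ ∷ u) = unique-++⁻ʳ xs u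

  unique-++⁻ˡ : ∀ (xs : List A) {ys} → Unique (xs ++ ys) → Unique xs
  unique-++⁻ˡ [] u = []
  unique-++⁻ˡ (x ∷ xs) (x∉ ∷ u) = All.++⁻ˡ xs x∉ ∷ unique-++⁻ˡ xs u

  unique-disjoint : ∀ (xs : List A) {ys} → Unique (xs ++ ys) → ∀ {v} → v ∈ xs → v ∈ ys → ⊥
  unique-disjoint (x ∷ xs) (x∉ ∷ u) (here refl) q = All.lookup (All.++⁻ʳ xs x∉) q refl
  unique-disjoint (x ∷ xs) (x∉ ∷ u) (there p) q = unique-disjoint xs u p q

Simple : ∀ {n} → Sub n → List (Fin n) → Set
Simple C l = Unique l × All (_∈ₛ C) l

simple-↭ : ∀ {n} {C : Sub n} {xs ys} → xs ↭ ys → Simple C xs → Simple C ys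
simple-↭ p (u , a) = unique-↭ p u , All-resp-↭ p a

simple-++⁻ʳ : ∀ {n} {C : Sub n} xs {ys} → Simple C (xs ++ ys) → Simple C ys
simple-++⁻ʳ xs (u , a) = unique-++⁻ʳ xs u , All.++⁻ʳ xs a

simple-++⁻ˡ : ∀ {n} {C : Sub n} xs {ys} → Simple C (xs ++ ys) → Simple C xs
simple-++⁻ˡ xs (u , a) = unique-++⁻ˡ xs u , All.++⁻ˡ xs a

simple-++⁺ : ∀ {n} {C : Sub n} {xs ys} → Simple C xs → Simple C ys → (∀ {v} → v ∈ xs → v ∈ ys → ⊥) → Simple C (xs ++ ys)
simple-++⁺ (u , a) (u′ , a′) d = Unique.++⁺ u u′ (λ (p , q) → d p q) , All.++⁺ a a′

simple-∷ : ∀ {n} {C : Sub n} {v xs} → v ∈ₛ C → v ∉ xs → Simple C xs → Simple C (v ∷ xs)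
simple-∷ p q (u , a) = All.¬Any⇒All¬ _ q ∷ u , p ∷ a

simple-⊆ : ∀ {n} {C D : Sub n} → C ⊆ₛ D → ∀ {l} → Simple C l → Simple D l
simple-⊆ h (u , a) = u , All.map (λ {v} → h v) a

Adj : ∀ {n} → Graph n → Fin n → Fin n → Set
Adj G u v = adj G u v ≡ true

adj-sym : ∀ {n} (G : Graph n) {u v} → Adj G u v → Adj G v u
adj-sym G {u} {v} p = trans (Graph.sym G v u) p

adj⇒≢ : ∀ {n} (G : Graph n) {u v} → Adj G u v → ¬ u ≡ v
adj⇒≢ G {u} p refl = true≢false p (irrefl G u)

IsPath : ∀ {n} → Graph n → Sub n → List (Fin n) → Set
IsPath G C l = Linked (Adj G) l × Simple C l

Free : ∀ {n} → Graph n → Sub n → ℕ → Set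
Free G C p = ∀ l → IsPath G C l → length l ≤ p

-- Connectivity in cut form, so that no walks have to be handled.
Conn : ∀ {n} → Graph n → Sub n → Set
Conn G C = ∀ S u v → u ∈ₛ C → u ∈ₛ S → v ∈ₛ C → S v ≡ false →
  ∃₂ λ a b → (a ∈ₛ C × a ∈ₛ S) × (b ∈ₛ C × S b ≡ false) × Adj G a b

path-⊆ : ∀ {n} (G : Graph n) {C D : Sub n} → C ⊆ₛ D → ∀ {l} → IsPath G C l → IsPath G D l
path-⊆ G h (k , s) = k , simple-⊆ h s

path-reverse : ∀ {n} (G : Graph n) {C : Sub n} {l} → IsPath G C l → IsPath G C (reverse l)
path-reverse G (k , s) = linked-reverse (adj-sym G) k , simple-↭ (↭-sym (↭-reverse _)) s

length-reverse-++ : ∀ {A : Set} (xs ys : List A) → length (reverse xs ++ ys) ≡ length xs + length ys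
length-reverse-++ xs ys = trans (length-++ (reverse xs)) (cong (_+ length ys) (length-reverse xs))

linked-reverse-++ : ∀ {n} (G : Graph n) {u v xs ys} → Linked (Adj G) (u ∷ xs) → Adj G u v → Linked (Adj G) (v ∷ ys) →
  Linked (Adj G) (reverse (u ∷ xs) ++ v ∷ ys)
linked-reverse-++ G {u} {v} {xs} {ys} l r m = subst (λ z → Linked (Adj G) (z ++ v ∷ ys)) (sym (unfold-reverse u xs))
  (linked-++⁺ (reverse xs) (subst (Linked (Adj G)) (unfold-reverse u xs) (linked-reverse (adj-sym G) l)) r m)

-- Pósa's lemma: linked cycles, gap counting, crossing paths

-- A cycle has this property with its full length, and the property survives the addition of an
-- adjacent vertex. It therefore replaces cycles when two disjoint ones are to be linked by cut
-- edges alone.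
Sprouts : ∀ {n} → Graph n → Sub n → ℕ → Set
Sprouts G S a = ∀ s → s ∈ₛ S → ∃ λ q → IsPath G S (s ∷ q) × a ≤ length (s ∷ q)

-- S is enlarged along cut edges, keeping the sprouting property, until it meets Z.
join-sprouts : ∀ {n} (G : Graph n) {C} → Conn G C → ∀ {a b} S Z f → card C ≤ card S + f →
  S ⊆ₛ C → Z ⊆ₛ C → (∃ λ s → s ∈ₛ S) → (∃ λ z → z ∈ₛ Z) → (∀ v → v ∈ₛ S → v ∈ₛ Z → ⊥) →
  Sprouts G S a → Sprouts G Z b → ∃ λ l → IsPath G C l × a + b ≤ length l
join-sprouts G {C} conn {a} {b} S Z f le S⊆ Z⊆ (s₀ , s₀∈) (z₀ , z₀∈) dis sp sz
  with conn S s₀ z₀ (S⊆ s₀ s₀∈) s₀∈ (Z⊆ z₀ z₀∈) (¬true⇒false λ p → dis z₀ p z₀∈)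
... | u , v , (u∈C , u∈S) , (v∈C , v∉S) , uv with bool-cases (Z v)
... | inj₁ v∈Z with sp u u∈S | sz v v∈Z
...   | q , (kq , sq) , aq | r , (kr , sr) , br =
  reverse (v ∷ r) ++ u ∷ q ,
  (linked-reverse-++ G kr (adj-sym G uv) kq ,
   simple-++⁺ (simple-⊆ Z⊆ (simple-↭ (↭-sym (↭-reverse _)) sr)) (simple-⊆ S⊆ sq)
     (λ p q′ → dis _ (All.lookup (proj₂ sq) q′) (All.lookup (proj₂ sr) (∈-resp-↭ (↭-reverse _) p)))) ,
  (begin
    a + b                              ≤⟨ +-mono-≤ aq br ⟩
    length (u ∷ q) + length (v ∷ r)    ≡⟨ +-comm (length (u ∷ q)) _ ⟩
    length (v ∷ r) + length (u ∷ q)    ≡⟨ length-reverse-++ (v ∷ r) (u ∷ q) ⟨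
    length (reverse (v ∷ r) ++ u ∷ q)  ∎)
  where open ≤-Reasoning
join-sprouts G {C} conn {a} {b} S Z f le S⊆ Z⊆ (s₀ , s₀∈) (z₀ , z₀∈) dis sp sz
    | u , v , (u∈C , u∈S) , (v∈C , v∉S) , uv | inj₂ v∉Z = grow f le
  where
  S′ = S ∪ ｛ v ｝
  S⊆S′ : S ⊆ₛ S′
  S⊆S′ j p = ∪-left p
  S′─ : ∀ j → S j ≡ (S′ ─ v) j
  S′─ j with j ≟ v
  ... | yes refl rewrite v∉S = refl
  ... | no _ with S j
  ...   | true = refl
  ...   | false = refl
  v∈S′ : v ∈ₛ S′
  v∈S′ = ∪-right {S v} (∈｛｝ v)
  card′ : card S′ ≡ suc (card S)
  card′ = trans (card-─ S′ v∈S′) (cong suc (sym (card-cong S′─)))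
  sp′ : Sprouts G S′ a
  sp′ s s∈ with ∪-elim {S s} s∈
  ... | inj₁ p = let (q , pq , aq) = sp s p in q , path-⊆ G S⊆S′ pq , aq
  ... | inj₂ p with ∈｛｝⇒≡ {v = v} {s} p
  ...   | refl = let (q , (kq , sq) , aq) = sp u u∈S in u ∷ q ,
            (adj-sym G uv ∷ kq , simple-∷ v∈S′ (λ i → true≢false (All.lookup (proj₂ sq) i) v∉S) (simple-⊆ S⊆S′ sq)) , m≤n⇒m≤1+n aq
  grow : ∀ f → card C ≤ card S + f → _
  grow zero le = ⊥-elim (<⇒≱ (begin-strict
      card S      <⟨ ≤-refl ⟩
      suc (card S) ≡⟨ card′ ⟨
      card S′     ≤⟨ card-mono {A = S′} {C} (λ j p → case ∪-elim {S j} p of λ { (inj₁ q) → S⊆ j q ; (inj₂ q) → subst (_∈ₛ C) (sym (∈｛｝⇒≡ q)) v∈C }) ⟩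
      card C      ∎) (subst (card C ≤_) (+-identityʳ _) le))
    where open ≤-Reasoning
  grow (suc f) le = join-sprouts G conn S′ Z f
    (≤-trans le (≤-reflexive (trans (+-suc (card S) f) (cong (_+ f) (sym card′)))))
    (λ j p → case ∪-elim {S j} p of λ { (inj₁ q) → S⊆ j q ; (inj₂ q) → subst (_∈ₛ C) (sym (∈｛｝⇒≡ q)) v∈C })
    Z⊆ (v , v∈S′) (z₀ , z₀∈)
    (λ j p q → case ∪-elim {S j} p of λ { (inj₁ r) → dis j r q ; (inj₂ r) → true≢false (subst (_∈ₛ Z) (∈｛｝⇒≡ r) q) v∉Z })
    sp′ sz

-- Linear arithmetic certificates: from a ≤ b and the identity c + b + k = d + a.
≤-from : ∀ {a b} → a ≤ b → ∀ {c d} k → c + b + k ≡ d + a → c ≤ d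
≤-from {a} {b} h {c} {d} k eq = +-cancelʳ-≤ a c d (begin
  c + a      ≤⟨ +-monoʳ-≤ c h ⟩
  c + b      ≤⟨ m≤m+n (c + b) k ⟩
  c + b + k  ≡⟨ eq ⟩
  d + a      ∎)
  where open ≤-Reasoning

-- The empty suffix counts as well: reaching the end of a path closes a gap just as a vertex of X
-- does.
HeadIn : ∀ {n} → Sub n → List (Fin n) → Set
HeadIn X [] = ⊤
HeadIn X (s ∷ _) = s ∈ₛ X

Gap : ∀ {n} → (X Y : Sub n) → ℕ → List (Fin n) → Set
Gap X Y g l = ∀ pre v mid suf → l ≡ pre ++ v ∷ mid ++ suf → v ∈ₛ Y → HeadIn X suf → g ≤ length mid

module _ {n : ℕ} (X Y : Sub n) (g : ℕ) (1≤g : 1 ≤ g) where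

  gap-tail : ∀ {v l} → Gap X Y g (v ∷ l) → Gap X Y g l
  gap-tail {v} G pre u mid suf eq = G (v ∷ pre) u mid suf (cong (v ∷_) eq)

  -- Because of 1 ≤ g every Y-vertex has a successor on the list, and that successor is not in X.
  -- Passing to successors injects the Y-vertices into the vertices outside X.
  scan : ∀ l → Gap X Y g l → count X l + count Y l ≤ length l
  -- State after a Y-vertex and e further vertices outside X and Y. The stretch from the last
  -- Y-vertex to the next X-vertex or the end avoids both sets and supplies the summand g; another
  -- Y-vertex restarts it with e = 0.
  scan-pending : ∀ l e → Gap X Y g l →
    (∀ mid suf → l ≡ mid ++ suf → HeadIn X suf → g ≤ e + length mid) →
    count X l + count Y l + g ≤ length l + e

  scan [] G = z≤n
  scan (v ∷ l) G with X v | Y v in yv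
  ... | false | false = m≤n⇒m≤1+n (scan l (gap-tail G))
  ... | true  | false = s≤s (scan l (gap-tail G))
  ... | x     | true  = ≤-from (+-mono-≤ (scan-pending l 0 (gap-tail G) λ mid suf eq → G [] v mid suf (cong (v ∷_) eq) yv) 1≤g)
    (1 ∸ ⟦ x ⟧) (lem x)
    where
    lem : ∀ x → (⟦ x ⟧ + count X l) + (1 + count Y l) + (length l + 0 + g) + (1 ∸ ⟦ x ⟧) ≡ suc (length l) + (count X l + count Y l + g + 1)
    lem true = lem′ (count X l) (count Y l) (length l) g
      where
      lem′ : ∀ a b c d → (1 + a) + (1 + b) + (c + 0 + d) + 0 ≡ suc c + (a + b + d + 1)
      lem′ = solve-∀
    lem false = lem′ (count X l) (count Y l) (length l) g
      where
      lem′ : ∀ a b c d → (0 + a) + (1 + b) + (c + 0 + d) + 1 ≡ suc c + (a + b + d + 1)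
      lem′ = solve-∀

  scan-pending [] e G P = subst (g ≤_) (+-identityʳ e) (P [] [] refl tt)
  scan-pending (v ∷ l) e G P with X v in xv | Y v in yv
  ... | false | false = subst (count X l + count Y l + g ≤_) (+-suc (length l) e)
    (scan-pending l (suc e) (gap-tail G) λ mid suf eq h → subst (g ≤_) (+-suc e _) (P (v ∷ mid) suf (cong (v ∷_) eq) h))
  ... | true  | false = +-mono-≤ (s≤s (scan l (gap-tail G))) (subst (g ≤_) (+-identityʳ e) (P [] (v ∷ l) refl xv))
  ... | false | true  = ≤-from (scan-pending l 0 (gap-tail G) λ mid suf eq → G [] v mid suf (cong (v ∷_) eq) yv)
    e (lem (count X l) (count Y l) (length l) g e)
    where
    lem : ∀ a b c d e → a + (1 + b) + d + (c + 0) + e ≡ suc c + e + (a + b + d)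
    lem = solve-∀
  ... | true  | true  = ≤-from (+-mono-≤ (scan-pending l 0 (gap-tail G) λ mid suf eq → G [] v mid suf (cong (v ∷_) eq) yv)
      (≤-trans 1≤g (subst (g ≤_) (+-identityʳ e) (P [] (v ∷ l) refl xv))))
    0 (lem (count X l) (count Y l) (length l) g e)
    where
    lem : ∀ a b c d e → (1 + a) + (1 + b) + d + (c + 0 + e) + 0 ≡ suc c + e + (a + b + d + 1)
    lem = solve-∀

  -- A single Y-vertex already improves `scan` by g - 1, which is exactly what the degree count in
  -- `posa` needs.
  scan-strict : ∀ l → Gap X Y g l → ∀ {v} → v ∈ l → v ∈ₛ Y → count X l + count Y l + g ≤ suc (length l)
  scan-strict (v ∷ l) G p y with X v in xv | Y v in yv
  ... | x | true = ≤-from (scan-pending l 0 (gap-tail G) λ mid suf eq → G [] v mid suf (cong (v ∷_) eq) yv)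
    (1 ∸ ⟦ x ⟧) (lem x)
    where
    lem : ∀ x → (⟦ x ⟧ + count X l) + (1 + count Y l) + g + (length l + 0) + (1 ∸ ⟦ x ⟧) ≡ suc (suc (length l)) + (count X l + count Y l + g)
    lem true = lem′ (count X l) (count Y l) (length l) g
      where
      lem′ : ∀ a b c d → (1 + a) + (1 + b) + d + (c + 0) + 0 ≡ suc (suc c) + (a + b + d)
      lem′ = solve-∀
    lem false = lem′ (count X l) (count Y l) (length l) g
      where
      lem′ : ∀ a b c d → (0 + a) + (1 + b) + d + (c + 0) + 1 ≡ suc (suc c) + (a + b + d)
      lem′ = solve-∀
  scan-strict (v ∷ l) G (here refl) y | x | false = ⊥-elim (true≢false y yv)
  scan-strict (v ∷ l) G (there p) y | false | false = m≤n⇒m≤1+n (scan-strict l (gap-tail G) p y)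
  scan-strict (v ∷ l) G (there p) y | true  | false = s≤s (scan-strict l (gap-tail G) p y)

count-last : ∀ {n} (X : Sub n) l → count X l ≡ 0 ⊎
  (∃ λ pre → ∃₂ λ v suf → l ≡ pre ++ v ∷ suf × v ∈ₛ X × count X l ≤ suc (length pre))
count-last X [] = inj₁ refl
count-last X (v ∷ l) with count-last X l
... | inj₂ (pre , u , suf , refl , p , c) = inj₂ (v ∷ pre , u , suf , refl , p , +-mono-≤ {⟦ X v ⟧} {1} (b≤1 (X v)) c)
  where
  b≤1 : ∀ b → ⟦ b ⟧ ≤ 1
  b≤1 true = ≤-refl
  b≤1 false = z≤n
... | inj₁ z with X v in eq
...   | false = inj₁ z
...   | true = inj₂ ([] , v , l , refl , eq , s≤s (≤-reflexive z))

count-++ : ∀ {n} (X : Sub n) xs {ys} → count X (xs ++ ys) ≡ count X xs + count X ys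
count-++ X [] = refl
count-++ X (x ∷ xs) = trans (cong (⟦ X x ⟧ +_) (count-++ X xs)) (sym (+-assoc ⟦ X x ⟧ _ _))

setOf-⊆ : ∀ {n} {C : Sub n} {l} → All (_∈ₛ C) l → setOf l ⊆ₛ C
setOf-⊆ a v p = All.lookup a (∈setOf⇒∈ p)

last-split : ∀ {A : Set} (w : A) t → ∃₂ λ t′ v → w ∷ t ≡ t′ ++ [ v ]
last-split w [] = [] , w , refl
last-split w (w′ ∷ t) = let (t′ , v , e) = last-split w′ t in w ∷ t′ , v , cong (w ∷_) e

module _ {n : ℕ} (G : Graph n) where

  -- An initial segment closed up by a chord from its last vertex to x is a cycle, hence sprouts.
  cycle-sprouts : ∀ {C} x A → IsPath G C (x ∷ A) → ∃ λ Z → ∃ λ W → x ∷ A ≡ (x ∷ Z) ++ W ×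
    Sprouts G (setOf (x ∷ Z)) (suc (count (adj G x) A))
  cycle-sprouts x A (k , s) with count-last (adj G x) A
  ... | inj₁ z = [] , A , refl , λ v v∈ → [] , ([-] , (([] ∷ []) , (v∈ ∷ []))) , s≤s (≤-reflexive z)
  ... | inj₂ (pre , v , suf , refl , xv , c) = Z , suf , cong (x ∷_) (sym (++-assoc pre [ v ] suf)) , sprout
    where
    Z = pre ++ [ v ]
    kZ : Linked (Adj G) (x ∷ Z)
    kZ = proj₁ (linked-++⁻ (x ∷ Z) (subst (λ l → Linked (Adj G) (x ∷ l)) (sym (++-assoc pre [ v ] suf)) k))
    uZ : Unique (x ∷ Z)
    uZ = unique-++⁻ˡ (x ∷ Z) (subst (λ l → Unique (x ∷ l)) (sym (++-assoc pre [ v ] suf)) (proj₁ s))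
    sZ : Simple (setOf (x ∷ Z)) (x ∷ Z)
    sZ = uZ , All.tabulate ∈⇒∈setOf
    rotate : ∀ s₁ w t → x ∷ Z ≡ s₁ ++ w ∷ t → Linked (Adj G) ((w ∷ t) ++ s₁)
    rotate [] w t refl = subst (Linked (Adj G)) (cong (x ∷_) (sym (++-identityʳ Z))) kZ
    rotate (_ ∷ s₂) w t eq with ∷-injectiveˡ eq | last-split w t
    ... | refl | t′ , v′ , e = subst (λ z → Linked (Adj G) (z ++ x ∷ s₂)) (sym e)
        (linked-++⁺ t′ (subst (Linked (Adj G)) e (proj₂ k₁₂)) (subst (λ z → Adj G z x) v≡v′ (adj-sym G xv)) (proj₁ k₁₂))
      where
      k₁₂ = linked-++⁻ (x ∷ s₂) (subst (Linked (Adj G)) eq kZ)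
      v≡v′ : v ≡ v′
      v≡v′ = ∷ʳ-injectiveʳ (x ∷ pre) ((x ∷ s₂) ++ t′) (trans eq (trans (cong ((x ∷ s₂) ++_) e) (sym (++-assoc (x ∷ s₂) t′ [ v′ ]))))
    sprout : Sprouts G (setOf (x ∷ Z)) (suc (count (adj G x) (pre ++ v ∷ suf)))
    sprout w w∈ with ∈-∃++ (∈setOf⇒∈ {l = x ∷ Z} w∈)
    ... | s₁ , t , eq = t ++ s₁ , (rotate s₁ w t eq , simple-↭ perm sZ) , (begin
        suc (count (adj G x) (pre ++ v ∷ suf))  ≤⟨ s≤s c ⟩
        suc (suc (length pre))                  ≡⟨ cong suc (sym (trans (length-++ pre) (+-comm (length pre) 1))) ⟩
        length (x ∷ Z)                          ≡⟨ ↭-length perm ⟩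
        length (w ∷ t ++ s₁)                    ∎)
      where
      open ≤-Reasoning
      perm : x ∷ Z ↭ w ∷ t ++ s₁
      perm = ↭-trans (↭-reflexive eq) (++-comm-↭ s₁ (w ∷ t))

  -- If y ~ v and v is followed by a short gap before a neighbour of x (or the end), then the path from x can be cut at
  -- the gap and rearranged to a path that ends in v and continues along the path from y.
  crossing : ∀ {C p} x A y B → Free G C p → Linked (Adj G) (x ∷ A) → Linked (Adj G) (y ∷ B) →
    Simple C (x ∷ A ++ y ∷ B) → ∀ g → p + g ≤ length (x ∷ A) + length (y ∷ B) →
    Gap (adj G x) (adj G y) g (x ∷ A)
  crossing {C} {p} x A y B free kA kB s g le pre v mid suf eq yv hd = +-cancelˡ-≤ p g (length mid) (begin
      p + g                                              ≤⟨ le ⟩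
      length (x ∷ A) + length (y ∷ B)                    ≡⟨ length-++ (x ∷ A) ⟨
      length (x ∷ A ++ y ∷ B)                            ≡⟨ ↭-length perm ⟩
      length (mid ++ L)                                  ≡⟨ length-++ mid ⟩
      length mid + length L                              ≡⟨ +-comm (length mid) _ ⟩
      length L + length mid                              ≤⟨ +-monoˡ-≤ (length mid) (free L (kL , simple-++⁻ʳ mid (simple-↭ perm s))) ⟩
      p + length mid                                     ∎)
    where
    open ≤-Reasoning
    N = pre ++ [ v ]
    L = reverse suf ++ N ++ y ∷ B
    eq′ : x ∷ A ≡ N ++ mid ++ suf
    eq′ = trans eq (sym (++-assoc pre [ v ] (mid ++ suf)))
    perm : x ∷ A ++ y ∷ B ↭ mid ++ L
    perm = begin′
      where
      begin′ = ↭-trans (↭-reflexive (cong (_++ y ∷ B) (trans eq′ (sym (++-assoc N mid suf)))))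
        (↭-trans (++⁺ʳ (y ∷ B) (++⁺ʳ suf (++-comm-↭ N mid)))
        (↭-trans (↭-reflexive (trans (++-assoc (mid ++ N) suf (y ∷ B)) (++-assoc mid N (suf ++ y ∷ B))))
        (++⁺ˡ mid (↭-trans (↭-reflexive (sym (++-assoc N suf (y ∷ B))))
          (↭-trans (++⁺ʳ (y ∷ B) (↭-trans (++-comm-↭ N suf) (++⁺ʳ N (↭-sym (↭-reverse suf)))))
            (↭-reflexive (++-assoc (reverse suf) N (y ∷ B))))))))
    kNms = subst (Linked (Adj G)) eq′ kA
    kN : Linked (Adj G) N
    kN = proj₁ (linked-++⁻ N kNms)
    kS : Linked (Adj G) suf
    kS = proj₂ (linked-++⁻ mid (proj₂ (linked-++⁻ N kNms)))
    kNB : Linked (Adj G) (N ++ y ∷ B)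
    kNB = linked-++⁺ pre kN (adj-sym G yv) kB
    headN : ∃ λ N′ → N ≡ x ∷ N′
    headN = go pre eq
      where
      go : ∀ pre → x ∷ A ≡ pre ++ v ∷ mid ++ suf → ∃ λ N′ → pre ++ [ v ] ≡ x ∷ N′
      go [] refl = [] , refl
      go (_ ∷ pre) refl = pre ++ [ v ] , refl
    kL : Linked (Adj G) L
    kL = go suf hd kS
      where
      go : ∀ suf → HeadIn (adj G x) suf → Linked (Adj G) suf → Linked (Adj G) (reverse suf ++ N ++ y ∷ B)
      go [] _ _ = kNB
      go (t ∷ suf′) xt kt = subst (λ z → Linked (Adj G) (reverse (t ∷ suf′) ++ z ++ y ∷ B)) (sym (proj₂ headN))
        (linked-reverse-++ G kt (adj-sym G xt) (subst (λ z → Linked (Adj G) (z ++ y ∷ B)) (proj₂ headN) kNB))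

  any-or-none : ∀ (Y : Sub n) l → (∃ λ v → v ∈ l × v ∈ₛ Y) ⊎ count Y l ≡ 0
  any-or-none Y l with count-last Y l
  ... | inj₁ z = inj₂ z
  ... | inj₂ (pre , v , suf , refl , p , _) = inj₁ (v , ∈-++⁺ʳ pre (here refl) , p)

  -- Pósa's lemma for two disjoint paths starting in x and y, in the absence of long paths.
  posa : ∀ {C p} x A y B → Conn G C → Free G C p → Linked (Adj G) (x ∷ A) → Linked (Adj G) (y ∷ B) →
    Simple C (x ∷ A ++ y ∷ B) → p < length (x ∷ A) + length (y ∷ B) →
    p ≤ count (adj G x) (A ++ B) + count (adj G y) (A ++ B) → ⊥
  posa {C} {p} x A y B conn free kA kB s lt many = cases (any-or-none (adj G y) A) (any-or-none (adj G x) B)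
    where
    g = length (x ∷ A) + length (y ∷ B) ∸ p
    1≤g : 1 ≤ g
    1≤g = m<n⇒0<n∸m lt
    pg : p + g ≡ length (x ∷ A) + length (y ∷ B)
    pg = m+[n∸m]≡n (<⇒≤ lt)
    s′ : Simple C (y ∷ B ++ x ∷ A)
    s′ = simple-↭ (++-comm-↭ (x ∷ A) (y ∷ B)) s
    gapA : Gap (adj G x) (adj G y) g A
    gapA = gap-tail (adj G x) (adj G y) g 1≤g (crossing x A y B free kA kB s g (≤-reflexive pg))
    gapB : Gap (adj G y) (adj G x) g B
    gapB = gap-tail (adj G y) (adj G x) g 1≤g (crossing y B x A free kB kA s′ g
      (≤-reflexive (trans pg (+-comm (length (x ∷ A)) _))))
    xA = count (adj G x) A
    xB = count (adj G x) B
    yA = count (adj G y) A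
    yB = count (adj G y) B
    many′ : p ≤ (xA + xB) + (yA + yB)
    many′ = subst (p ≤_) (cong₂ _+_ (count-++ (adj G x) A) (count-++ (adj G y) A)) many
    -- Since |A| + |B| + 2 = p + g, the plain counts bound the degree sum only by p + g - 2. One
    -- saving of g - 1 brings it down to p - 1.
    finish : xA + yA + (yB + xB) + g ≤ suc (length A + length B) → ⊥
    finish h = 1+n≰n (≤-from (+-mono-≤ (+-mono-≤ h many′) (≤-reflexive (sym pg)))
        {c = suc p} {d = p} 0 (lem p g (length A) (length B) xA xB yA yB))
      where
      lem : ∀ p g a b xa xb ya yb → suc p + ((suc (a + b) + ((xa + xb) + (ya + yb))) + (p + g)) + 0 ≡
        p + (((xa + ya + (yb + xb) + g) + p) + (suc a + suc b))
      lem = solve-∀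
    cases : _ → _ → ⊥
    cases (inj₁ (v , v∈ , p∈)) _ = finish (≤-from (+-mono-≤ (scan-strict (adj G x) (adj G y) g 1≤g A gapA v∈ p∈) (scan (adj G y) (adj G x) g 1≤g B gapB))
      0 (lem xA yA yB xB g (length A) (length B)))
      where
      lem : ∀ a b c d g m n → a + b + (c + d) + g + (suc m + n) + 0 ≡ suc (m + n) + (a + b + g + (c + d))
      lem = solve-∀
    cases (inj₂ _) (inj₁ (v , v∈ , p∈)) = finish (≤-from (+-mono-≤ (scan (adj G x) (adj G y) g 1≤g A gapA) (scan-strict (adj G y) (adj G x) g 1≤g B gapB v∈ p∈))
      0 (lem xA yA yB xB g (length A) (length B)))
      where
      lem : ∀ a b c d g m n → a + b + (c + d) + g + (m + suc n) + 0 ≡ suc (m + n) + (a + b + (c + d + g))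
      lem = solve-∀
    -- Neither end has a neighbour on the other path, so no gap is available. Instead the initial
    -- pieces of the two paths sprout with xA + 1 and yB + 1 vertices, and linking them gives a path
    -- on at least xA + yB + 2 > p vertices.
    cases (inj₂ yA≡0) (inj₂ xB≡0) with cycle-sprouts {C} x A (kA , simple-++⁻ˡ (x ∷ A) s) | cycle-sprouts {C} y B (kB , simple-++⁻ʳ (x ∷ A) s)
    ... | Z , W , eZ , sprZ | Z′ , W′ , eZ′ , sprZ′
      with join-sprouts G conn (setOf (x ∷ Z)) (setOf (y ∷ Z′)) (card C) (m≤n+m (card C) _)
        (setOf-⊆ (All.++⁻ˡ (x ∷ Z) (subst (All _) eZ (proj₂ (simple-++⁻ˡ (x ∷ A) s)))))
        (setOf-⊆ (All.++⁻ˡ (y ∷ Z′) (subst (All _) eZ′ (proj₂ (simple-++⁻ʳ (x ∷ A) s)))))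
        (x , ∈⇒∈setOf {l = x ∷ Z} (here refl)) (y , ∈⇒∈setOf {l = y ∷ Z′} (here refl))
        (λ v p q → unique-disjoint (x ∷ A) (proj₁ s)
          (subst (v ∈_) (sym eZ) (∈-++⁺ˡ (∈setOf⇒∈ {l = x ∷ Z} p)))
          (subst (v ∈_) (sym eZ′) (∈-++⁺ˡ (∈setOf⇒∈ {l = y ∷ Z′} q))))
        sprZ sprZ′
    ...   | l , path , le = 1+n≰n (≤-from (+-mono-≤ (+-mono-≤ le (free l path)) (subst₂ (λ a b → p ≤ (xA + a) + (b + yB)) xB≡0 yA≡0 many′))
              {c = suc p} {d = p} 1 (lem p (length l) xA yB))
      where
      lem : ∀ p l a b → suc p + ((l + p) + ((a + 0) + (0 + b))) + 1 ≡ p + (((suc a + suc b) + l) + p)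
      lem = solve-∀

-- Saturated graphs

_⊑_ : ∀ {n} → Graph n → Graph n → Set
G ⊑ G′ = ∀ i j → Adj G i j → Adj G′ i j

addEdge : ∀ {n} → Graph n → (x y : Fin n) → ¬ x ≡ y → Graph n
addEdge G x y x≢y = record
  { adj    = λ i j → adj G i j ∨ ((｛ x ｝ i ∧ ｛ y ｝ j) ∨ (｛ y ｝ i ∧ ｛ x ｝ j))
  ; sym    = λ i j → cong₂ _∨_ (Graph.sym G i j)
      (trans (∨-comm (｛ x ｝ i ∧ ｛ y ｝ j) _) (cong₂ _∨_ (∧-comm (｛ y ｝ i) (｛ x ｝ j)) (∧-comm (｛ x ｝ i) (｛ y ｝ j))))
  ; irrefl = λ i → cong₂ _∨_ (irrefl G i) (irr i)
  }
  where
  irr : ∀ i → (｛ x ｝ i ∧ ｛ y ｝ i) ∨ (｛ y ｝ i ∧ ｛ x ｝ i) ≡ false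
  irr i with i ≟ x | i ≟ y
  ... | yes refl | yes refl = ⊥-elim (x≢y refl)
  ... | yes _ | no _ = refl
  ... | no _ | yes _ = refl
  ... | no _ | no _ = refl

-- A pair of disjoint paths in C that the edge xy would link to a path with more than p vertices.
System : ∀ {n} → Graph n → Sub n → ℕ → (x y : Fin n) (A B : List (Fin n)) → Set
System G C p x y A B = Linked (Adj G) (x ∷ A) × Linked (Adj G) (y ∷ B) × Simple C (x ∷ A ++ y ∷ B) ×
  p < length (x ∷ A) + length (y ∷ B)

-- The long path created by the edge xy is described by a system in G itself. The double negation is
-- harmless: a system only ever serves to refute something or to establish adjacency, which is
-- decidable.
Saturated : ∀ {n} → Graph n → Sub n → ℕ → Set
Saturated G C p = ∀ x y → x ∈ₛ C → y ∈ₛ C → ¬ x ≡ y → adj G x y ≡ false → ¬ (∀ A B → ¬ System G C p x y A B)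

conn-⊑ : ∀ {n} {G G′ : Graph n} {C} → G ⊑ G′ → Conn G C → Conn G′ C
conn-⊑ le conn S u v uC uS vC vS = let (a , b , p , q , e) = conn S u v uC uS vC vS in a , b , p , q , le a b e

deg-⊑ : ∀ {n} {G G′ : Graph n} → G ⊑ G′ → ∀ A v → deg G A v ≤ deg G′ A v
deg-⊑ {G = G} {G′} le A v = card-mono {A = A ∩ adj G v} {A ∩ adj G′ v} λ i p → let (a , e) = ∧-true {A i} p in true-∧ a (le v i e)

edges₂-⊑ : ∀ {n} {G G′ : Graph n} → G ⊑ G′ → ∀ A → edges₂ G A ≤ edges₂ G′ A
edges₂-⊑ le A = ∑-mono λ i → ∑-mono λ j → ⟦⟧-mono λ p → let (a , e) = ∧-true {A i ∧ A j} p in true-∧ a (le i j e)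

module _ {n : ℕ} (G : Graph n) (x y : Fin n) (x≢y : ¬ x ≡ y) where

  private
    G⁺ = addEdge G x y x≢y

  ⊑-addEdge : G ⊑ G⁺
  ⊑-addEdge i j p = ∪-left p

  addEdge-new : Adj G⁺ x y
  addEdge-new = ∪-right {adj G x y} (∪-left (true-∧ (∈｛｝ x) (∈｛｝ y)))

  addEdge-elim : ∀ {i j} → Adj G⁺ i j → Adj G i j ⊎ (i ≡ x × j ≡ y) ⊎ (i ≡ y × j ≡ x)
  addEdge-elim {i} {j} p with ∪-elim {adj G i j} p
  ... | inj₁ q = inj₁ q
  ... | inj₂ q with ∪-elim {｛ x ｝ i ∧ ｛ y ｝ j} q
  ...   | inj₁ r = inj₂ (inj₁ (∈｛｝⇒≡ (proj₁ (∧-true r)) , ∈｛｝⇒≡ (proj₂ (∧-true {｛ x ｝ i} r))))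
  ...   | inj₂ r = inj₂ (inj₂ (∈｛｝⇒≡ (proj₁ (∧-true r)) , ∈｛｝⇒≡ (proj₂ (∧-true {｛ y ｝ i} r))))

  edges₂-addEdge : ∀ {C} → x ∈ₛ C → y ∈ₛ C → adj G x y ≡ false → 2 + edges₂ G C ≤ edges₂ G⁺ C
  edges₂-addEdge {C} x∈ y∈ ¬xy = begin
    2 + edges₂ G C                              ≡⟨ cong (2 +_) (edges₂-remove G C x∈) ⟩
    2 + (edges₂ G (C ─ x) + 2 * deg G C x)      ≡⟨ lem (edges₂ G (C ─ x)) (deg G C x) ⟩
    edges₂ G (C ─ x) + 2 * suc (deg G C x)      ≤⟨ +-mono-≤ (edges₂-⊑ {G = G} {G⁺} ⊑-addEdge (C ─ x)) (*-monoʳ-≤ 2 more) ⟩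
    edges₂ G⁺ (C ─ x) + 2 * deg G⁺ C x          ≡⟨ edges₂-remove G⁺ C x∈ ⟨
    edges₂ G⁺ C                                 ∎
    where
    open ≤-Reasoning
    lem : ∀ a b → 2 + (a + 2 * b) ≡ a + 2 * suc b
    lem = solve-∀
    more : suc (deg G C x) ≤ deg G⁺ C x
    more = subst (suc (deg G C x) ≤_) (sym (card-─ (C ∩ adj G⁺ x) (true-∧ y∈ addEdge-new)))
      (s≤s (card-mono {A = C ∩ adj G x} {(C ∩ adj G⁺ x) ─ y} λ i p → let (a , e) = ∧-true {C i} p in
        ∈-─ {A = C ∩ adj G⁺ x} (true-∧ a (⊑-addEdge x i e)) λ { refl → true≢false e ¬xy }))

  -- A path visits x and y at most once each, so it uses the new edge at most once.
  linked-addEdge : ∀ {l} → Linked (Adj G⁺) l → Unique l → Linked (Adj G) l ⊎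
    (∃₂ λ s t → ∃₂ λ u v → l ≡ (s ++ [ u ]) ++ v ∷ t × Linked (Adj G) (s ++ [ u ]) × Linked (Adj G) (v ∷ t) ×
      ((u ≡ x × v ≡ y) ⊎ (u ≡ y × v ≡ x)))
  linked-addEdge [] u = inj₁ []
  linked-addEdge [-] u = inj₁ [-]
  linked-addEdge {a ∷ b ∷ l} (r ∷ k) (a∉ ∷ un) with linked-addEdge k un | addEdge-elim r
  ... | inj₁ k′ | inj₁ r′ = inj₁ (r′ ∷ k′)
  ... | inj₁ k′ | inj₂ ab = inj₂ ([] , l , a , b , refl , [-] , k′ , ab)
  ... | inj₂ (s , t , u , v , eq , k₁ , k₂ , uv) | inj₂ ab = ⊥-elim (All.lookup a∉ (subst (a ∈_) (sym eq) a∈) refl)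
    where
    a∈ : a ∈ (s ++ [ u ]) ++ v ∷ t
    a∈ = go ab uv
      where
      go : (a ≡ x × b ≡ y) ⊎ (a ≡ y × b ≡ x) → (u ≡ x × v ≡ y) ⊎ (u ≡ y × v ≡ x) → a ∈ (s ++ [ u ]) ++ v ∷ t
      go (inj₁ (refl , _)) (inj₁ (refl , _)) = ∈-++⁺ˡ (∈-++⁺ʳ s (here refl))
      go (inj₁ (refl , _)) (inj₂ (_ , refl)) = ∈-++⁺ʳ (s ++ [ u ]) (here refl)
      go (inj₂ (refl , _)) (inj₁ (_ , refl)) = ∈-++⁺ʳ (s ++ [ u ]) (here refl)
      go (inj₂ (refl , _)) (inj₂ (refl , _)) = ∈-++⁺ˡ (∈-++⁺ʳ s (here refl))
  ... | inj₂ ([] , t , u , v , refl , k₁ , k₂ , uv) | inj₁ r′ = inj₂ (a ∷ [] , t , u , v , refl , r′ ∷ [-] , k₂ , uv)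
  ... | inj₂ (b ∷ s , t , u , v , refl , k₁ , k₂ , uv) | inj₁ r′ = inj₂ (a ∷ b ∷ s , t , u , v , refl , r′ ∷ k₁ , k₂ , uv)

  free-addEdge : ∀ {C p} → Free G C p → (∀ A B → ¬ System G C p x y A B) → Free G⁺ C p
  free-addEdge {C} {p} free none l (k , sm) with linked-addEdge k (proj₁ sm)
  ... | inj₁ k′ = free l (k′ , sm)
  ... | inj₂ (s , t , u , v , refl , k₁ , k₂ , uv) = ≮⇒≥ λ lt → contra lt uv
    where
    kr : Linked (Adj G) (u ∷ reverse s)
    kr = subst (Linked (Adj G)) (reverse-++ s [ u ]) (linked-reverse (adj-sym G) k₁)
    perm : (s ++ [ u ]) ++ v ∷ t ↭ u ∷ reverse s ++ v ∷ t
    perm = ++⁺ʳ (v ∷ t) (↭-trans (++-comm-↭ s [ u ]) (prep u (↭-sym (↭-reverse s))))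
    len : length ((s ++ [ u ]) ++ v ∷ t) ≡ length (u ∷ reverse s) + length (v ∷ t)
    len = trans (↭-length perm) (length-++ (u ∷ reverse s))
    contra : p < length ((s ++ [ u ]) ++ v ∷ t) → (u ≡ x × v ≡ y) ⊎ (u ≡ y × v ≡ x) → ⊥
    contra lt (inj₁ (refl , refl)) = none (reverse s) t (kr , k₂ , simple-↭ perm sm , subst (p <_) len lt)
    contra lt (inj₂ (refl , refl)) = none t (reverse s) (k₂ , kr ,
      simple-↭ (↭-trans perm (++-comm-↭ (u ∷ reverse s) (v ∷ t))) sm , subst (p <_) (trans len (+-comm (length (u ∷ reverse s)) _)) lt)

-- The fuel `f` bounds the doubled number of missing edges. The alternatives are kept apart because
-- a proper saturation has an edge to spare, and that edge later absorbs the additional edge for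
-- even P.
saturate : ∀ {n} (C : Sub n) p f (G : Graph n) → Free G C p → card C * (card C ∸ 1) ≤ edges₂ G C + f →
  ¬ ¬ (Saturated G C p ⊎ ∃ λ G′ → G ⊑ G′ × Free G′ C p × Saturated G′ C p × 2 + edges₂ G C ≤ edges₂ G′ C)
saturate C p f G free le k = k (inj₁ λ x y x∈ y∈ x≢y ¬xy none → step f le x y x∈ y∈ x≢y ¬xy none)
  where
  step : ∀ f → card C * (card C ∸ 1) ≤ edges₂ G C + f → ∀ x y → x ∈ₛ C → y ∈ₛ C → ¬ x ≡ y → adj G x y ≡ false →
    (∀ A B → ¬ System G C p x y A B) → ⊥
  step zero le x y x∈ y∈ x≢y ¬xy none = <⇒≱ (begin-strict
    card C * (card C ∸ 1)          ≤⟨ le ⟩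
    edges₂ G C + 0                 ≡⟨ +-identityʳ _ ⟩
    edges₂ G C                     <⟨ m<n+m (edges₂ G C) {2} z<s ⟩
    2 + edges₂ G C                 ≤⟨ edges₂-addEdge G x y x≢y {C} x∈ y∈ ¬xy ⟩
    edges₂ (addEdge G x y x≢y) C   ∎) (edges₂≤ (addEdge G x y x≢y) C)
    where open ≤-Reasoning
  step (suc f) le x y x∈ y∈ x≢y ¬xy none = saturate C p f G⁺ free⁺ le′ λ
    { (inj₁ sat) → k (inj₂ (G⁺ , ⊑-addEdge G x y x≢y , free⁺ , sat , more))
    ; (inj₂ (G′ , le , free′ , sat , more′)) → k (inj₂ (G′ , (λ i j e → le i j (⊑-addEdge G x y x≢y i j e)) , free′ , sat ,
        ≤-trans more (≤-trans (m≤n+m _ 2) more′))) }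
    where
    G⁺ = addEdge G x y x≢y
    free⁺ = free-addEdge G x y x≢y free none
    more = edges₂-addEdge G x y x≢y {C} x∈ y∈ ¬xy
    le′ : card C * (card C ∸ 1) ≤ edges₂ G⁺ C + f
    le′ = ≤-trans le (≤-trans (≤-reflexive (+-suc (edges₂ G C) f)) (+-monoˡ-≤ f (≤-trans (n≤1+n _) more)))

deg≤count : ∀ {n} (G : Graph n) {A : Sub n} {x} l → (∀ v → v ∈ₛ A → Adj G x v → v ∈ l) → deg G A x ≤ count (adj G x) l
deg≤count G {A} {x} l h = ≤-trans (card≤count (A ∩ adj G x) l λ v p → let (a , e) = ∧-true {A v} p in h v a e) (cm l)
  where
  cm : ∀ l → count (A ∩ adj G x) l ≤ count (adj G x) l
  cm [] = z≤n
  cm (v ∷ l) = +-mono-≤ (⟦⟧-mono λ p → proj₂ (∧-true {A v} p)) (cm l)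

module _ {n : ℕ} (G : Graph n) {C : Sub n} {p : ℕ} (conn : Conn G C) (free : Free G C p) where

  no-link : ∀ {x y A B} → System G C p x y A B → adj G x y ≡ false
  no-link {x} {y} {A} {B} (kA , kB , s , lt) = ¬true⇒false λ xy → <⇒≱ lt (subst (_≤ p) (length-reverse-++ (x ∷ A) (y ∷ B))
    (free _ (linked-reverse-++ G kA xy kB , simple-↭ (++⁺ʳ (y ∷ B) (↭-sym (↭-reverse (x ∷ A)))) s)))

  system-swap : ∀ {x y A B} → System G C p x y A B → System G C p y x B A
  system-swap {x} {y} {A} {B} (kA , kB , s , lt) = kB , kA , simple-↭ (++-comm-↭ (x ∷ A) (y ∷ B)) s ,
    subst (p <_) (+-comm (length (x ∷ A)) _) lt

  -- By `no-link` the ends x and y are not adjacent, so counting neighbours along the whole system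
  -- gives the same numbers as in `posa`.
  system-degrees : ∀ {x y A B} → System G C p x y A B →
    count (adj G x) (x ∷ A ++ y ∷ B) + count (adj G y) (x ∷ A ++ y ∷ B) < p
  system-degrees {x} {y} {A} {B} sys@(kA , kB , s , lt) = ≰⇒> λ le →
    posa G x A y B conn free kA kB s lt (subst (p ≤_) (cong₂ _+_ cx cy) le)
    where
    cx : count (adj G x) (x ∷ A ++ y ∷ B) ≡ count (adj G x) (A ++ B)
    cx rewrite irrefl G x | count-++ (adj G x) A {y ∷ B} | no-link sys = sym (count-++ (adj G x) A)
    cy : count (adj G y) (x ∷ A ++ y ∷ B) ≡ count (adj G y) (A ++ B)
    cy rewrite no-link (system-swap sys) | count-++ (adj G y) A {y ∷ B} | irrefl G y = sym (count-++ (adj G y) A)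

  private
    -- A neighbour of x off the system can be put in front of x. It is chosen in X so that the
    -- degree hypothesis holds again at the new end.
    extend : ∀ {x y A B} (X : Sub n) → X ⊆ₛ C → System G C p x y A B →
      deg G X x ≤ count (adj G x) (x ∷ A ++ y ∷ B) ⊎ (∃ λ z → z ∈ₛ X × System G C p z y (x ∷ A) B)
    extend {x} {y} {A} {B} X X⊆ (kA , kB , s , lt) with card ((X ∩ adj G x) ∖ setOf L) in eq
      where L = x ∷ A ++ y ∷ B
    ... | zero = inj₁ (deg≤count G (x ∷ A ++ y ∷ B) λ v v∈ xv → ∈setOf⇒∈ (onPath v v∈ xv))
      where
      L = x ∷ A ++ y ∷ B
      onPath : ∀ v → v ∈ₛ X → Adj G x v → v ∈ₛ setOf L
      onPath v v∈ xv with bool-cases (setOf L v)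
      ... | inj₁ q = q
      ... | inj₂ q = ⊥-elim (n≮0 (subst (0 <_) eq (∃⇒card>0 {A = (X ∩ adj G x) ∖ setOf L} (true-∧ (true-∧ v∈ xv) (not-true q)))))
    ... | suc _ with card>0⇒∃ ((X ∩ adj G x) ∖ setOf (x ∷ A ++ y ∷ B)) (subst (0 <_) (sym eq) z<s)
    ...   | z , q = let (a , b) = ∧-true {(X ∩ adj G x) z} q ; (z∈ , xz) = ∧-true {X z} a in
            inj₂ (z , z∈ , (adj-sym G xz ∷ kA) , kB ,
              simple-∷ (X⊆ z z∈) (λ i → true≢false (∈⇒∈setOf i) (true-not b)) s , m≤n⇒m≤1+n lt)

    -- When a system can be extended at neither end, it contains all X-neighbours of x and all
    -- Y-neighbours of y. These are at least α + β ≥ p in number, against `system-degrees`. The fuel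
    -- bounds the vertices of C not yet on the system.
    no-system : ∀ {X Y α β} → X ⊆ₛ C → Y ⊆ₛ C → (∀ v → v ∈ₛ X → α ≤ deg G X v) → (∀ v → v ∈ₛ Y → β ≤ deg G Y v) →
      p ≤ α + β → ∀ f {x y A B} → x ∈ₛ X → y ∈ₛ Y → System G C p x y A B →
      card C ≤ length (x ∷ A) + length (y ∷ B) + f → ⊥
    no-system {X} {Y} X⊆ Y⊆ dX dY le f {x} {y} {A} {B} x∈ y∈ sys fuel with extend X X⊆ sys | extend Y Y⊆ (system-swap sys)
    ... | inj₁ cx | inj₁ cy = <⇒≱ (system-degrees sys) (≤-trans le (+-mono-≤ (≤-trans (dX x x∈) cx)
              (≤-trans (≤-trans (dY y y∈) cy) (≤-reflexive (count-swap (adj G y) (y ∷ B) (x ∷ A))))))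
      where
      count-swap : ∀ (Z : Sub n) xs ys → count Z (xs ++ ys) ≡ count Z (ys ++ xs)
      count-swap Z xs ys = trans (count-++ Z xs) (trans (+-comm (count Z xs) _) (sym (count-++ Z ys)))
    no-system {X} {Y} X⊆ Y⊆ dX dY le zero {x} {y} {A} {B} x∈ y∈ sys fuel | inj₂ (z , z∈ , (_ , _ , (u , a) , _)) | _ =
      <⇒≱ (subst (_< card C) (length-++ (x ∷ A)) (unique-length≤card C _ u a)) (subst (card C ≤_) (+-identityʳ _) fuel)
    no-system {X} {Y} X⊆ Y⊆ dX dY le (suc f) {x} {y} {A} {B} x∈ y∈ sys fuel | inj₂ (z , z∈ , sys′) | _ =
      no-system X⊆ Y⊆ dX dY le f z∈ y∈ sys′ (subst (card C ≤_) (+-suc _ f) fuel)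
    no-system {X} {Y} X⊆ Y⊆ dX dY le zero {x} {y} {A} {B} x∈ y∈ sys fuel | inj₁ _ | inj₂ (z , z∈ , (_ , _ , (u , a) , _)) =
      <⇒≱ (subst (_< card C) (trans (length-++ (y ∷ B)) (+-comm (length (y ∷ B)) _)) (unique-length≤card C _ u a)) (subst (card C ≤_) (+-identityʳ _) fuel)
    no-system {X} {Y} X⊆ Y⊆ dX dY le (suc f) {x} {y} {A} {B} x∈ y∈ sys fuel | inj₁ _ | inj₂ (z , z∈ , sys′) =
      no-system X⊆ Y⊆ dX dY le f x∈ z∈ (system-swap sys′)
        (subst (card C ≤_) (trans (+-suc _ f) (cong (_+ f) (sym (+-suc (length (x ∷ A)) _)))) fuel)

  -- Kopylov's key step: a nonadjacent pair (x , y) with a longest system contradicts Pósa's lemma.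
  joined : Saturated G C p → ∀ {X Y α β} → X ⊆ₛ C → Y ⊆ₛ C →
    (∀ v → v ∈ₛ X → α ≤ deg G X v) → (∀ v → v ∈ₛ Y → β ≤ deg G Y v) → p ≤ α + β →
    ∀ {x y} → x ∈ₛ X → y ∈ₛ Y → ¬ x ≡ y → Adj G x y
  joined sat {X} {Y} X⊆ Y⊆ dX dY le {x} {y} x∈ y∈ x≢y with bool-cases (adj G x y)
  ... | inj₁ q = q
  ... | inj₂ q = ⊥-elim (sat x y (X⊆ x x∈) (Y⊆ y y∈) x≢y q λ A B sys →
          no-system X⊆ Y⊆ dX dY le (card C) x∈ y∈ sys (m≤n+m (card C) _))

-- Cores

MinDeg : ∀ {n} → Graph n → ℕ → Sub n → Set
MinDeg G t D = ∀ v → v ∈ₛ D → t < deg G D v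

IsCore : ∀ {n} → Graph n → ℕ → Sub n → Sub n → Set
IsCore G t C D = D ⊆ₛ C × MinDeg G t D × (∀ E → E ⊆ₛ C → MinDeg G t E → E ⊆ₛ D)

module _ {n : ℕ} (G : Graph n) (t : ℕ) where

  low-vertex : ∀ C → MinDeg G t C ⊎ (∃ λ v → v ∈ₛ C × deg G C v ≤ t)
  low-vertex C with any? (λ v → (C v Bool.≟ true) ×-dec (deg G C v ≤? t))
  ... | yes q = inj₂ q
  ... | no q = inj₁ λ v v∈ → ≰⇒> λ le → q (v , v∈ , le)

  core : ∀ f C → card C ≤ f → ∃ (IsCore G t C)
  core f C le with low-vertex C
  ... | inj₁ md = C , (λ v p → p) , md , λ E E⊆ _ → E⊆
  core zero C le | inj₂ (v , v∈ , _) = ⊥-elim (<⇒≱ (∃⇒card>0 {A = C} v∈) le)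
  core (suc f) C le | inj₂ (v , v∈ , low) with core f (C ─ v) (≤-pred (subst (_≤ suc f) (card-─ C v∈) le))
  ... | D , D⊆ , md , mx = D , (λ u p → ─⊆ {A = C} {v} u (D⊆ u p)) , md , λ E E⊆ mE →
          mx E (λ u p → ∈-─ {A = C} (E⊆ u p) λ { refl → <⇒≱ (mE u p) (≤-trans (deg-mono G {E} {C} u E⊆) low) }) mE

  core-─ : ∀ {C D v} → IsCore G t C D → D v ≡ false → IsCore G t (C ─ v) D
  core-─ {C} {D} {v} (D⊆ , md , mx) v∉ = (λ u p → ∈-─ {A = C} (D⊆ u p) λ { refl → true≢false p v∉ }) , md ,
    λ E E⊆ → mx E λ u p → ─⊆ {A = C} {v} u (E⊆ u p)

  low⇒∉core : ∀ {C D v} → IsCore G t C D → deg G C v ≤ t → D v ≡ false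
  low⇒∉core {C} {D} {v} (D⊆ , md , mx) low = ¬true⇒false λ p → <⇒≱ (md v p) (≤-trans (deg-mono G {D} {C} v D⊆) low)

  -- A set larger than its core has a vertex of degree at most t, so the deletion of such vertices
  -- can be halted at any size m that is not below |D|.
  disintegrate : ∀ f {C D} → IsCore G t C D → ∀ {m} → card D ≤ m → card C ≡ f + m →
    ∃ λ M → D ⊆ₛ M × M ⊆ₛ C × card M ≡ m × edges₂ G C ≤ edges₂ G M + 2 * t * f
  disintegrate zero {C} (D⊆ , _) _ eq = C , D⊆ , (λ _ p → p) , eq , m≤m+n _ _
  disintegrate (suc f) {C} {D} isCore@(D⊆ , md , mx) {m} le eq with low-vertex C
  ... | inj₁ mC = ⊥-elim (<⇒≱ (s≤s (m≤n+m m f)) (subst (_≤ m) eq (≤-trans (card-mono {A = C} {D} (mx C (λ _ p → p) mC)) le)))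
  ... | inj₂ (v , v∈ , low) with disintegrate f (core-─ isCore (low⇒∉core isCore low)) le (suc-injective (trans (sym (card-─ C v∈)) eq))
  ...   | M , D⊆M , M⊆ , cM , eM = M , D⊆M , (λ u p → ─⊆ {A = C} {v} u (M⊆ u p)) , cM , (begin
          edges₂ G C                                  ≡⟨ edges₂-remove G C v∈ ⟩
          edges₂ G (C ─ v) + 2 * deg G C v            ≤⟨ +-mono-≤ eM (*-monoʳ-≤ 2 low) ⟩
          edges₂ G M + 2 * t * f + 2 * t              ≡⟨ lem (edges₂ G M) t f ⟩
          edges₂ G M + 2 * t * suc f                  ∎)
    where
    open ≤-Reasoning
    lem : ∀ a t f → a + 2 * t * f + 2 * t ≡ a + 2 * t * suc f
    lem = solve-∀

-- Complete cores and Kopylov's alternative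

Enum : ∀ {n} → Sub n → ℕ → Set
Enum A f = ∃ λ l → Unique l × All (_∈ₛ A) l × length l ≡ f × (∀ v → v ∈ₛ A → v ∈ l)

enum : ∀ {n} f (A : Sub n) → card A ≡ f → Enum A f
enum zero A eq = [] , [] , [] , refl , λ v p → ⊥-elim (n≮0 (subst (0 <_) eq (∃⇒card>0 {A = A} p)))
enum (suc f) A eq with card>0⇒∃ A (subst (0 <_) (sym eq) z<s)
... | v , v∈ with enum f (A ─ v) (suc-injective (trans (sym (card-─ A v∈)) eq))
...   | l , u , a , len , cov = v ∷ l , All.map (λ {j} p → ∈-─⇒≢ {A = A} {v} {j} p ∘ sym) a ∷ u ,
          v∈ ∷ All.map (λ {j} → ─⊆ {A = A} {v} j) a , cong suc len , cov′
  where
  cov′ : ∀ j → j ∈ₛ A → j ∈ v ∷ l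
  cov′ j p with j ≟ v
  ... | yes q = here q
  ... | no q = there (cov j (∈-─ {A = A} p q))

Complete : ∀ {n} → Graph n → Sub n → Set
Complete G D = ∀ {x y} → x ∈ₛ D → y ∈ₛ D → ¬ x ≡ y → Adj G x y

linked-complete : ∀ {n} {G : Graph n} {D} → Complete G D → ∀ {l} → Unique l → All (_∈ₛ D) l → Linked (Adj G) l
linked-complete cp [] [] = []
linked-complete cp {x ∷ []} u a = [-]
linked-complete {G = G} {D} cp {x ∷ y ∷ l} ((x≢y ∷ _) ∷ u) (px ∷ py ∷ a) = cp px py x≢y ∷ linked-complete {G = G} {D} cp u (py ∷ a)

complete-deg : ∀ {n} {G : Graph n} {D} → Complete G D → ∀ {v} → v ∈ₛ D → card D ≤ suc (deg G D v)
complete-deg {G = G} {D} cp {v} v∈ = subst (_≤ suc (deg G D v)) (sym (card-─ D v∈))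
  (s≤s (card-mono {A = D ─ v} {D ∩ adj G v} λ j p → true-∧ (─⊆ {A = D} {v} j p) (cp v∈ (─⊆ {A = D} {v} j p) λ q → ∈-─⇒≢ {A = D} {v} {j} p (sym q))))

-- The second outcome of Kopylov's argument: a complete core D such that C disintegrates to D with threshold a = p − |D|.
Kopylov₂ : ∀ {n} → Graph n → Sub n → (p σ : ℕ) → Set
Kopylov₂ G C p σ = ∃₂ λ D a → IsCore G σ C D × Complete G D × suc (suc σ) ≤ card D × card D + a ≡ p ×
  edges₂ G C + 2 * a * card D ≤ card D * (card D ∸ 1) + 2 * a * card C

kopylov : ∀ {n} (G : Graph n) {C p σ} → Conn G C → Free G C p → Saturated G C p →
  2 * σ < p → p ≤ 2 * σ + 2 → p ≤ card C →
  edges₂ G C + σ * suc σ ≤ 2 * σ * card C ⊎ Kopylov₂ G C p σ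
kopylov {n} G {C} {p} {σ} conn free sat lo hi pc with core G σ (card C) C ≤-refl
... | D , isCore@(D⊆ , md , mx) with card D ≤? σ
-- Halting the deletion at σ vertices leaves at most σ(σ - 1) doubled edges, and each of the |C| - σ
-- deleted vertices accounts for at most 2σ.
...   | yes d≤σ = inj₁ (begin
          edges₂ G C + σ * suc σ                                       ≤⟨ +-monoˡ-≤ (σ * suc σ) eM ⟩
          edges₂ G M + 2 * σ * (card C ∸ σ) + σ * suc σ                ≤⟨ +-monoˡ-≤ (σ * suc σ) (+-monoˡ-≤ (2 * σ * (card C ∸ σ)) (subst (λ m → edges₂ G M ≤ m * (m ∸ 1)) cM (edges₂≤ G M))) ⟩
          σ * (σ ∸ 1) + 2 * σ * (card C ∸ σ) + σ * suc σ               ≡⟨ lem σ (card C ∸ σ) ⟩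
          2 * σ * (card C ∸ σ + σ)                                     ≡⟨ cong (2 * σ *_) (m∸n+n≡m σ≤c) ⟩
          2 * σ * card C                                               ∎)
  where
  open ≤-Reasoning
  σ≤c : σ ≤ card C
  σ≤c = ≤-trans (≤-trans (m≤m+n σ _) (<⇒≤ lo)) pc
  dis = disintegrate G σ (card C ∸ σ) isCore d≤σ (sym (m∸n+n≡m σ≤c))
  M = proj₁ dis
  cM : card M ≡ σ
  cM = proj₁ (proj₂ (proj₂ (proj₂ dis)))
  eM = proj₂ (proj₂ (proj₂ (proj₂ dis)))
  lem : ∀ s r → s * (s ∸ 1) + 2 * s * r + s * suc s ≡ 2 * s * (r + s)
  lem zero r = refl
  lem (suc s) r = lem′ s r
    where
    lem′ : ∀ s r → suc s * s + 2 * suc s * r + suc s * suc (suc s) ≡ 2 * suc s * (r + suc s)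
    lem′ = solve-∀
...   | no d≰σ = inj₂ (D , a , isCore , cp , d≥ , da , bound)
  where
  d>0 : 0 < card D
  d>0 = ≤-<-trans z≤n (≰⇒> d≰σ)
  d≥ : suc (suc σ) ≤ card D
  d≥ = let (v , v∈) = card>0⇒∃ D d>0 in ≤-<-trans (md v v∈) (deg<card G v∈)
  -- Degrees in D are at least σ + 1, and 2(σ + 1) ≥ p.
  cp : Complete G D
  cp = joined G conn free sat D⊆ D⊆ md md (≤-trans hi (≤-reflexive (lem σ)))
    where
    lem : ∀ s → 2 * s + 2 ≡ suc s + suc s
    lem = solve-∀
  d≤p : card D ≤ p
  d≤p = let (l , u , al , len , _) = enum (card D) D refl in
    subst (_≤ p) len (free l (linked-complete {G = G} {D} cp u al , (u , All.map (λ {v} → D⊆ v) al)))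
  a = p ∸ card D
  da : card D + a ≡ p
  da = m+[n∸m]≡n d≤p
  a≤σ : a ≤ σ
  a≤σ = ≤-from (+-mono-≤ (+-mono-≤ hi d≥) (≤-reflexive da)) 0 (lem a σ p (card D))
    where
    lem : ∀ a s p d → a + ((2 * s + 2 + d) + p) + 0 ≡ s + (p + suc (suc s) + (d + a))
    lem = solve-∀
  D′ = proj₁ (core G a (card C) C ≤-refl)
  isCore′ : IsCore G a C D′
  isCore′ = proj₂ (core G a (card C) C ≤-refl)
  D⊆D′ : D ⊆ₛ D′
  D⊆D′ = proj₂ (proj₂ isCore′) D D⊆ (λ v v∈ → ≤-<-trans a≤σ (md v v∈))
  dX : ∀ v → v ∈ₛ D → card D ∸ 1 ≤ deg G D v
  dX v v∈ = pred-mono-≤ (complete-deg {G = G} {D} cp v∈)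
  -- A vertex y of the a-core outside D has degree at least a + 1 there, vertices of D have degree
  -- at least |D| - 1 in D, and the sum is p. So y is joined to all of D, and D with y added
  -- contradicts the maximality of the σ-core.
  D′⊆D : D′ ⊆ₛ D
  D′⊆D y y∈ with bool-cases (D y)
  ... | inj₁ q = q
  ... | inj₂ y∉ = mx E E⊆ mE y (∪-right {D y} (∈｛｝ y))
    where
    E = D ∪ ｛ y ｝
    D⊆E : D ⊆ₛ E
    D⊆E v p = ∪-left p
    E⊆ : E ⊆ₛ C
    E⊆ v p with ∪-elim {D v} p
    ... | inj₁ q = D⊆ v q
    ... | inj₂ q = subst (_∈ₛ C) (sym (∈｛｝⇒≡ q)) (proj₁ isCore′ y y∈)
    adj-y : ∀ x → x ∈ₛ D → Adj G x y
    adj-y x x∈ = joined G conn free sat {D} {D′} {card D ∸ 1} {suc a} D⊆ (proj₁ isCore′) dX (proj₁ (proj₂ isCore′))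
      (≤-reflexive (trans (sym da) (trans (cong (_+ a) (sym (m+[n∸m]≡n {1} d>0))) (sym (+-suc _ a))))) x∈ y∈ λ { refl → true≢false x∈ y∉ }
    mE : MinDeg G σ E
    mE v v∈ with ∪-elim {D v} v∈
    ... | inj₁ q = <-≤-trans (md v q) (deg-mono G {D} {E} v D⊆E)
    ... | inj₂ q with ∈｛｝⇒≡ {v = y} {v} q
    ...   | refl = <-≤-trans (≤-trans (n≤1+n _) d≥) (card-mono {A = D} {E ∩ adj G v} λ j p → true-∧ (D⊆E j p) (adj-sym G (adj-y j p)))
  cD : card D ≡ card D′
  cD = ≤-antisym (card-mono {A = D} {D′} D⊆D′) (card-mono {A = D′} {D} D′⊆D)
  d≤c : card D ≤ card C
  d≤c = card-mono {A = D} {C} D⊆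
  bound : edges₂ G C + 2 * a * card D ≤ card D * (card D ∸ 1) + 2 * a * card C
  bound with disintegrate G a (card C ∸ card D) isCore′ (≤-reflexive (sym cD)) (sym (m∸n+n≡m d≤c))
  ... | M , _ , _ , cM , eM = begin
      edges₂ G C + 2 * a * card D                                            ≤⟨ +-monoˡ-≤ (2 * a * card D) eM ⟩
      edges₂ G M + 2 * a * (card C ∸ card D) + 2 * a * card D                ≡⟨ lem (edges₂ G M) a (card C ∸ card D) (card D) ⟩
      edges₂ G M + 2 * a * (card C ∸ card D + card D)                        ≡⟨ cong (λ z → edges₂ G M + 2 * a * z) (m∸n+n≡m d≤c) ⟩
      edges₂ G M + 2 * a * card C                                            ≤⟨ +-monoˡ-≤ (2 * a * card C) (subst (λ m → edges₂ G M ≤ m * (m ∸ 1)) cM (edges₂≤ G M)) ⟩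
      card D * (card D ∸ 1) + 2 * a * card C                                 ∎
    where
    open ≤-Reasoning
    lem : ∀ e a c d → e + 2 * a * c + 2 * a * d ≡ e + 2 * a * (c + d)
    lem = solve-∀

-- Longest paths and their ends

longest : ∀ {n} (G : Graph n) {C p} → Free G C p → ∀ f l → IsPath G C l → p ≤ length l + f →
  ¬ ¬ (∃ λ l′ → IsPath G C l′ × Free G C (length l′))
longest G free f l pl le k = k (l , pl , λ l′ pl′ → ≮⇒≥ λ lt → step f le l′ pl′ lt)
  where
  step : ∀ f → _ ≤ length l + f → ∀ l′ → IsPath G _ l′ → length l < length l′ → ⊥
  step zero le l′ pl′ lt = <⇒≱ lt (≤-trans (free l′ pl′) (subst (_ ≤_) (+-identityʳ _) le))
  step (suc f) le l′ pl′ lt = longest G free f l′ pl′ (≤-trans le (≤-trans (≤-reflexive (+-suc _ f)) (+-monoˡ-≤ f lt))) k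

simple-cover : ∀ {n} {C : Sub n} {l} → Simple C l → card C ≤ length l → ∀ v → v ∈ₛ C → v ∈ l
simple-cover {C = C} {l} (u , a) le v v∈ with bool-cases (setOf l v)
... | inj₁ q = ∈setOf⇒∈ q
... | inj₂ q = ⊥-elim (<⇒≱ (unique-length≤card C (v ∷ l)
        (All.¬Any⇒All¬ l (λ i → true≢false (∈⇒∈setOf i) q) ∷ u) (v∈ ∷ a)) le)

linked-cut : ∀ {n} (G : Graph n) (S : Sub n) l → Linked (Adj G) l → All (_∈ₛ S) l ⊎ All (λ v → S v ≡ false) l ⊎
  (∃₂ λ a b → a ∈ l × b ∈ l × a ∈ₛ S × S b ≡ false × Adj G a b)
linked-cut G S [] k = inj₁ []
linked-cut G S (v ∷ []) k with bool-cases (S v)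
... | inj₁ q = inj₁ (q ∷ [])
... | inj₂ q = inj₂ (inj₁ (q ∷ []))
linked-cut G S (v ∷ w ∷ l) (r ∷ k) with linked-cut G S (w ∷ l) k | bool-cases (S v)
... | inj₁ a | inj₁ q = inj₁ (q ∷ a)
... | inj₁ (b ∷ a) | inj₂ q = inj₂ (inj₂ (w , v , there (here refl) , here refl , b , q , adj-sym G r))
... | inj₂ (inj₁ (b ∷ a)) | inj₁ q = inj₂ (inj₂ (v , w , here refl , there (here refl) , q , b , r))
... | inj₂ (inj₁ a) | inj₂ q = inj₂ (inj₁ (q ∷ a))
... | inj₂ (inj₂ (a , b , a∈ , b∈ , rest)) | _ = inj₂ (inj₂ (a , b , there a∈ , there b∈ , rest))

module _ {n : ℕ} (G : Graph n) {C : Sub n} where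

  end-neighbours : ∀ {x A} → IsPath G C (x ∷ A) → Free G C (length (x ∷ A)) → ∀ v → v ∈ₛ C → Adj G x v → v ∈ A
  end-neighbours {x} {A} (k , s) free v v∈ xv with bool-cases (setOf (x ∷ A) v)
  ... | inj₂ q = ⊥-elim (1+n≰n (free (v ∷ x ∷ A) (adj-sym G xv ∷ k , simple-∷ v∈ (λ i → true≢false (∈⇒∈setOf i) q) s)))
  ... | inj₁ q with ∈setOf⇒∈ {l = x ∷ A} q
  ...   | here refl = ⊥-elim (adj⇒≢ G xv refl)
  ...   | there r = r

  -- The remaining path keeps all neighbours of the removed end together.
  conn-remove-end : ∀ {x A} → Conn G C → IsPath G C (x ∷ A) → Free G C (length (x ∷ A)) → Conn G (C ─ x)
  conn-remove-end {x} {A} conn path@(k , (x∉ ∷ _ , _ ∷ A⊆)) free S u v u∈ u∈S v∈ v∉S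
    with linked-cut G S A (proj₂ (linked-++⁻ [ x ] k))
  ... | inj₂ (inj₂ (a , b , a∈ , b∈ , a∈S , b∉S , ab)) = a , b , (inC a a∈ , a∈S) , (inC b b∈ , b∉S) , ab
    where
    inC : ∀ a → a ∈ A → a ∈ₛ (C ─ x)
    inC a a∈ = ∈-─ {A = C} (All.lookup A⊆ a∈) (λ q → All.lookup x∉ a∈ (sym q))
  ... | inj₁ A∈S with conn (S ∪ ｛ x ｝) u v (─⊆ {A = C} {x} u u∈) (∪-left u∈S) (─⊆ {A = C} {x} v v∈)
        (¬true⇒false λ q → case ∪-elim {S v} q of λ { (inj₁ r) → true≢false r v∉S ; (inj₂ r) → ∈-─⇒≢ {A = C} {x} {v} v∈ (∈｛｝⇒≡ r) })
  ...   | a , b , (a∈C , a∈S∪) , (b∈C , b∉) , ab = a , b , (∈-─ {A = C} a∈C a≢x , a∈S) , (∈-─ {A = C} b∈C b≢x , b∉S) , ab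
    where
    b∉S : S b ≡ false
    b∉S = ¬true⇒false λ q → true≢false (∪-left q) b∉
    b≢x : ¬ b ≡ x
    b≢x refl = true≢false (∪-right {S b} (∈｛｝ b)) b∉
    a≢x : ¬ a ≡ x
    a≢x refl = true≢false (All.lookup A∈S (end-neighbours path free b b∈C ab)) b∉S
    a∈S : a ∈ₛ S
    a∈S with ∪-elim {S a} a∈S∪
    ... | inj₁ q = q
    ... | inj₂ q = ⊥-elim (a≢x (∈｛｝⇒≡ q))
  conn-remove-end {x} {A} conn path@(k , (x∉ ∷ _ , _ ∷ A⊆)) free S u v u∈ u∈S v∈ v∉S | inj₂ (inj₁ A∉S)
    with conn (S ─ x) u v (─⊆ {A = C} {x} u u∈) (∈-─ {A = S} u∈S (∈-─⇒≢ {A = C} {x} {u} u∈)) (─⊆ {A = C} {x} v v∈)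
        (¬true⇒false λ q → true≢false (─⊆ {A = S} {x} v q) v∉S)
  ...   | a , b , (a∈C , a∈S─) , (b∈C , b∉) , ab = a , b , (∈-─ {A = C} a∈C (∈-─⇒≢ {A = S} {x} {a} a∈S─) , a∈S) , (∈-─ {A = C} b∈C b≢x , b∉S) , ab
    where
    a∈S : a ∈ₛ S
    a∈S = ─⊆ {A = S} {x} a a∈S─
    b≢x : ¬ b ≡ x
    b≢x refl = true≢false a∈S (All.lookup A∉S (end-neighbours path free a a∈C (adj-sym G ab)))
    b∉S : S b ≡ false
    b∉S = ¬true⇒false λ q → true≢false (∈-─ {A = S} q b≢x) b∉

  -- Connectivity gives an edge from a path vertex a to a vertex g off the path. Cutting the path
  -- behind a and appending g there yields a system for the two ends with one vertex more than a
  -- longest path, so `system-degrees` applies.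
  end-degrees : ∀ {x A y B} → Conn G C → IsPath G C (x ∷ A) → Free G C (length (x ∷ A)) → reverse (x ∷ A) ≡ y ∷ B →
    length (x ∷ A) < card C → deg G C x + deg G C y < length (x ∷ A)
  end-degrees {x} {A} {y} {B} conn path@(k , s@(u , al)) free rev lt
    with card<⇒∃ (setOf (x ∷ A)) C (≤-<-trans (≤-trans (card≤count (setOf (x ∷ A)) (x ∷ A) λ v → ∈setOf⇒∈) (count≤ (x ∷ A))) lt)
    where
    count≤ : ∀ l → count (setOf (x ∷ A)) l ≤ length l
    count≤ [] = z≤n
    count≤ (v ∷ l) with setOf (x ∷ A) v
    ... | true = s≤s (count≤ l)
    ... | false = m≤n⇒m≤1+n (count≤ l)
  ... | w , w∈ , w∉ with conn (setOf (x ∷ A)) x w (All.lookup al (here refl)) (∈⇒∈setOf {l = x ∷ A} (here refl)) w∈ w∉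
  ... | a , g , (a∈C , a∈l) , (g∈C , g∉l) , ag with ∈-∃++ (∈setOf⇒∈ {l = x ∷ A} a∈l)
  -- Here a is the last vertex, and g would prolong the longest path.
  ... | l₁ , [] , eq = ⊥-elim (1+n≰n (subst (_≤ length (x ∷ A)) (cong suc (length-reverse (x ∷ A))) (free (g ∷ reverse (x ∷ A))
          (subst (λ z → Linked (Adj G) (g ∷ z)) (sym revl) (adj-sym G ag ∷ subst (Linked (Adj G)) revl (linked-reverse (adj-sym G) k)) ,
           simple-∷ g∈C (λ i → true≢false (∈⇒∈setOf (∈-resp-↭ (↭-reverse (x ∷ A)) i)) g∉l) (simple-↭ (↭-sym (↭-reverse (x ∷ A))) s)))))
    where
    revl : reverse (x ∷ A) ≡ a ∷ reverse l₁
    revl = trans (cong reverse eq) (reverse-++ l₁ [ a ])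
  ... | l₁ , b ∷ l₂ , eq with last-split b l₂ | headOf l₁ eq
    where
    headOf : ∀ l₁ → x ∷ A ≡ l₁ ++ a ∷ b ∷ l₂ → ∃ λ A₁ → (l₁ ++ [ a ]) ++ [ g ] ≡ x ∷ A₁
    headOf [] refl = [ g ] , refl
    headOf (_ ∷ l₁) refl = (l₁ ++ [ a ]) ++ [ g ] , refl
  ... | t , y′ , e | A₁ , hd = subst (λ z → deg G C x + deg G C z < length (x ∷ A)) y′≡y
          (≤-<-trans (+-mono-≤ (deg≤count G L λ v v∈ xv → onL v (there (end-neighbours path free v v∈ xv)))
            (deg≤count G L λ v v∈ yv → onL v (∈-resp-↭ (↭-reverse (x ∷ A)) (subst (v ∈_) (sym revl) (there (end-neighbours path′ free′ v v∈ yv))))))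
            (system-degrees G conn free sys))
    where
    L = x ∷ A₁ ++ y′ ∷ reverse t
    eq₂ : x ∷ A ≡ (l₁ ++ [ a ]) ++ b ∷ l₂
    eq₂ = trans eq (sym (++-assoc l₁ [ a ] (b ∷ l₂)))
    revb : reverse (b ∷ l₂) ≡ y′ ∷ reverse t
    revb = trans (cong reverse e) (reverse-++ t [ y′ ])
    revl : reverse (x ∷ A) ≡ y′ ∷ (reverse t ++ reverse (l₁ ++ [ a ]))
    revl = trans (cong reverse eq₂) (trans (reverse-++ (l₁ ++ [ a ]) (b ∷ l₂)) (cong (_++ reverse (l₁ ++ [ a ])) revb))
    y′≡y : y′ ≡ y
    y′≡y = ∷-injectiveˡ (trans (sym revl) rev)
    path′ : IsPath G C (y′ ∷ (reverse t ++ reverse (l₁ ++ [ a ])))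
    path′ = subst (IsPath G C) revl (path-reverse G path)
    free′ : Free G C (length (y′ ∷ (reverse t ++ reverse (l₁ ++ [ a ]))))
    free′ = subst (λ z → Free G C (length z)) revl (subst (Free G C) (sym (length-reverse (x ∷ A))) free)
    perm : g ∷ x ∷ A ↭ L
    perm = ↭-trans (↭-trans (↭-reflexive (cong (g ∷_) eq₂)) (++⁺ʳ (b ∷ l₂) (++-comm-↭ [ g ] (l₁ ++ [ a ]))))
      (↭-trans (++⁺ˡ ((l₁ ++ [ a ]) ++ [ g ]) (↭-trans (↭-sym (↭-reverse (b ∷ l₂))) (↭-reflexive revb)))
        (↭-reflexive (cong (_++ y′ ∷ reverse t) hd)))
    onL : ∀ v → v ∈ x ∷ A → v ∈ L
    onL v i = ∈-resp-↭ perm (there i)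
    kk = linked-++⁻ (l₁ ++ [ a ]) (subst (Linked (Adj G)) eq₂ k)
    sys : System G C (length (x ∷ A)) x y′ A₁ (reverse t)
    sys = subst (Linked (Adj G)) hd (linked-++⁺ l₁ (proj₁ kk) ag [-]) ,
      subst (Linked (Adj G)) revb (linked-reverse (adj-sym G) (proj₂ kk)) ,
      simple-↭ perm (simple-∷ g∈C (λ i → true≢false (∈⇒∈setOf i) g∉l) s) ,
      ≤-reflexive (trans (↭-length perm) (length-++ (x ∷ A₁)))

-- By `end-degrees` the ends of a longest path have degree sum below 2s + 2, so one of them has
-- degree at most s.
removable-end : ∀ {n} (G : Graph n) {C s} → Conn G C → Free G C (2 * s + 2) → 2 * s + 2 < card C →
  ¬ ¬ (∃ λ v → v ∈ₛ C × deg G C v ≤ s × Conn G (C ─ v))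
removable-end {n} G {C} {s} conn free lt k with card>0⇒∃ C (≤-<-trans z≤n lt)
... | v₀ , v₀∈ = longest G free (2 * s + 2) [ v₀ ] ([-] , ([] ∷ [] , v₀∈ ∷ [])) (m≤n+m _ 1) go
  where
  go : ¬ (∃ λ l → IsPath G C l × Free G C (length l))
  go ([] , _ , fr) = 1+n≰n (fr [ v₀ ] ([-] , ([] ∷ [] , v₀∈ ∷ [])))
  go (x ∷ A , path , fr) with last-split x A
  ... | t , y , e = case deg G C x ≤? s of λ
      { (yes low) → k (x , All.lookup (proj₂ (proj₂ path)) (here refl) , low , conn-remove-end G conn path fr)
      ; (no high) → k (y , All.lookup (proj₂ (proj₂ pathʳ)) (here refl) , low′ (≰⇒> high) , conn-remove-end G conn pathʳ frʳ) }
    where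
    rev : reverse (x ∷ A) ≡ y ∷ reverse t
    rev = trans (cong reverse e) (reverse-++ t [ y ])
    pathʳ : IsPath G C (y ∷ reverse t)
    pathʳ = subst (IsPath G C) rev (path-reverse G path)
    len≤ : length (x ∷ A) ≤ 2 * s + 2
    len≤ = free _ path
    frʳ : Free G C (length (y ∷ reverse t))
    frʳ = subst (λ z → Free G C (length z)) rev (subst (Free G C) (sym (length-reverse (x ∷ A))) fr)
    low′ : s < deg G C x → deg G C y ≤ s
    low′ hx = ≤-from (+-mono-≤ (+-mono-≤ (end-degrees G conn path fr rev (≤-<-trans len≤ lt)) len≤) hx) 0
      (lem (deg G C x) (deg G C y) (length (x ∷ A)) s)
      where
      lem : ∀ dx dy l s → dy + ((l + (2 * s + 2)) + dx) + 0 ≡ s + ((suc (dx + dy) + l) + suc s)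
      lem = solve-∀

-- The extremal configuration with one additional edge

inter : ∀ {A : Set} → List A → List A → List A
inter [] ds = ds
inter (o ∷ os) [] = o ∷ os
inter (o ∷ os) (d ∷ ds) = o ∷ d ∷ inter os ds

inter-↭ : ∀ {A : Set} (os ds : List A) → inter os ds ↭ os ++ ds
inter-↭ [] ds = ↭-refl
inter-↭ (o ∷ os) [] = ↭-reflexive (sym (++-identityʳ (o ∷ os)))
inter-↭ (o ∷ os) (d ∷ ds) = prep o (↭-trans (prep d (inter-↭ os ds)) (↭-sym (shift d os ds)))

module _ {A : Set} {R : A → A → Set} (R-sym : ∀ {x y} → R x y → R y x) where

  -- Each inserted vertex stands between two consecutive vertices of `d ∷ ss`, all of which are
  -- joined to it. The links of `ss ++ rs` itself matter only behind the last insertion.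
  inter-linked : ∀ d os ss rs → length os ≤ length ss → All (λ o → R o d × All (R o) ss) os → Linked R (d ∷ ss ++ rs) →
    Linked R (d ∷ inter os (ss ++ rs))
  inter-linked d [] ss rs _ _ l = l
  inter-linked d (o ∷ os) (d′ ∷ ss) rs (s≤s le) ((od , od′ ∷ _) ∷ a) (_ ∷ l) =
    R-sym od ∷ od′ ∷ inter-linked d′ os ss rs le (All.map (λ { (_ , p ∷ q) → p , q }) a) l

  inter-linked′ : ∀ os ss rs → 0 < length os → length os ≤ length ss → All (λ o → All (R o) ss) os → Linked R (ss ++ rs) →
    Linked R (inter os (ss ++ rs))
  inter-linked′ (o ∷ os) (d ∷ ss) rs _ (s≤s le) ((od ∷ _) ∷ a) l =
    od ∷ inter-linked d os ss rs le (All.map (λ { (p ∷ q) → p , q }) a) l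

  alternating-linked : ∀ os ss → length os ≡ suc (length ss) → All (λ o → All (R o) ss) os → Linked R (inter os ss)
  alternating-linked (o ∷ []) [] _ _ = [-]
  alternating-linked (o ∷ o′ ∷ os) (d ∷ ss) eq ((od ∷ _) ∷ a@((o′d ∷ _) ∷ _)) =
    od ∷ go ss (alternating-linked (o′ ∷ os) ss (suc-injective eq) (All.map (λ { (_ ∷ q) → q }) a))
    where
    go : ∀ ss → Linked R (inter (o′ ∷ os) ss) → Linked R (d ∷ inter (o′ ∷ os) ss)
    go [] l = R-sym o′d ∷ l
    go (_ ∷ _) l = R-sym o′d ∷ l

Split : ∀ {A : Set} → List A → ℕ → ℕ → Set
Split l a b = ∃₂ λ l₁ l₂ → l ≡ l₁ ++ l₂ × length l₁ ≡ a × length l₂ ≡ b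

split-length : ∀ {A : Set} a {b} (l : List A) → length l ≡ a + b → Split l a b
split-length zero l eq = [] , l , refl , refl , eq
split-length (suc a) (x ∷ l) eq = let (l₁ , l₂ , e , p , q) = split-length a l (suc-injective eq) in x ∷ l₁ , l₂ , cong (x ∷_) e , cong suc p , q

TwoPaths : ∀ {n} → Graph n → Sub n → ℕ → ℕ → Set
TwoPaths G C a b = ∃₂ λ l₁ l₂ → Linked (Adj G) l₁ × Linked (Adj G) l₂ × Simple C (l₁ ++ l₂) × length l₁ ≡ a × length l₂ ≡ b

does⇒ : ∀ {P : Set} (d : Dec P) → does d ≡ true → P
does⇒ (yes p) _ = p

-- C spans at least as many edges as the join of K_s with K_2 and isolated vertices on |C| vertices.
-- The inequality is written without subtraction.
Tight : ∀ {n} → Graph n → Sub n → ℕ → Set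
Tight G C s = suc (suc s) * suc s + 2 * s * card C ≤ edges₂ G C + 2 * s * suc (suc s)

-- The vertices S of D with neighbours outside D become universal in any saturation of C, so that C ∖ D turns out
-- to be independent and completely joined to S.
module Extremal {n : ℕ} (G : Graph n) {C D : Sub n} {s : ℕ} (conn : Conn G C) (free : Free G C (2 * s + 2))
  (isCore : IsCore G s C D) (cp : Complete G D) (cD : card D ≡ suc (suc s)) (cC : card C ≡ 2 * s + 3) (tight : Tight G C s) where

  private
    D⊆ = proj₁ isCore
    md = proj₁ (proj₂ isCore)

  O : Sub n
  O = C ∖ D

  O⊆ : O ⊆ₛ C
  O⊆ v p = proj₁ (∧-true {C v} p)

  O∉D : ∀ {v} → v ∈ₛ O → D v ≡ false
  O∉D {v} p = true-not (proj₂ (∧-true {C v} p))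

  cO : card O ≡ suc s
  cO = +-cancelˡ-≡ (card D) _ _ (begin
    card D + card O           ≡⟨ cong (_+ card O) (≤-antisym (card-mono {A = D} {C ∩ D} λ v p → true-∧ (D⊆ v p) p)
                                   (card-mono {A = C ∩ D} {D} λ v p → proj₂ (∧-true {C v} p))) ⟩
    card (C ∩ D) + card O     ≡⟨ card-split C D ⟨
    card C                    ≡⟨ cC ⟩
    2 * s + 3                 ≡⟨ lem s ⟩
    suc (suc s) + suc s       ≡⟨ cong (_+ suc s) cD ⟨
    card D + suc s            ∎)
    where
    open ≡-Reasoning
    lem : ∀ s → 2 * s + 3 ≡ suc (suc s) + suc s
    lem = solve-∀

  tight′ : suc (suc s) * suc s + 2 * s * suc s ≤ edges₂ G C
  tight′ = ≤-from tight 0 (trans (lem s (edges₂ G C)) (cong (λ c → edges₂ G C + (suc (suc s) * suc s + 2 * s * c)) (sym cC)))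
    where
    lem : ∀ s e → suc (suc s) * suc s + 2 * s * suc s + (e + 2 * s * suc (suc s)) + 0 ≡ e + (suc (suc s) * suc s + 2 * s * (2 * s + 3))
    lem = solve-∀

  -- The vertex o may be deleted first, followed by s vertices of degree at most s, leaving s + 2
  -- vertices. With less than s edges lost at o the tight count would not be reached.
  deg-O : ∀ o → o ∈ₛ O → s ≤ deg G C o
  deg-O o o∈ = ≮⇒≥ contra
    where
    o∈C = O⊆ o o∈
    c─ : card (C ─ o) ≡ s + suc (suc s)
    c─ = suc-injective (trans (sym (card-─ C o∈C)) (trans cC (lem s)))
      where
      lem : ∀ s → 2 * s + 3 ≡ suc (s + suc (suc s))
      lem = solve-∀
    contra : deg G C o < s → ⊥
    contra lt with disintegrate G s s (core-─ G s isCore (O∉D o∈)) {suc (suc s)} (≤-reflexive cD) c─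
    ... | M , _ , _ , cM , eM = 1+n≰n (≤-from (+-mono-≤ (+-mono-≤ tight′ (≤-trans (≤-reflexive (edges₂-remove G C o∈C)) (+-monoˡ-≤ _ eM)))
            (+-mono-≤ (subst (λ m → edges₂ G M ≤ m * (m ∸ 1)) cM (edges₂≤ G M)) (+-mono-≤ lt lt)))
            {suc (edges₂ G C)} {edges₂ G C} 1 (lem s (edges₂ G C) (edges₂ G M) (deg G C o)))
      where
      lem : ∀ s e m d → suc e + ((e + (m + 2 * s * s + 2 * d)) + (suc (suc s) * suc s + (s + s))) + 1 ≡
        e + ((suc (suc s) * suc s + 2 * s * suc s + e) + (m + (suc d + suc d)))
      lem = solve-∀

  S : Sub n
  S v = D v ∧ does (1 ≤? deg G O v)

  S⊆D : S ⊆ₛ D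
  S⊆D v p = proj₁ (∧-true {D v} p)

  nbr∈S : ∀ {v o} → v ∈ₛ D → o ∈ₛ O → Adj G v o → v ∈ₛ S
  nbr∈S {v} {o} v∈ o∈ vo = true-∧ v∈ (dec-true (1 ≤? deg G O v) (∃⇒card>0 {A = O ∩ adj G v} (true-∧ o∈ vo)))

  deg-S : ∀ v → v ∈ₛ S → suc (suc s) ≤ deg G C v
  deg-S v v∈ = begin
    suc (suc s)                                             ≡⟨ +-comm 1 (suc s) ⟩
    suc s + 1                                               ≤⟨ +-mono-≤ (md v (S⊆D v v∈)) (does⇒ (1 ≤? deg G O v) (proj₂ (∧-true {D v} v∈))) ⟩
    deg G D v + deg G O v                                   ≤⟨ +-mono-≤
      (card-mono {A = D ∩ adj G v} {(C ∩ adj G v) ∩ D} λ j p → let (a , b) = ∧-true {D j} p in true-∧ (true-∧ (D⊆ j a) b) a)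
      (card-mono {A = O ∩ adj G v} {(C ∩ adj G v) ∖ D} λ j p → let (a , b) = ∧-true {O j} p in true-∧ (true-∧ (O⊆ j a) b) (not-true (O∉D a))) ⟩
    card ((C ∩ adj G v) ∩ D) + card ((C ∩ adj G v) ∖ D)     ≡⟨ card-split (C ∩ adj G v) D ⟨
    deg G C v                                               ∎
    where open ≤-Reasoning

  -- If the deletion is halted one vertex z above D, tightness forces z to have s neighbours in D,
  -- and these belong to S.
  s≤cS : s ≤ card S
  s≤cS with disintegrate G s s isCore {suc (suc (suc s))} (≤-trans (≤-reflexive cD) (n≤1+n _)) (trans cC (lem s))
    where
    lem : ∀ s → 2 * s + 3 ≡ s + suc (suc (suc s))
    lem = solve-∀
  ... | M , D⊆M , M⊆ , cM , eM with card<⇒∃ D M (≤-reflexive (trans (cong suc cD) (sym cM)))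
  ...   | z , z∈M , z∉D = begin
      s                ≤⟨ degz ⟩
      deg G M z        ≡⟨ deg-remove-self G M z ⟨
      deg G (M ─ z) z  ≤⟨ card-mono {A = (M ─ z) ∩ adj G z} {S} (λ j p → let (a , b) = ∧-true {(M ─ z) j} p in
                          nbr∈S (M─⊆D j a) (true-∧ (M⊆ z z∈M) (not-true z∉D)) (adj-sym G b)) ⟩
      card S           ∎
    where
    open ≤-Reasoning
    cM─ : card (M ─ z) ≡ suc (suc s)
    cM─ = suc-injective (trans (sym (card-─ M z∈M)) cM)
    M─⊆D : (M ─ z) ⊆ₛ D
    M─⊆D = ⊆∧card≥⇒⊇ {A = D} {M ─ z} (λ j p → ∈-─ {A = M} (D⊆M j p) λ { refl → true≢false p z∉D }) (≤-reflexive (trans cM─ (sym cD)))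
    degz : s ≤ deg G M z
    degz = *-cancelˡ-≤ 2 (≤-from (+-mono-≤ (+-mono-≤ tight′ eM) (+-mono-≤ (≤-reflexive (edges₂-remove G M z∈M))
        (subst (λ m → edges₂ G (M ─ z) ≤ m * (m ∸ 1)) cM─ (edges₂≤ G (M ─ z))))) 0
        (lem s (edges₂ G C) (edges₂ G M) (edges₂ G (M ─ z)) (deg G M z)))
      where
      lem : ∀ s c m r d → 2 * s + ((c + (m + 2 * s * s)) + ((r + 2 * d) + suc (suc s) * suc s)) + 0 ≡
        2 * d + ((suc (suc s) * suc s + 2 * s * suc s + c) + (m + r))
      lem = solve-∀

  module Saturation {G′ : Graph n} (G⊑ : G ⊑ G′) (free′ : Free G′ C (2 * s + 2)) (sat : Saturated G′ C (2 * s + 2)) where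

    -- As |C| = p + 1 for p = 2s + 2, a system covers C, so degrees in C are counted in full. Their
    -- sum (s + 2) + s = p contradicts `system-degrees` without any extension of the system.
    universal : ∀ {v o} → v ∈ₛ S → o ∈ₛ O → Adj G′ v o
    universal {v} {o} v∈ o∈ with bool-cases (adj G′ v o)
    ... | inj₁ q = q
    ... | inj₂ q = ⊥-elim (sat v o (D⊆ v (S⊆D v v∈)) (O⊆ o o∈) (λ { refl → true≢false (S⊆D v v∈) (O∉D o∈) }) q λ A B sys →
            <⇒≱ (system-degrees G′ (conn-⊑ {G = G} {G′} G⊑ conn) free′ sys) (begin
              2 * s + 2                     ≡⟨ lem s ⟩
              suc (suc s) + s               ≤⟨ +-mono-≤ (≤-trans (deg-S v v∈) (deg-⊑ {G = G} {G′} G⊑ C v)) (≤-trans (deg-O o o∈) (deg-⊑ {G = G} {G′} G⊑ C o)) ⟩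
              deg G′ C v + deg G′ C o       ≤⟨ +-mono-≤ (deg≤count G′ {C} {v} (v ∷ A ++ o ∷ B) λ j j∈ _ → cover A B sys j j∈)
                                                  (deg≤count G′ {C} {o} (v ∷ A ++ o ∷ B) λ j j∈ _ → cover A B sys j j∈) ⟩
              _                             ∎))
      where
      open ≤-Reasoning
      lem : ∀ s → 2 * s + 2 ≡ suc (suc s) + s
      lem = solve-∀
      cover : ∀ A B → System G′ C (2 * s + 2) v o A B → ∀ j → j ∈ₛ C → j ∈ v ∷ A ++ o ∷ B
      cover A B (_ , _ , sm , lt) = simple-cover sm (begin
        card C                             ≡⟨ cC ⟩
        2 * s + 3                          ≡⟨ +-suc (2 * s) 2 ⟩
        suc (2 * s + 2)                    ≤⟨ lt ⟩
        length (v ∷ A) + length (o ∷ B)    ≡⟨ length-++ (v ∷ A) ⟨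
        length (v ∷ A ++ o ∷ B)            ∎)

    complete′ : ∀ {l} → Unique l → All (_∈ₛ D) l → Linked (Adj G′) l
    complete′ = linked-complete {G = G′} {D} (λ a b c → G⊑ _ _ (cp a b c))

    too-long : ∀ os ds → Linked (Adj G′) (inter os ds) → Simple C (os ++ ds) → length os + length ds ≤ 2 * s + 2
    too-long os ds k sm = subst (_≤ 2 * s + 2) (trans (↭-length (inter-↭ os ds)) (length-++ os))
      (free′ _ (k , simple-↭ (↭-sym (inter-↭ os ds)) sm))

    rest-O∪D : ∀ {os ds} → Unique os → All (_∈ₛ O) os → Unique ds → All (_∈ₛ D) ds → Simple C (os ++ ds)
    rest-O∪D uo ao ud ad = simple-++⁺ (uo , All.map (λ {v} → O⊆ v) ao) (ud , All.map (λ {v} → D⊆ v) ad)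
      λ p q → true≢false (All.lookup ad q) (O∉D (All.lookup ao p))

    universal-All : ∀ {os ss} → All (_∈ₛ O) os → All (_∈ₛ S) ss → All (λ o → All (Adj G′ o) ss) os
    universal-All ao as = All.map (λ o∈ → All.map (λ d∈ → adj-sym G′ (universal d∈ o∈)) as) ao

    DList : Set
    DList = ∃₂ λ ss rs → Unique (ss ++ rs) × All (_∈ₛ S) ss × All (_∈ₛ D) (ss ++ rs) × length ss ≡ card S × length ss + length rs ≡ suc (suc s)

    D-list : DList
    D-list with enum (card S) S refl | enum (card (D ∖ S)) (D ∖ S) refl
    ... | ss , us , as , ls , _ | rs , ur , ar , lr , _ = ss , rs ,
      Unique.++⁺ us ur (λ (p , q) → true≢false (All.lookup as p) (true-not (proj₂ (∧-true {D _} (All.lookup ar q))))) , as ,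
      All.++⁺ (All.map (λ {v} → S⊆D v) as) (All.map (λ {v} p → proj₁ (∧-true {D v} p)) ar) , ls ,
      (begin
        length ss + length rs        ≡⟨ cong₂ _+_ ls lr ⟩
        card S + card (D ∖ S)        ≡⟨ cong (_+ card (D ∖ S)) (≤-antisym (card-mono {A = S} {D ∩ S} λ v p → true-∧ (S⊆D v p) p) (card-mono {A = D ∩ S} {S} λ v p → proj₂ (∧-true {D v} p))) ⟩
        card (D ∩ S) + card (D ∖ S)  ≡⟨ card-split D S ⟨
        card D                       ≡⟨ cD ⟩
        suc (suc s)                  ∎)
      where open ≡-Reasoning

    -- With s + 1 universal vertices all of O could be interleaved with S and the path continued
    -- through the rest of D, which gives a path on 2s + 3 vertices.
    cS≤s : card S ≤ s
    cS≤s = go D-list (enum (suc s) O cO)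
      where
      open ≤-Reasoning
      lem : ∀ s → suc (2 * s + 2) ≡ suc s + suc (suc s)
      lem = solve-∀
      go : DList → Enum O (suc s) → card S ≤ s
      go (ss , rs , u , as , ad , ls , l+) (os , uo , ao , lo , _) = ≮⇒≥ λ lt → 1+n≰n (begin
        suc (2 * s + 2)                ≡⟨ lem s ⟩
        suc s + suc (suc s)            ≡⟨ cong₂ _+_ lo (trans (length-++ ss) l+) ⟨
        length os + length (ss ++ rs)  ≤⟨ too-long os (ss ++ rs)
            (inter-linked′ (adj-sym G′) os ss rs (subst (0 <_) (sym lo) z<s) (subst₂ _≤_ (sym lo) (sym ls) lt) (universal-All ao as) (complete′ u ad))
            (rest-O∪D uo ao u ad) ⟩
        2 * s + 2                      ∎)

    cS : card S ≡ s
    cS = ≤-antisym cS≤s s≤cS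

    -- An edge inside O would save one vertex of S: starting with that edge, the alternation again
    -- reaches all 2s + 3 vertices.
    independent : 1 ≤ s → ∀ {o o′} → o ∈ₛ O → o′ ∈ₛ O → adj G o o′ ≡ false
    independent 1≤s {o} {o′} o∈ o′∈ = ¬true⇒false contra
      where
      open ≤-Reasoning
      c─ : ¬ o ≡ o′ → card ((O ─ o) ─ o′) ≡ s ∸ 1
      c─ o≢ = suc-injective (suc-injective (trans (cong suc (sym (card-─ (O ─ o) (∈-─ {A = O} o′∈ (λ q → o≢ (sym q))))))
        (trans (sym (card-─ O o∈)) (trans cO (cong suc (sym (m+[n∸m]≡n 1≤s)))))))
      contra : ¬ Adj G o o′
      contra oo′ = go D-list (enum (s ∸ 1) ((O ─ o) ─ o′) (c─ (adj⇒≢ G oo′)))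
       where
       go : DList → Enum ((O ─ o) ─ o′) (s ∸ 1) → ⊥
       go (ss , rs , u , as , ad , ls , l+) (os , uo , ao , lo , _) = 1+n≰n (begin
          suc (2 * s + 2)                                ≡⟨ lem s ⟩
          suc s + suc (suc s)                            ≡⟨ cong₂ _+_ (cong suc lo′) (trans (length-++ ss) l+) ⟨
          length (o ∷ o′ ∷ os) + length (ss ++ rs)       ≡⟨ trans (↭-length (prep o (inter-↭ (o′ ∷ os) (ss ++ rs)))) (length-++ (o ∷ o′ ∷ os)) ⟨
          length (o ∷ inter (o′ ∷ os) (ss ++ rs))        ≤⟨ free′ _ (kk , simple-↭ (↭-sym (prep o (inter-↭ (o′ ∷ os) (ss ++ rs)))) (rest-O∪D uo′ ao′ u ad)) ⟩
          2 * s + 2                                      ∎)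
        where
        lem : ∀ s → suc (2 * s + 2) ≡ suc s + suc (suc s)
        lem = solve-∀
        lo′ : length (o′ ∷ os) ≡ s
        lo′ = trans (cong suc lo) (m+[n∸m]≡n 1≤s)
        inO : ∀ {j} → j ∈ₛ ((O ─ o) ─ o′) → j ∈ₛ O
        inO {j} p = ─⊆ {A = O} {o} j (─⊆ {A = O ─ o} {o′} j p)
        ao′ : All (_∈ₛ O) (o ∷ o′ ∷ os)
        ao′ = o∈ ∷ o′∈ ∷ All.map inO ao
        uo′ : Unique (o ∷ o′ ∷ os)
        uo′ = (adj⇒≢ G oo′ ∷ All.map (λ {j} p q → ∈-─⇒≢ {A = O} {o} {j} (─⊆ {A = O ─ o} {o′} j p) (sym q)) ao) ∷
          All.map (λ {j} p q → ∈-─⇒≢ {A = O ─ o} {o′} {j} p (sym q)) ao ∷ uo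
        link : Linked (Adj G′) (inter (o′ ∷ os) (ss ++ rs))
        link = inter-linked′ (adj-sym G′) (o′ ∷ os) ss rs z<s (≤-reflexive (trans lo′ (sym (trans ls cS)))) (universal-All (All.tail ao′) as) (complete′ u ad)
        kk : Linked (Adj G′) (o ∷ inter (o′ ∷ os) (ss ++ rs))
        kk = glue (ss ++ rs) link
          where
          glue : ∀ l → Linked (Adj G′) (inter (o′ ∷ os) l) → Linked (Adj G′) (o ∷ inter (o′ ∷ os) l)
          glue [] k = G⊑ _ _ oo′ ∷ k
          glue (_ ∷ _) k = G⊑ _ _ oo′ ∷ k

    -- This brings `universal` back from the saturation to G: by independence the G-neighbours of o
    -- all lie in S, and there are at least s = |S| of them.
    O-S-joined : 1 ≤ s → ∀ {o v} → o ∈ₛ O → v ∈ₛ S → Adj G o v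
    O-S-joined 1≤s {o} {v} o∈ v∈ = proj₂ (∧-true {C v} (⊆∧card≥⇒⊇ {A = C ∩ adj G o} {S} sub (≤-trans (≤-reflexive cS) (deg-O o o∈)) v v∈))
      where
      sub : (C ∩ adj G o) ⊆ₛ S
      sub j p with ∧-true {C j} p | bool-cases (D j)
      ... | j∈ , oj | inj₁ q = nbr∈S q o∈ (adj-sym G oj)
      ... | j∈ , oj | inj₂ q = ⊥-elim (true≢false oj (independent 1≤s o∈ (true-∧ j∈ (not-true q))))

    -- The first path alternates i vertices of O with i of S and ends in the two vertices of D
    -- outside S. The second alternates the remaining j + 2 vertices of O with the remaining j + 1
    -- of S.
    two-paths : ∀ i j → s ≡ suc (i + j) → TwoPaths G C (2 + 2 * i) (3 + 2 * j)
    two-paths i j s≡ = go₀ D-list (enum (suc s) O cO)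
     where
     go₀ : DList → Enum O (suc s) → TwoPaths G C (2 + 2 * i) (3 + 2 * j)
     go₀ (ss , rs , u , as , ad , ls , l+) (os , uo , ao , lo , _) =
       go₁ (split-length i os (trans lo (trans (cong suc s≡) (lem i j)))) (split-length i ss (trans ls (trans cS (trans s≡ (lem′ i j)))))
      where
      lem : ∀ i j → suc (suc (i + j)) ≡ i + (suc (suc j))
      lem = solve-∀
      lem′ : ∀ i j → suc (i + j) ≡ i + suc j
      lem′ = solve-∀
      go₁ : Split os i (suc (suc j)) → Split ss i (suc j) → TwoPaths G C (2 + 2 * i) (3 + 2 * j)
      go₁ (os₁ , os₂ , refl , lo₁ , lo₂) (ss₁ , ss₂ , refl , ls₁ , ls₂) = inter os₁ (ss₁ ++ rs) , inter os₂ ss₂ , k₁ ,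
           alternating-linked (adj-sym G) os₂ ss₂ (trans lo₂ (cong suc (sym ls₂))) (joinAll (All.++⁻ʳ os₁ ao) (All.++⁻ʳ ss₁ as)) ,
           simple-↭ (↭-trans perm (++⁺ (↭-sym (inter-↭ os₁ (ss₁ ++ rs))) (↭-sym (inter-↭ os₂ ss₂)))) (rest-O∪D uo ao u ad) ,
           trans (↭-length (inter-↭ os₁ (ss₁ ++ rs))) (trans (length-++ os₁) (trans (cong₂ _+_ lo₁ (trans (length-++ ss₁) (cong₂ _+_ ls₁ lr))) (lem₁ i))) ,
           trans (↭-length (inter-↭ os₂ ss₂)) (trans (length-++ os₂) (trans (cong₂ _+_ lo₂ ls₂) (lem₂ j)))
       where
       1≤s : 1 ≤ s
       1≤s = subst (1 ≤_) (sym s≡) (s≤s z≤n)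
       lr : length rs ≡ 2
       lr = +-cancelˡ-≡ s _ _ (trans (cong (_+ length rs) (sym (trans ls cS))) (trans l+ (+-comm 2 s)))
       lem₁ : ∀ i → i + (i + 2) ≡ 2 + 2 * i
       lem₁ = solve-∀
       lem₂ : ∀ j → suc (suc j) + suc j ≡ 3 + 2 * j
       lem₂ = solve-∀
       joinAll : ∀ {os ss} → All (_∈ₛ O) os → All (_∈ₛ S) ss → All (λ o → All (Adj G o) ss) os
       joinAll ao as = All.map (λ o∈ → All.map (λ d∈ → O-S-joined 1≤s o∈ d∈) as) ao
       perm : (os₁ ++ os₂) ++ (ss₁ ++ ss₂) ++ rs ↭ (os₁ ++ ss₁ ++ rs) ++ os₂ ++ ss₂
       perm = ↭-trans (↭-reflexive (++-assoc os₁ os₂ _)) (↭-trans (++⁺ˡ os₁ inner) (↭-reflexive (sym (++-assoc os₁ (ss₁ ++ rs) (os₂ ++ ss₂)))))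
         where
         inner : os₂ ++ (ss₁ ++ ss₂) ++ rs ↭ (ss₁ ++ rs) ++ os₂ ++ ss₂
         inner = ↭-trans (++⁺ˡ os₂ (↭-trans (↭-reflexive (++-assoc ss₁ ss₂ rs)) (↭-trans (++⁺ˡ ss₁ (++-comm-↭ ss₂ rs)) (↭-reflexive (sym (++-assoc ss₁ rs ss₂))))))
           (↭-trans (↭-reflexive (sym (++-assoc os₂ (ss₁ ++ rs) ss₂))) (↭-trans (++⁺ʳ ss₂ (++-comm-↭ os₂ (ss₁ ++ rs))) (↭-reflexive (++-assoc (ss₁ ++ rs) os₂ ss₂))))
       dRest : Unique (ss₁ ++ rs) × All (_∈ₛ D) (ss₁ ++ rs)
       dRest = unique-++⁻ʳ ss₂ (unique-↭ p u) , All.++⁻ʳ ss₂ (All-resp-↭ p ad)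
         where
         p : (ss₁ ++ ss₂) ++ rs ↭ ss₂ ++ ss₁ ++ rs
         p = ↭-trans (++⁺ʳ rs (++-comm-↭ ss₁ ss₂)) (↭-reflexive (++-assoc ss₂ ss₁ rs))
       k₁ : Linked (Adj G) (inter os₁ (ss₁ ++ rs))
       k₁ = go os₁ lo₁ (All.++⁻ˡ os₁ ao)
         where
         go : ∀ os → length os ≡ i → All (_∈ₛ O) os → Linked (Adj G) (inter os (ss₁ ++ rs))
         go [] _ _ = linked-complete {G = G} {D} cp (proj₁ dRest) (proj₂ dRest)
         go (o ∷ os) l ao = inter-linked′ (adj-sym G) (o ∷ os) ss₁ rs z<s (≤-reflexive (trans l (sym ls₁))) (joinAll ao (All.++⁻ˡ ss₁ as))
           (linked-complete {G = G} {D} cp (proj₁ dRest) (proj₂ dRest))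

-- Removing low ends of longest paths shrinks C to 2s + 3 vertices and preserves connectedness, core
-- and tightness. Saturation need not pass to the smaller set, so it is taken anew at the end.
extremal-two-paths : ∀ {n} (G : Graph n) {D s} → Complete G D → card D ≡ suc (suc s) →
  ∀ f {C} → Conn G C → Free G C (2 * s + 2) → IsCore G s C D → card C ≡ f + (2 * s + 3) → Tight G C s →
  ∀ i j → s ≡ suc (i + j) → ¬ ¬ TwoPaths G C (2 + 2 * i) (3 + 2 * j)
extremal-two-paths G {D} {s} cp cD zero {C} conn free isCore cC tight i j s≡ k =
  saturate C (2 * s + 2) (card C * (card C ∸ 1)) G free (m≤n+m _ _) λ
    { (inj₁ sat) → k (Saturation.two-paths {G} (λ _ _ e → e) free sat i j s≡)
    ; (inj₂ (G′ , le , free′ , sat , _)) → k (Saturation.two-paths {G′} le free′ sat i j s≡) }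
  where open Extremal G conn free isCore cp cD cC tight
extremal-two-paths {n} G {D} {s} cp cD (suc f) {C} conn free isCore cC tight i j s≡ k =
  removable-end G {s = s} conn free (subst (2 * s + 2 <_) (sym cC) (s≤s (≤-trans (+-monoʳ-≤ (2 * s) (n≤1+n 2)) (m≤n+m _ f)))) λ
    { (v , v∈ , low , conn′) → extremal-two-paths G cp cD f {C ─ v} conn′ (λ l pl → free l (path-⊆ G (─⊆ {A = C} {v}) pl))
        (core-─ G s isCore (low⇒∉core G s isCore low)) (suc-injective (trans (sym (card-─ C v∈)) cC)) (tight─ v v∈ low) i j s≡
        λ (l₁ , l₂ , k₁ , k₂ , sm , e₁ , e₂) → k (l₁ , l₂ , k₁ , k₂ , simple-⊆ (─⊆ {A = C} {v}) sm , e₁ , e₂) }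
  where
  tight─ : ∀ v → v ∈ₛ C → deg G C v ≤ s → Tight G (C ─ v) s
  tight─ v v∈ low = ≤-from (+-mono-≤ (subst₂ (λ c e → suc (suc s) * suc s + 2 * s * c ≤ e + 2 * s * suc (suc s)) (card-─ C v∈) (edges₂-remove G C v∈) tight) (*-monoʳ-≤ 2 low))
    0 (lem s (card (C ─ v)) (edges₂ G (C ─ v)) (deg G C v))
    where
    lem : ∀ s c e d → suc (suc s) * suc s + 2 * s * c + ((e + 2 * d + 2 * s * suc (suc s)) + 2 * s) + 0 ≡
      e + 2 * s * suc (suc s) + ((suc (suc s) * suc s + 2 * s * suc c) + 2 * d)
    lem = solve-∀

-- Numerical bounds

half : ∀ P → 1 ≤ P → ∃ λ σ → P ≡ 2 * σ + 1 ⊎ P ≡ 2 * σ + 2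
half (suc zero) _ = 0 , inj₁ refl
half (suc (suc zero)) _ = 0 , inj₂ refl
half (suc (suc (suc P))) _ with half (suc P) (s≤s z≤n)
... | σ , inj₁ e = suc σ , inj₁ (trans (cong (2 +_) e) (lem σ))
  where
  lem : ∀ s → 2 + (2 * s + 1) ≡ 2 * suc s + 1
  lem = solve-∀
... | σ , inj₂ e = suc σ , inj₂ (trans (cong (2 +_) e) (lem σ))
  where
  lem : ∀ s → 2 + (2 * s + 2) ≡ 2 * suc s + 2
  lem = solve-∀

parity-bounds : ∀ {P} σ → P ≡ 2 * σ + 1 ⊎ P ≡ 2 * σ + 2 → 2 * σ < P × P ≤ 2 * σ + 2
parity-bounds σ (inj₁ refl) = ≤-reflexive (+-comm 1 (2 * σ)) , +-monoʳ-≤ (2 * σ) (s≤s z≤n)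
parity-bounds σ (inj₂ refl) = m<m+n (2 * σ) z<s , ≤-refl

n*pred : ∀ x → x * (x ∸ 1) + x ≡ x * x
n*pred zero = refl
n*pred (suc x) = lem x
  where
  lem : ∀ x → suc x * x + suc x ≡ suc x * suc x
  lem = solve-∀

≤⇒∃+ : ∀ {m n} → m ≤ n → ∃ λ o → n ≡ m + o
≤⇒∃+ {m} {n} le = n ∸ m , sym (m+[n∸m]≡n le)

-- The bound d(d − 1) + 2a(c − d), with a = P − d, is convex in a; at a = 0 and a = σ it is P(P − 1) and
-- (up to parity) 2σc − σ(σ + 1).  Here σ = a + 1 + e and c = P + x.
private
  interior : ∀ {δ} → δ ≤ 1 → ∀ a e x E → let d = suc (a + 2 * suc e + δ) ; σ = a + suc e in
    E + 2 * a * d ≤ d * (d ∸ 1) + 2 * a * (d + a + x) →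
    E ≤ (d + a) * (d + a ∸ 1) ⊎ E + σ * suc σ ≤ 2 * σ * (d + a + x)
  -- Here δ = P - 2σ - 1. For a > 0 this is exactly the condition for the bound to be at most P(P -
  -- 1).
  interior {δ} δ≤1 a e x E hyp with suc (a + 2 * x) ≤? 2 * d
    where d = suc (a + 2 * suc e + δ)
  ... | yes small = inj₁ (≤-from (+-mono-≤ hyp (*-monoʳ-≤ a small)) 0 (lem E a x (a + 2 * suc e + δ)))
    where
    lem : ∀ E a x d′ → E + (suc d′ * d′ + 2 * a * (suc d′ + a + x) + a * (2 * suc d′)) + 0 ≡
      suc (d′ + a) * (d′ + a) + (E + 2 * a * suc d′ + a * suc (a + 2 * x))
    lem = solve-∀
  interior {zero} δ≤1 a e x E hyp | no large = inj₂ (≤-from (+-mono-≤ hyp (*-monoʳ-≤ (suc e) (≤-pred (≰⇒> large))))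
      (3 * a * suc e + 3 * (e * e) + 7 * e + 4) (lem E a x e))
    where
    lem : ∀ E a x e → E + (a + suc e) * suc (a + suc e) +
      (suc (a + 2 * suc e + 0) * (a + 2 * suc e + 0) + 2 * a * (suc (a + 2 * suc e + 0) + a + x) + suc e * (a + 2 * x)) + (3 * a * suc e + 3 * (e * e) + 7 * e + 4)
      ≡ 2 * (a + suc e) * (suc (a + 2 * suc e + 0) + a + x) + (E + 2 * a * suc (a + 2 * suc e + 0) + suc e * (2 * suc (a + 2 * suc e + 0)))
    lem = solve-∀
  interior {suc zero} δ≤1 a e x E hyp | no large = inj₂ (≤-from (+-mono-≤ hyp (*-monoʳ-≤ (suc e) (≤-pred (≰⇒> large))))
      (3 * a * suc e + 3 * (e * e) + 7 * e + 2) (lem E a x e))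
    where
    lem : ∀ E a x e → E + (a + suc e) * suc (a + suc e) +
      (suc (a + 2 * suc e + 1) * (a + 2 * suc e + 1) + 2 * a * (suc (a + 2 * suc e + 1) + a + x) + suc e * (a + 2 * x)) + (3 * a * suc e + 3 * (e * e) + 7 * e + 2)
      ≡ 2 * (a + suc e) * (suc (a + 2 * suc e + 1) + a + x) + (E + 2 * a * suc (a + 2 * suc e + 1) + suc e * (2 * suc (a + 2 * suc e + 1)))
    lem = solve-∀
  interior {suc (suc _)} (s≤s ()) a e x E hyp | no large

  interior′ : ∀ {δ} → δ ≤ 1 → ∀ a e x E {σ d c} → σ ≡ a + suc e → d ≡ suc (a + 2 * suc e + δ) → c ≡ d + a + x →
    E + 2 * a * d ≤ d * (d ∸ 1) + 2 * a * c → E ≤ (d + a) * (d + a ∸ 1) ⊎ E + σ * suc σ ≤ 2 * σ * c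
  interior′ δ≤1 a e x E refl refl refl = interior δ≤1 a e x E

-- For odd P, |D| ≥ σ + 2 gives a < σ. For even P, a = σ occurs exactly if d = σ + 2; the bound then
-- exceeds 2σc - σ(σ + 1) by 2, which is the additional edge.
kopylov-bound : ∀ {P σ d a c E} → P ≡ 2 * σ + 1 ⊎ P ≡ 2 * σ + 2 → d + a ≡ P → suc (suc σ) ≤ d → P ≤ c →
  E + 2 * a * d ≤ d * (d ∸ 1) + 2 * a * c →
  E ≤ P * (P ∸ 1) ⊎ E + σ * suc σ ≤ 2 * σ * c ⊎ (P ≡ 2 * σ + 2 × d ≡ suc (suc σ) × E + σ * suc σ ≤ 2 * σ * c + 2)
kopylov-bound {P} {σ} {d} {a} {c} {E} par refl d≥ Pc hyp with ≤⇒∃+ d≥ | ≤⇒∃+ Pc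
kopylov-bound {P} {σ} {d} {a} {c} {E} (inj₁ e) refl d≥ Pc hyp | b , d≡ | x , c≡ =
  case interior′ z≤n a b x E σ≡ (trans d≡ (trans (cong (λ s → suc (suc s) + b) σ≡) (lem₃ a b))) c≡ hyp of λ
    { (inj₁ p) → inj₁ p ; (inj₂ q) → inj₂ (inj₁ q) }
  where
  lem₁ : ∀ s → suc s + s ≡ 2 * s + 1
  lem₁ = solve-∀
  lem₂ : ∀ s a b → suc (suc s) + b + a ≡ suc s + (a + suc b)
  lem₂ = solve-∀
  lem₃ : ∀ a b → suc (suc (a + suc b)) + b ≡ suc (a + 2 * suc b + 0)
  lem₃ = solve-∀
  σ≡ : σ ≡ a + suc b
  σ≡ = +-cancelˡ-≡ (suc σ) _ _ (trans (lem₁ σ) (trans (sym e) (trans (cong (_+ a) d≡) (lem₂ σ a b))))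
kopylov-bound {P} {σ} {d} {a} {c} {E} (inj₂ e) refl d≥ Pc hyp | zero , d≡ | x , c≡ = inj₂ (inj₂ (e , trans d≡ (+-identityʳ _) ,
  ≤-from (subst₂ (λ d a → E + 2 * a * d ≤ d * (d ∸ 1) + 2 * a * c) (trans d≡ (+-identityʳ _)) (sym σ≡) hyp) 0 (lem₃ E σ c)))
  where
  lem₁ : ∀ s → suc (suc s) + s ≡ 2 * s + 2
  lem₁ = solve-∀
  lem₂ : ∀ s a → suc (suc s) + 0 + a ≡ suc (suc s) + a
  lem₂ = solve-∀
  σ≡ : σ ≡ a
  σ≡ = +-cancelˡ-≡ (suc (suc σ)) _ _ (trans (lem₁ σ) (trans (sym e) (trans (cong (_+ a) d≡) (lem₂ σ a))))
  lem₃ : ∀ E s c → E + s * suc s + (suc (suc s) * suc s + 2 * s * c) + 0 ≡ 2 * s * c + 2 + (E + 2 * s * suc (suc s))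
  lem₃ = solve-∀
kopylov-bound {P} {σ} {d} {a} {c} {E} (inj₂ e) refl d≥ Pc hyp | suc b , d≡ | x , c≡ =
  case interior′ ≤-refl a b x E σ≡ (trans d≡ (trans (cong (λ s → suc (suc s) + suc b) σ≡) (lem₃ a b))) c≡ hyp of λ
    { (inj₁ p) → inj₁ p ; (inj₂ q) → inj₂ (inj₁ q) }
  where
  lem₁ : ∀ s → suc (suc s) + s ≡ 2 * s + 2
  lem₁ = solve-∀
  lem₂ : ∀ s a b → suc (suc s) + suc b + a ≡ suc (suc s) + (a + suc b)
  lem₂ = solve-∀
  lem₃ : ∀ a b → suc (suc (a + suc b)) + suc b ≡ suc (a + 2 * suc b + 1)
  lem₃ = solve-∀
  σ≡ : σ ≡ a + suc b
  σ≡ = +-cancelˡ-≡ (suc (suc σ)) _ _ (trans (lem₁ σ) (trans (sym e) (trans (cong (_+ a) d≡) (lem₂ σ a b))))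

-- The step from σ to σ + 1 changes 2σc - σ(σ + 1) by 2(c - σ - 1), which is nonnegative below c.
bs-raise : ∀ {σ s c E} → σ ≤ s → s ≤ c → E + σ * suc σ ≤ 2 * σ * c → E + s * suc s ≤ 2 * s * c
bs-raise {σ} {s} {c} {E} σ≤s s≤c h with ≤⇒∃+ σ≤s
... | zero , refl = subst (λ z → E + z * suc z ≤ 2 * z * c) (sym (+-identityʳ σ)) h
... | suc g , refl with ≤⇒∃+ s≤c
...   | r , refl = ≤-from h (2 * suc g * r + suc g * suc g ∸ suc g) (lem E σ g r)
  where
  lem : ∀ E σ g r → E + (σ + suc g) * suc (σ + suc g) + 2 * σ * (σ + suc g + r) + (2 * suc g * r + suc g * suc g ∸ suc g)
    ≡ 2 * (σ + suc g) * (σ + suc g + r) + (E + σ * suc σ)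
  lem E σ g r = trans (cong (E + (σ + suc g) * suc (σ + suc g) + 2 * σ * (σ + suc g + r) +_)
      (trans (cong (_∸ suc g) (lem₁ g r)) (m+n∸m≡n (suc g) _))) (lem₂ E σ g r)
    where
    lem₁ : ∀ g r → 2 * suc g * r + suc g * suc g ≡ suc g + (2 * suc g * r + g * suc g)
    lem₁ = solve-∀
    lem₂ : ∀ E σ g r → E + (σ + suc g) * suc (σ + suc g) + 2 * σ * (σ + suc g + r) + (2 * suc g * r + g * suc g)
      ≡ 2 * (σ + suc g) * (σ + suc g + r) + (E + σ * suc σ)
    lem₂ = solve-∀

-- Disjoint unions of cliques of equal order

-- H l x is twice the number of edges of a disjoint union of cliques K_w, w = l + 1, and one smaller clique on x vertices.
module _ (l : ℕ) where

  private
    w : ℕ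
    w = suc l

  H : ℕ → ℕ
  H zero = 0
  H (suc x) = H x + 2 * (x % w)

  H-clique : ∀ {x} → x ≤ w → H x ≡ x * (x ∸ 1)
  H-clique {zero} _ = refl
  H-clique {suc x} x<w = begin
    H x + 2 * (x % w)      ≡⟨ cong₂ (λ a b → a + 2 * b) (H-clique (<⇒≤ x<w)) (m<n⇒m%n≡m x<w) ⟩
    x * (x ∸ 1) + 2 * x    ≡⟨ lem x ⟩
    suc x * x              ∎
    where
    open ≡-Reasoning
    lem : ∀ x → x * (x ∸ 1) + 2 * x ≡ suc x * x
    lem zero = refl
    lem (suc x) = lem′ x
      where
      lem′ : ∀ x → suc x * x + 2 * suc x ≡ suc (suc x) * suc x
      lem′ = solve-∀

  H-+w : ∀ x → H (x + w) ≡ H x + w * l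
  H-+w zero = H-clique ≤-refl
  H-+w (suc x) = begin
    H (x + w) + 2 * ((x + w) % w)     ≡⟨ cong₂ (λ a b → a + 2 * b) (H-+w x) ([m+n]%n≡m%n x w) ⟩
    H x + w * l + 2 * (x % w)         ≡⟨ lem (H x) (w * l) (2 * (x % w)) ⟩
    H x + 2 * (x % w) + w * l         ∎
    where
    open ≡-Reasoning
    lem : ∀ a b c → a + b + c ≡ a + c + b
    lem = solve-∀

  H-mono : ∀ x y → H x ≤ H (x + y)
  H-mono x zero = ≤-reflexive (cong H (sym (+-identityʳ x)))
  H-mono x (suc y) = subst (λ z → H x ≤ H z) (sym (+-suc x y)) (≤-trans (H-mono x y) (m≤m+n _ _))

  H-step : ∀ x y → H (x + y) ≤ H x + 2 * l * y
  H-step x zero = ≤-reflexive (trans (cong H (+-identityʳ x)) (trans (sym (+-identityʳ _)) (cong (H x +_) (sym (*-zeroʳ (2 * l))))))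
  H-step x (suc y) = subst (λ z → H z ≤ H x + 2 * l * suc y) (sym (+-suc x y)) (begin
    H (x + y) + 2 * ((x + y) % w)     ≤⟨ +-mono-≤ (H-step x y) (*-monoʳ-≤ 2 (m%n≤l (x + y))) ⟩
    H x + 2 * l * y + 2 * l           ≡⟨ lem (H x) l y ⟩
    H x + 2 * l * suc y               ∎)
    where
    open ≤-Reasoning
    m%n≤l : ∀ m → m % w ≤ l
    m%n≤l m = ≤-pred (m%n<n m w)
    lem : ∀ h l y → h + 2 * l * y + 2 * l ≡ h + 2 * l * suc y
    lem = solve-∀

  mod-induction : (P : ℕ → Set) → (∀ x → x ≤ w → P x) → (∀ x → P x → P (x + w)) → ∀ x → P x
  mod-induction P base step x = go x x ≤-refl
    where
    go : ∀ f x → x ≤ f → P x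
    go zero x le = base x (≤-trans le z≤n)
    go (suc f) x le with x ≤? w
    ... | yes small = base x small
    ... | no large with ≤⇒∃+ (<⇒≤ (≰⇒> large))
    ...   | y , refl = subst P (+-comm y w) (step y (go f y (≤-pred (≤-trans (s≤s (m≤n+m y l)) le))))

  H≤ : ∀ x → H x ≤ l * x
  H≤ = mod-induction _
    (λ x le → ≤-trans (≤-reflexive (H-clique le)) (≤-trans (*-monoʳ-≤ x (pred-mono-≤ le)) (≤-reflexive (*-comm x l))))
    (λ x h → ≤-trans (≤-reflexive (H-+w x)) (≤-trans (+-monoˡ-≤ (w * l) h) (≤-reflexive (lem l x))))
    where
    lem : ∀ l x → l * x + suc l * l ≡ l * (x + suc l)
    lem = solve-∀

  -- Periodicity reduces the claim to x, y ≤ w. If x + y = w + z there, moving vertices until one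
  -- clique is full makes the sizes more unequal, and the sum of squares grows.
  H-super : ∀ x y → H x + H y ≤ H (x + y)
  H-super = mod-induction _ (λ x xw → mod-induction _ (base x xw) (λ y h → begin
      H x + H (y + w)          ≡⟨ cong (H x +_) (H-+w y) ⟩
      H x + (H y + w * l)      ≡⟨ +-assoc (H x) _ _ ⟨
      H x + H y + w * l        ≤⟨ +-monoˡ-≤ (w * l) h ⟩
      H (x + y) + w * l        ≡⟨ H-+w (x + y) ⟨
      H (x + y + w)            ≡⟨ cong H (+-assoc x y w) ⟩
      H (x + (y + w))          ∎))
    λ x h y → begin
      H (x + w) + H y          ≡⟨ cong (_+ H y) (H-+w x) ⟩
      H x + w * l + H y        ≡⟨ lem (H x) (w * l) (H y) ⟩
      H x + H y + w * l        ≤⟨ +-monoˡ-≤ (w * l) (h y) ⟩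
      H (x + y) + w * l        ≡⟨ H-+w (x + y) ⟨
      H (x + y + w)            ≡⟨ cong H (lem x y w) ⟩
      H (x + w + y)            ∎
    where
    open ≤-Reasoning
    lem : ∀ a b c → a + b + c ≡ a + c + b
    lem = solve-∀
    base : ∀ x → x ≤ w → ∀ y → y ≤ w → H x + H y ≤ H (x + y)
    base x xw y yw with x + y ≤? w
    ... | yes small = begin
        H x + H y                        ≡⟨ cong₂ _+_ (H-clique xw) (H-clique yw) ⟩
        x * (x ∸ 1) + y * (y ∸ 1)        ≤⟨ +-mono-≤ (*-monoʳ-≤ x (∸-monoˡ-≤ 1 (m≤m+n x y))) (*-monoʳ-≤ y (∸-monoˡ-≤ 1 (m≤n+m y x))) ⟩
        x * (x + y ∸ 1) + y * (x + y ∸ 1) ≡⟨ *-distribʳ-+ (x + y ∸ 1) x y ⟨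
        (x + y) * (x + y ∸ 1)            ≡⟨ H-clique small ⟨
        H (x + y)                        ∎
    ... | no large with ≤⇒∃+ (<⇒≤ (≰⇒> large)) | ≤⇒∃+ xw | ≤⇒∃+ yw
    ...   | z , exy | β , ex | α , ey = +-cancelʳ-≤ (x + y) _ _ (begin
        H x + H y + (x + y)                                 ≡⟨ cong₂ (λ a b → a + b + (x + y)) (H-clique xw) (H-clique yw) ⟩
        x * (x ∸ 1) + y * (y ∸ 1) + (x + y)                 ≡⟨ lem₁ (x * (x ∸ 1)) (y * (y ∸ 1)) x y ⟩
        (x * (x ∸ 1) + x) + (y * (y ∸ 1) + y)               ≡⟨ cong₂ _+_ (n*pred x) (n*pred y) ⟩
        x * x + y * y                                       ≡⟨ cong₂ (λ a b → a * a + b * b) x≡ y≡ ⟩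
        (z + α) * (z + α) + (z + β) * (z + β)               ≤⟨ m≤m+n _ (2 * α * β) ⟩
        (z + α) * (z + α) + (z + β) * (z + β) + 2 * α * β   ≡⟨ lem₂ z α β ⟩
        z * z + (z + α + β) * (z + α + β)                   ≡⟨ cong (λ a → z * z + a * a) (trans ex (cong (_+ β) x≡)) ⟨
        z * z + w * w                                       ≡⟨ cong₂ _+_ (sym (n*pred z)) (sym (n*pred w)) ⟩
        (z * (z ∸ 1) + z) + (w * l + w)                     ≡⟨ lem₃ (z * (z ∸ 1)) z (w * l) w ⟩
        (z * (z ∸ 1) + w * l) + (w + z)                     ≡⟨ cong₂ _+_ (cong (_+ w * l) (sym (H-clique z≤w))) (sym exy) ⟩
        (H z + w * l) + (x + y)                             ≡⟨ cong (_+ (x + y)) (sym (H-+w z)) ⟩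
        H (z + w) + (x + y)                                 ≡⟨ cong (λ a → H a + (x + y)) (trans (+-comm z w) (sym exy)) ⟩
        H (x + y) + (x + y)                                 ∎)
      where
      lem₁ : ∀ a b x y → a + b + (x + y) ≡ (a + x) + (b + y)
      lem₁ = solve-∀
      lem₂ : ∀ z a b → (z + a) * (z + a) + (z + b) * (z + b) + 2 * a * b ≡ z * z + (z + a + b) * (z + a + b)
      lem₂ = solve-∀
      lem₃ : ∀ a z b w → (a + z) + (b + w) ≡ (a + b) + (w + z)
      lem₃ = solve-∀
      x≡ : x ≡ z + α
      x≡ = +-cancelʳ-≡ y x (z + α) (trans exy (trans (cong (_+ z) ey) (lem′ y α z)))
        where
        lem′ : ∀ y a z → y + a + z ≡ z + a + y
        lem′ = solve-∀
      y≡ : y ≡ z + β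
      y≡ = +-cancelˡ-≡ x y (z + β) (trans exy (trans (cong (_+ z) ex) (lem′ x β z)))
        where
        lem′ : ∀ y a z → y + a + z ≡ y + (z + a)
        lem′ = solve-∀
      z≤w : z ≤ w
      z≤w = ≤-trans (subst (z ≤_) (sym x≡) (m≤m+n z α)) xw

  -- The other extremal graph never beats the disjoint cliques when 2σ < w.
  H-linear : ∀ {σ} → 2 * σ < w → ∀ c → 2 * σ * c ≤ H c + σ * suc σ
  H-linear {σ} lt = mod-induction _ base (λ c h → ≤-from (+-mono-≤ h (*-monoʳ-≤ w (≤-pred lt))) 0
      (trans (lem σ c l (H c)) (cong (λ z → z + σ * suc σ + (2 * σ * c + suc l * (2 * σ))) (sym (H-+w c)))))
    where
    lem : ∀ σ c l h → 2 * σ * (c + suc l) + (h + σ * suc σ + suc l * l) + 0 ≡ h + suc l * l + σ * suc σ + (2 * σ * c + suc l * (2 * σ))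
    lem = solve-∀
    quad : ∀ c → 2 * σ * c ≤ c * (c ∸ 1) + σ * suc σ
    quad zero = ≤-trans (≤-reflexive (*-zeroʳ (2 * σ))) z≤n
    quad (suc c) with ≤-total (suc c) σ
    ... | inj₁ p with ≤⇒∃+ p
    ...   | t , refl = subst (2 * (suc c + t) * suc c ≤_) (lem₁ c t) (m≤m+n _ (t * suc t))
      where
      lem₁ : ∀ c t → 2 * (suc c + t) * suc c + t * suc t ≡ suc c * c + (suc c + t) * suc (suc c + t)
      lem₁ = solve-∀
    quad (suc c) | inj₂ p with ≤⇒∃+ p
    ... | zero , e = ≤-reflexive (trans (cong (2 * σ *_) e) (trans (lem₂ σ) (cong (λ z → z * (z ∸ 1) + σ * suc σ) (sym e))))
      where
      lem₂ : ∀ σ → 2 * σ * (σ + 0) ≡ (σ + 0) * (σ + 0 ∸ 1) + σ * suc σ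
      lem₂ zero = refl
      lem₂ (suc σ) = lem₃ σ
        where
        lem₃ : ∀ σ → 2 * suc σ * (suc σ + 0) ≡ (suc σ + 0) * (σ + 0) + suc σ * suc (suc σ)
        lem₃ = solve-∀
    ... | suc t , e = subst (λ z → 2 * σ * z ≤ z * (z ∸ 1) + σ * suc σ) (sym (trans e (+-suc σ t)))
        (subst (2 * σ * suc (σ + t) ≤_) (lem₁ σ t) (m≤m+n _ (t * suc t)))
      where
      lem₁ : ∀ σ t → 2 * σ * suc (σ + t) + t * suc t ≡ suc (σ + t) * (σ + t) + σ * suc σ
      lem₁ = solve-∀
    base : ∀ c → c ≤ w → 2 * σ * c ≤ H c + σ * suc σ
    base c le = subst (λ z → 2 * σ * c ≤ z + σ * suc σ) (sym (H-clique le)) (quad c)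

pred-+ : ∀ d s → (d + s) * (d + s ∸ 1) ≡ d * (d ∸ 1) + 2 * d * s + s * (s ∸ 1)
pred-+ d s = +-cancelʳ-≡ (d + s) _ _ (begin
  (d + s) * (d + s ∸ 1) + (d + s)                              ≡⟨ n*pred (d + s) ⟩
  (d + s) * (d + s)                                            ≡⟨ lem₁ d s ⟩
  d * d + 2 * d * s + s * s                                    ≡⟨ cong₂ (λ a b → a + 2 * d * s + b) (n*pred d) (n*pred s) ⟨
  (d * (d ∸ 1) + d) + 2 * d * s + (s * (s ∸ 1) + s)            ≡⟨ lem₂ (d * (d ∸ 1)) d (2 * d * s) (s * (s ∸ 1)) s ⟩
  d * (d ∸ 1) + 2 * d * s + s * (s ∸ 1) + (d + s)              ∎)
  where
  open ≡-Reasoning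
  lem₁ : ∀ d s → (d + s) * (d + s) ≡ d * d + 2 * d * s + s * s
  lem₁ = solve-∀
  lem₂ : ∀ a d b c s → (a + d) + b + (c + s) ≡ a + b + c + (d + s)
  lem₂ = solve-∀

half-bounds : ∀ P → 1 ≤ P → ∃ λ σ → 2 * σ < P × P ≤ 2 * σ + 2
half-bounds P le = let (σ , par) = half P le in σ , parity-bounds σ par

half-≤ : ∀ {a b} → 2 * a ≤ 2 * b + 1 → a ≤ b
half-≤ {a} {b} h = ≮⇒≥ λ lt → 1+n≰n (≤-from (+-mono-≤ h (*-monoʳ-≤ 2 lt)) {suc (2 * a)} {2 * a} 0 (lem a b))
  where
  lem : ∀ a b → suc (2 * a) + (2 * b + 1 + 2 * a) + 0 ≡ 2 * a + (2 * a + 2 * suc b)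
  lem = solve-∀

-- Merging the bounds of several components

-- Bounds for a union of components (c vertices, E doubled edges) into whose longest paths items of total size S have
-- been packed, no component having room for a path on k = w + 1 vertices any more.  Z is a predicate recorded in the
-- one case where the bound 2σc − σ(σ + 1) is exceeded.
module Merge (l : ℕ) (Z : ℕ → Set) where

  private
    w : ℕ
    w = suc l

  Clq Bs Sp Wk NonPool Agg : ℕ → ℕ → ℕ → Set
  Clq S c E = ∃₂ λ d y → S ≤ d × d ≤ S + w × d + y ≡ c × E ≤ d * (d ∸ 1) + H l y
  Bs S c E = ∃ λ σ → (2 * σ < S + w × S + w ≤ 2 * σ + 2) × E + σ * suc σ ≤ 2 * σ * c
  Sp S c E = ∃ λ σ → S + w ≡ 2 * σ + 2 × E + σ * suc σ ≤ 2 * σ * c + 2 × Z σ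
  Wk S c E = ∃ λ σ → 2 * σ ≤ S + w × E + σ * suc σ ≤ 2 * σ * c
  NonPool S c E = (w < S × S ≤ c) × (Clq S c E ⊎ Bs S c E ⊎ Sp S c E)
  Agg S c E = (S ≡ 0 × E ≤ H l c) ⊎ NonPool S c E

  -- From the second clique, of order S₂ + z, the S₂ vertices move to the first and the other z ≤ w
  -- form a small clique. The loss 2S₂z is outweighed by the gain 2d₁S₂, because z ≤ w < S₁ ≤ d₁.
  clq-clq : ∀ {S₁ S₂ c₁ c₂ E₁ E₂} → w < S₁ → Clq S₁ c₁ E₁ → Clq S₂ c₂ E₂ → Clq (S₁ + S₂) (c₁ + c₂) (E₁ + E₂)
  clq-clq {S₁} {S₂} {E₁ = E₁} {E₂} w<S (d₁ , y₁ , lo₁ , hi₁ , refl , e₁) (d₂ , y₂ , lo₂ , hi₂ , refl , e₂) with ≤⇒∃+ lo₂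
  ... | z , refl with ≤⇒∃+ (≤-trans (+-cancelˡ-≤ S₂ _ _ hi₂) (≤-trans (<⇒≤ w<S) lo₁))
  ...   | t , refl = z + t + S₂ , y₁ + y₂ + z , +-monoˡ-≤ S₂ lo₁ ,
          ≤-trans (+-monoˡ-≤ S₂ hi₁) (≤-reflexive (lem₁ S₁ w S₂)) , lem₂ z t S₂ y₁ y₂ , (begin
      E₁ + E₂                                                                    ≤⟨ +-mono-≤ e₁ e₂ ⟩
      D₁ * (D₁ ∸ 1) + H l y₁ + ((S₂ + z) * (S₂ + z ∸ 1) + H l y₂)                ≡⟨ cong (λ a → D₁ * (D₁ ∸ 1) + H l y₁ + (a + H l y₂)) (pred-+ S₂ z) ⟩
      D₁ * (D₁ ∸ 1) + H l y₁ + (S₂ * (S₂ ∸ 1) + 2 * S₂ * z + z * (z ∸ 1) + H l y₂)  ≤⟨ m≤m+n _ (2 * S₂ * t) ⟩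
      D₁ * (D₁ ∸ 1) + H l y₁ + (S₂ * (S₂ ∸ 1) + 2 * S₂ * z + z * (z ∸ 1) + H l y₂) + 2 * S₂ * t
        ≡⟨ lem₃ (D₁ * (D₁ ∸ 1)) (H l y₁) (H l y₂) (S₂ * (S₂ ∸ 1)) (z * (z ∸ 1)) S₂ z t ⟩
      D₁ * (D₁ ∸ 1) + 2 * D₁ * S₂ + S₂ * (S₂ ∸ 1) + (H l y₁ + H l y₂ + z * (z ∸ 1))
        ≡⟨ cong₂ (λ a b → a + (H l y₁ + H l y₂ + b)) (pred-+ D₁ S₂) (H-clique l (+-cancelˡ-≤ S₂ _ _ hi₂)) ⟨
      (D₁ + S₂) * (D₁ + S₂ ∸ 1) + (H l y₁ + H l y₂ + H l z)                      ≤⟨ +-monoʳ-≤ ((D₁ + S₂) * (D₁ + S₂ ∸ 1)) (≤-trans (+-monoˡ-≤ (H l z) (H-super l y₁ y₂)) (H-super l (y₁ + y₂) z)) ⟩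
      (D₁ + S₂) * (D₁ + S₂ ∸ 1) + H l (y₁ + y₂ + z)                              ∎)
    where
    open ≤-Reasoning
    D₁ = z + t
    lem₁ : ∀ a b c → a + b + c ≡ a + c + b
    lem₁ = solve-∀
    lem₂ : ∀ z t S a b → z + t + S + (a + b + z) ≡ z + t + a + (S + z + b)
    lem₂ = solve-∀
    lem₃ : ∀ a h h′ b c S z t → a + h + (b + 2 * S * z + c + h′) + 2 * S * t ≡ a + 2 * (z + t) * S + b + (h + h′ + c)
    lem₃ = solve-∀

  bs⇒wk : ∀ {S c E} → Bs S c E → Wk S c E
  bs⇒wk (σ , (lo , hi) , e) = σ , <⇒≤ lo , e

  -- From w < S ≤ c and S + w = 2σ + 2 follows c ≥ σ + 2, so replacing σ by σ + 1 gains at least the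
  -- missing 2.
  sp⇒wk : ∀ {S c E} → w < S → S ≤ c → Sp S c E → Wk S c E
  sp⇒wk {S} {c} {E} w<S S≤c (σ , eq , e , _) = suc σ , ≤-reflexive (trans (lem₁ σ) (sym eq)) ,
      ≤-from (+-mono-≤ e (*-monoʳ-≤ 2 (half-≤ {suc (suc σ)} {c} c≥))) 0 (lem₂ σ c E)
    where
    lem₁ : ∀ s → 2 * suc s ≡ 2 * s + 2
    lem₁ = solve-∀
    lem₂ : ∀ s c E → E + suc s * suc (suc s) + (2 * s * c + 2 + 2 * c) + 0 ≡ 2 * suc s * c + (E + s * suc s + 2 * suc (suc s))
    lem₂ = solve-∀
    c≥ : 2 * suc (suc σ) ≤ 2 * c + 1
    c≥ = ≤-from (+-mono-≤ (+-mono-≤ (≤-reflexive (sym eq)) w<S) (+-mono-≤ S≤c S≤c)) 0 (lem σ S w c)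
      where
      lem : ∀ σ S w c → 2 * suc (suc σ) + ((S + w + S) + (c + c)) + 0 ≡ 2 * c + 1 + ((2 * σ + 2 + suc w) + (S + S))
      lem = solve-∀

  -- The larger parameter σ₁ serves for both parts, with σ₂(σ₂ + 1) given away; since S₂ is
  -- positive, σ₁ is within the range of the combined order and can be raised to it.
  wk-wk′ : ∀ {S₁ S₂ c₁ c₂ E₁ E₂} → w < S₁ → w < S₂ → S₁ ≤ c₁ → S₂ ≤ c₂ → 1 ≤ w →
    ((σ₁ , _) : Wk S₁ c₁ E₁) ((σ₂ , _) : Wk S₂ c₂ E₂) → σ₂ ≤ σ₁ → Bs (S₁ + S₂) (c₁ + c₂) (E₁ + E₂)
  wk-wk′ {S₁} {S₂} {c₁} {c₂} {E₁} {E₂} w<S₁ w<S₂ S≤c₁ S≤c₂ 1≤w (σ₁ , h₁ , e₁) (σ₂ , h₂ , e₂) σ₂≤σ₁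
    with half-bounds (S₁ + S₂ + w) (≤-trans 1≤w (m≤n+m w _))
  ... | s , lo , hi = s , (lo , hi) , bs-raise (half-≤ {σ₁} {s} σ₁≤s) s≤c
            (≤-from (+-mono-≤ (+-mono-≤ e₁ e₂) (*-monoʳ-≤ (2 * c₂) σ₂≤σ₁)) (σ₂ * suc σ₂) (lem E₁ E₂ σ₁ σ₂ c₁ c₂))
    where
    lem : ∀ E E′ σ τ c c′ → E + E′ + σ * suc σ + ((2 * σ * c + 2 * τ * c′) + 2 * c′ * σ) + τ * suc τ ≡ 2 * σ * (c + c′) + ((E + σ * suc σ + (E′ + τ * suc τ)) + 2 * c′ * τ)
    lem = solve-∀
    σ₁≤s : 2 * σ₁ ≤ 2 * s + 1
    σ₁≤s = ≤-from (+-mono-≤ (+-mono-≤ h₁ hi) (≤-trans (s≤s 1≤w) w<S₂)) 1 (lem′ σ₁ S₁ S₂ w s)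
      where
      lem′ : ∀ σ S S′ w s → 2 * σ + ((S + w + (2 * s + 2)) + S′) + 1 ≡ 2 * s + 1 + ((2 * σ + (S + S′ + w)) + 2)
      lem′ = solve-∀
    s≤c : s ≤ c₁ + c₂
    s≤c = half-≤ {s} {c₁ + c₂} (≤-from (+-mono-≤ (+-mono-≤ lo w<S₁) (+-mono-≤ (+-mono-≤ S≤c₁ S≤c₁) S≤c₂)) (3 + c₂) (lem′ s S₁ S₂ w c₁ c₂))
      where
      lem′ : ∀ s S S′ w c c′ → 2 * s + ((S + S′ + w + S) + (c + c + c′)) + (3 + c′) ≡ 2 * (c + c′) + 1 + ((suc (2 * s) + suc w) + (S + S + S′))
      lem′ = solve-∀

  wk-wk : ∀ {S₁ S₂ c₁ c₂ E₁ E₂} → w < S₁ → w < S₂ → S₁ ≤ c₁ → S₂ ≤ c₂ → 1 ≤ w → Wk S₁ c₁ E₁ → Wk S₂ c₂ E₂ →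
    Bs (S₁ + S₂) (c₁ + c₂) (E₁ + E₂)
  wk-wk {S₁} {S₂} {c₁} {c₂} {E₁} {E₂} w<S₁ w<S₂ S≤c₁ S≤c₂ 1≤w k₁ k₂ with ≤-total (proj₁ k₂) (proj₁ k₁)
  ... | inj₁ le = wk-wk′ w<S₁ w<S₂ S≤c₁ S≤c₂ 1≤w k₁ k₂ le
  ... | inj₂ le rewrite +-comm S₁ S₂ | +-comm c₁ c₂ | +-comm E₁ E₂ = wk-wk′ w<S₂ w<S₁ S≤c₂ S≤c₁ 1≤w k₂ k₁ le

  -- If the first component is large it pays to move everything to it, otherwise its vertices go to the clique.
  wk-clq : ∀ {S₁ S₂ c₁ c₂ E₁ E₂} → w < S₁ → w < S₂ → S₁ ≤ c₁ → 1 ≤ w → Wk S₁ c₁ E₁ → Clq S₂ c₂ E₂ →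
    Clq (S₁ + S₂) (c₁ + c₂) (E₁ + E₂) ⊎ Bs (S₁ + S₂) (c₁ + c₂) (E₁ + E₂)
  wk-clq {S₁} {S₂} {c₁} {E₁ = E₁} {E₂} w<S₁ w<S₂ S≤c₁ 1≤w (σ , h , e₁) (d , y , lo₂ , hi₂ , refl , e₂)
    with half-bounds (S₁ + S₂ + w) (≤-trans 1≤w (m≤n+m w _))
  ... | s , lo , hi with s ≤? c₁
  ...   | yes s≤c = inj₂ (s , (lo , hi) , (begin
      E₁ + E₂ + s * suc s                          ≡⟨ lem₁ E₁ E₂ (s * suc s) ⟩
      E₁ + s * suc s + E₂                          ≤⟨ +-mono-≤ (bs-raise (half-≤ {σ} {s} σ≤s) s≤c e₁) e₂ ⟩
      2 * s * c₁ + (d * (d ∸ 1) + H l y)           ≤⟨ +-monoʳ-≤ (2 * s * c₁) (+-mono-≤ (*-monoʳ-≤ d d≤) (≤-trans (H≤ l y) (*-monoˡ-≤ y l≤))) ⟩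
      2 * s * c₁ + (d * (2 * s) + 2 * s * y)       ≡⟨ lem₂ s c₁ d y ⟩
      2 * s * (c₁ + (d + y))                       ∎))
    where
    open ≤-Reasoning
    lem₁ : ∀ a b c → a + b + c ≡ a + c + b
    lem₁ = solve-∀
    lem₂ : ∀ s c d y → 2 * s * c + (d * (2 * s) + 2 * s * y) ≡ 2 * s * (c + (d + y))
    lem₂ = solve-∀
    σ≤s : 2 * σ ≤ 2 * s + 1
    σ≤s = ≤-from (+-mono-≤ (+-mono-≤ h hi) (≤-trans (s≤s 1≤w) w<S₂)) 1 (lem′ σ S₁ S₂ w s)
      where
      lem′ : ∀ σ S S′ w s → 2 * σ + ((S + w + (2 * s + 2)) + S′) + 1 ≡ 2 * s + 1 + ((2 * σ + (S + S′ + w)) + 2)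
      lem′ = solve-∀
    d≤ : d ∸ 1 ≤ 2 * s
    d≤ = ≤-trans (∸-monoˡ-≤ 1 (≤-from (+-mono-≤ (+-mono-≤ hi₂ hi) (≤-trans (s≤s z≤n) w<S₁)) {d} {suc (2 * s)} 0 (lem′ d S₁ S₂ w s))) ≤-refl
      where
      lem′ : ∀ d S S′ w s → d + ((S′ + w + (2 * s + 2)) + S) + 0 ≡ suc (2 * s) + ((d + (S + S′ + w)) + 1)
      lem′ = solve-∀
    l≤ : l ≤ 2 * s
    l≤ = ≤-from (+-mono-≤ hi (≤-trans (s≤s z≤n) w<S₁)) S₂ (lem′ l S₁ S₂ s)
      where
      lem′ : ∀ l S S′ s → l + (2 * s + 2 + S) + S′ ≡ 2 * s + (S + S′ + suc l + 1)
      lem′ = solve-∀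
  ...   | no s≰c with ≤⇒∃+ S≤c₁
  ...     | x , refl = inj₁ (d + S₁ , y + x , ≤-trans (≤-reflexive (+-comm S₁ S₂)) (+-monoˡ-≤ S₁ lo₂) ,
              ≤-trans (+-monoˡ-≤ S₁ hi₂) (≤-reflexive (lem₁ S₂ w S₁)) , lem₂ d S₁ y x , (begin
      E₁ + E₂                                                           ≤⟨ +-mono-≤ E₁≤ e₂ ⟩
      2 * d * S₁ + S₁ * (S₁ ∸ 1) + (d * (d ∸ 1) + H l y)                ≡⟨ lem₃ (2 * d * S₁) (S₁ * (S₁ ∸ 1)) (d * (d ∸ 1)) (H l y) ⟩
      d * (d ∸ 1) + 2 * d * S₁ + S₁ * (S₁ ∸ 1) + H l y                  ≡⟨ cong (_+ H l y) (pred-+ d S₁) ⟨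
      (d + S₁) * (d + S₁ ∸ 1) + H l y                                   ≤⟨ +-monoʳ-≤ ((d + S₁) * (d + S₁ ∸ 1)) (H-mono l y x) ⟩
      (d + S₁) * (d + S₁ ∸ 1) + H l (y + x)                             ∎))
    where
    open ≤-Reasoning
    lem₁ : ∀ a b c → a + b + c ≡ c + a + b
    lem₁ = solve-∀
    lem₂ : ∀ d S y x → d + S + (y + x) ≡ S + x + (d + y)
    lem₂ = solve-∀
    lem₃ : ∀ a b c h → a + b + (c + h) ≡ c + a + b + h
    lem₃ = solve-∀
    σ≤ : 2 * σ ≤ 2 * S₁
    σ≤ = ≤-from (+-mono-≤ h w<S₁) 1 (lem σ S₁ w)
      where
      lem : ∀ σ S w → 2 * σ + (S + w + S) + 1 ≡ 2 * S + (2 * σ + suc w)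
      lem = solve-∀
    c≤ : 2 * (S₁ + x) + 4 ≤ S₁ + 2 * S₂
    c≤ = ≤-from (+-mono-≤ (+-mono-≤ lo w<S₂) (*-monoʳ-≤ 2 (≰⇒> s≰c))) 0 (lem S₁ S₂ w x s)
      where
      lem : ∀ S S′ w x s → 2 * (S + x) + 4 + ((S + S′ + w + S′) + 2 * s) + 0 ≡ S + 2 * S′ + ((suc (2 * s) + suc w) + 2 * suc (S + x))
      lem = solve-∀
    E₁≤ : E₁ ≤ 2 * d * S₁ + S₁ * (S₁ ∸ 1)
    E₁≤ = *-cancelˡ-≤ 2 (+-cancelʳ-≤ (2 * S₁) _ _ (begin
      2 * E₁ + 2 * S₁                               ≤⟨ +-monoˡ-≤ (2 * S₁) (*-monoʳ-≤ 2 (≤-trans (m≤m+n E₁ _) e₁)) ⟩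
      2 * (2 * σ * (S₁ + x)) + 2 * S₁               ≤⟨ +-monoˡ-≤ (2 * S₁) (*-monoʳ-≤ 2 (*-monoˡ-≤ (S₁ + x) σ≤)) ⟩
      2 * (2 * S₁ * (S₁ + x)) + 2 * S₁              ≤⟨ m≤m+n _ (6 * S₁) ⟩
      2 * (2 * S₁ * (S₁ + x)) + 2 * S₁ + 6 * S₁     ≡⟨ lem₄ S₁ x ⟩
      2 * S₁ * (2 * (S₁ + x) + 4)                   ≤⟨ *-monoʳ-≤ (2 * S₁) c≤ ⟩
      2 * S₁ * (S₁ + 2 * S₂)                        ≤⟨ *-monoʳ-≤ (2 * S₁) (+-monoʳ-≤ S₁ (*-monoʳ-≤ 2 lo₂)) ⟩
      2 * S₁ * (S₁ + 2 * d)                         ≡⟨ lem₅ S₁ d ⟩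
      2 * (2 * d * S₁) + 2 * (S₁ * S₁)              ≡⟨ cong (λ a → 2 * (2 * d * S₁) + 2 * a) (n*pred S₁) ⟨
      2 * (2 * d * S₁) + 2 * (S₁ * (S₁ ∸ 1) + S₁)   ≡⟨ lem₆ (2 * d * S₁) (S₁ * (S₁ ∸ 1)) S₁ ⟩
      2 * (2 * d * S₁ + S₁ * (S₁ ∸ 1)) + 2 * S₁     ∎))
      where
      lem₄ : ∀ S x → 2 * (2 * S * (S + x)) + 2 * S + 6 * S ≡ 2 * S * (2 * (S + x) + 4)
      lem₄ = solve-∀
      lem₅ : ∀ S d → 2 * S * (S + 2 * d) ≡ 2 * (2 * d * S) + 2 * (S * S)
      lem₅ = solve-∀
      lem₆ : ∀ a b S → 2 * a + 2 * (b + S) ≡ 2 * (a + b) + 2 * S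
      lem₆ = solve-∀

  pool-nonpool : ∀ {S c c₀ E E₀} → E₀ ≤ H l c₀ → NonPool S c E → NonPool S (c + c₀) (E + E₀)
  pool-nonpool {S} {c} {c₀} {E} {E₀} h ((w<S , S≤c) , out) = (w<S , ≤-trans S≤c (m≤m+n c c₀)) , go out
    where
    linear : ∀ {σ} → S + w ≤ 2 * σ + 2 → E₀ ≤ 2 * σ * c₀
    linear {σ} hi = ≤-trans h (≤-trans (H≤ l c₀) (*-monoˡ-≤ c₀ (≤-from (+-mono-≤ hi (≤-trans (s≤s z≤n) w<S)) {l} {2 * σ} 0 (lem l S σ))))
      where
      lem : ∀ l S σ → l + (2 * σ + 2 + S) + 0 ≡ 2 * σ + (S + suc l + 1)
      lem = solve-∀
    go : Clq S c E ⊎ Bs S c E ⊎ Sp S c E → Clq S (c + c₀) (E + E₀) ⊎ Bs S (c + c₀) (E + E₀) ⊎ Sp S (c + c₀) (E + E₀)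
    go (inj₁ (d , y , lo , hi , refl , e)) = inj₁ (d , y + c₀ , lo , hi , sym (+-assoc d y c₀) ,
      ≤-trans (+-mono-≤ e h) (≤-trans (≤-reflexive (+-assoc (d * (d ∸ 1)) _ _)) (+-monoʳ-≤ (d * (d ∸ 1)) (H-super l y c₀))))
    go (inj₂ (inj₁ (σ , (lo , hi) , e))) = inj₂ (inj₁ (σ , (lo , hi) , ≤-from (+-mono-≤ e (linear {σ} hi)) 0 (lem E E₀ σ c c₀)))
      where
      lem : ∀ E F σ c d → E + F + σ * suc σ + (2 * σ * c + 2 * σ * d) + 0 ≡ 2 * σ * (c + d) + (E + σ * suc σ + F)
      lem = solve-∀
    go (inj₂ (inj₂ (σ , eq , e , z))) = inj₂ (inj₂ (σ , eq , ≤-from (+-mono-≤ e (linear {σ} (≤-reflexive eq))) 0 (lem E E₀ σ c c₀) , z))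
      where
      lem : ∀ E F σ c d → E + F + σ * suc σ + (2 * σ * c + 2 + 2 * σ * d) + 0 ≡ 2 * σ * (c + d) + 2 + (E + σ * suc σ + F)
      lem = solve-∀

  nonpool-nonpool : ∀ {S₁ S₂ c₁ c₂ E₁ E₂} → NonPool S₁ c₁ E₁ → NonPool S₂ c₂ E₂ → NonPool (S₁ + S₂) (c₁ + c₂) (E₁ + E₂)
  nonpool-nonpool {S₁} {S₂} {c₁} {c₂} {E₁} {E₂} ((w<₁ , S≤₁) , out₁) ((w<₂ , S≤₂) , out₂) =
      (≤-trans w<₁ (m≤m+n S₁ S₂) , +-mono-≤ S≤₁ S≤₂) , go (split out₁ w<₁ S≤₁) (split out₂ w<₂ S≤₂)
    where
    split : ∀ {S c E} → Clq S c E ⊎ Bs S c E ⊎ Sp S c E → w < S → S ≤ c → Clq S c E ⊎ Wk S c E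
    split (inj₁ q) _ _ = inj₁ q
    split (inj₂ (inj₁ b)) _ _ = inj₂ (bs⇒wk b)
    split (inj₂ (inj₂ s)) p q = inj₂ (sp⇒wk p q s)
    swapped : ∀ {S c E S′ c′ E′} → S ≡ S′ → c ≡ c′ → E ≡ E′ → Clq S c E ⊎ Bs S c E → Clq S′ c′ E′ ⊎ Bs S′ c′ E′
    swapped refl refl refl o = o
    weaken : ∀ {S c E} → Clq S c E ⊎ Bs S c E → Clq S c E ⊎ Bs S c E ⊎ Sp S c E
    weaken (inj₁ q) = inj₁ q
    weaken (inj₂ b) = inj₂ (inj₁ b)
    go : Clq S₁ c₁ E₁ ⊎ Wk S₁ c₁ E₁ → Clq S₂ c₂ E₂ ⊎ Wk S₂ c₂ E₂ → _
    go (inj₁ q₁) (inj₁ q₂) = inj₁ (clq-clq w<₁ q₁ q₂)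
    go (inj₂ k₁) (inj₂ k₂) = inj₂ (inj₁ (wk-wk w<₁ w<₂ S≤₁ S≤₂ (s≤s z≤n) k₁ k₂))
    go (inj₂ k₁) (inj₁ q₂) = weaken (wk-clq w<₁ w<₂ S≤₁ (s≤s z≤n) k₁ q₂)
    go (inj₁ q₁) (inj₂ k₂) = weaken (swapped (+-comm S₂ S₁) (+-comm c₂ c₁) (+-comm E₂ E₁) (wk-clq w<₂ w<₁ S≤₂ (s≤s z≤n) k₂ q₁))

  merge : ∀ {S₁ S₂ c₁ c₂ E₁ E₂} → Agg S₁ c₁ E₁ → Agg S₂ c₂ E₂ → Agg (S₁ + S₂) (c₁ + c₂) (E₁ + E₂)
  merge {c₁ = c₁} {c₂} (inj₁ (refl , h₁)) (inj₁ (refl , h₂)) = inj₁ (refl , ≤-trans (+-mono-≤ h₁ h₂) (H-super l c₁ c₂))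
  merge {S₂ = S₂} {c₁} {c₂} {E₁} {E₂} (inj₁ (refl , h₁)) (inj₂ n₂) =
    inj₂ (subst₂ (NonPool S₂) (+-comm c₂ c₁) (+-comm E₂ E₁) (pool-nonpool h₁ n₂))
  merge {S₁} {S₂} {c₁} {c₂} {E₁} {E₂} (inj₂ n₁) (inj₁ (refl , h₂)) =
    inj₂ (subst (λ S → NonPool S (c₁ + c₂) (E₁ + E₂)) (sym (+-identityʳ S₁)) (pool-nonpool h₂ n₁))
  merge (inj₂ n₁) (inj₂ n₂) = inj₂ (nonpool-nonpool n₁ n₂)

  -- The big clique is enlarged to its maximal order T + w: a vertex taken from the small cliques
  -- gives up degree at most l there and gains at least d ≥ l.
  agg-bound : ∀ {T x E} → Agg T (T + w + x) E →
    E ≤ (T + w) * (T + w ∸ 1) + H l x ⊎ (w < T × (Bs T (T + w + x) E ⊎ Sp T (T + w + x) E))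
  agg-bound {x = x} (inj₁ (refl , h)) = inj₁ (≤-trans h (≤-reflexive (trans (cong (H l) (+-comm w x)) (trans (H-+w l x) (+-comm (H l x) _)))))
  agg-bound (inj₂ ((w<T , _) , inj₂ o)) = inj₂ (w<T , o)
  agg-bound {T} {x} {E} (inj₂ ((w<T , _) , inj₁ (d , y , lo , hi , eq , e))) with ≤⇒∃+ hi
  ... | t , hi≡ = inj₁ (begin
      E                                                   ≤⟨ e ⟩
      d * (d ∸ 1) + H l y                                 ≡⟨ cong (λ a → d * (d ∸ 1) + H l a) y≡ ⟩
      d * (d ∸ 1) + H l (x + t)                           ≤⟨ +-monoʳ-≤ (d * (d ∸ 1)) (H-step l x t) ⟩
      d * (d ∸ 1) + (H l x + 2 * l * t)                   ≤⟨ +-monoʳ-≤ (d * (d ∸ 1)) (+-monoʳ-≤ (H l x) (*-monoˡ-≤ t (*-monoʳ-≤ 2 (≤-trans (≤-trans (n≤1+n l) (<⇒≤ w<T)) lo)))) ⟩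
      d * (d ∸ 1) + (H l x + 2 * d * t)                   ≤⟨ m≤m+n _ (t * (t ∸ 1)) ⟩
      d * (d ∸ 1) + (H l x + 2 * d * t) + t * (t ∸ 1)     ≡⟨ lem (d * (d ∸ 1)) (H l x) (2 * d * t) (t * (t ∸ 1)) ⟩
      d * (d ∸ 1) + 2 * d * t + t * (t ∸ 1) + H l x       ≡⟨ cong (_+ H l x) (pred-+ d t) ⟨
      (d + t) * (d + t ∸ 1) + H l x                       ≡⟨ cong (λ a → a * (a ∸ 1) + H l x) hi≡ ⟨
      (T + w) * (T + w ∸ 1) + H l x                       ∎)
    where
    open ≤-Reasoning
    lem : ∀ a h b c → a + (h + b) + c ≡ a + b + c + h
    lem = solve-∀
    y≡ : y ≡ x + t
    y≡ = +-cancelˡ-≡ d y (x + t) (trans eq (trans (cong (_+ x) hi≡) (trans (+-assoc d t x) (cong (d +_) (+-comm t x)))))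

-- The edge bound of a single component

-- Parity turns any excess over 2σc - σ(σ + 1) into an excess of at least 2, that is, into
-- tightness.
edges₂-even : ∀ {n} (G : Graph n) f A → card A ≤ f → ∃ λ k → edges₂ G A ≡ 2 * k
edges₂-even G f A le with card A in eq
... | zero = 0 , n≤0⇒n≡0 (subst (λ c → edges₂ G A ≤ c * (c ∸ 1)) eq (edges₂≤ G A))
edges₂-even G (suc f) A (s≤s le) | suc c with card>0⇒∃ A (subst (0 <_) (sym eq) z<s)
... | v , v∈ with edges₂-even G f (A ─ v) (≤-trans (≤-reflexive (suc-injective (trans (sym (card-─ A v∈)) eq))) le)
...   | k , e = k + deg G A v , trans (edges₂-remove G A v∈) (trans (cong (_+ 2 * deg G A v) e) (sym (*-distribˡ-+ 2 k _)))

n*suc-even : ∀ s → ∃ λ t → s * suc s ≡ 2 * t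
n*suc-even zero = 0 , refl
n*suc-even (suc s) with n*suc-even s
... | t , e = t + suc s , trans (lem s) (trans (cong (_+ 2 * suc s) e) (sym (*-distribˡ-+ 2 t (suc s))))
  where
  lem : ∀ s → suc s * suc (suc s) ≡ s * suc s + 2 * suc s
  lem = solve-∀

module _ {n : ℕ} (G : Graph n) where

  -- The orders run through all ways to write 2σ + 3 as an even number ≥ 2 plus an odd number ≥ 3.
  LongPairs : ℕ → Set
  LongPairs σ = ∀ i j → σ ≡ suc (i + j) → ¬ ¬ TwoPaths G full (2 + 2 * i) (3 + 2 * j)

  ComponentBound : ℕ → ℕ → ℕ → ℕ → Set
  ComponentBound P σ c E = E ≤ P * (P ∸ 1) ⊎ E + σ * suc σ ≤ 2 * σ * c ⊎ (P ≡ 2 * σ + 2 × E + σ * suc σ ≤ 2 * σ * c + 2 × LongPairs σ)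

  -- If G is not saturated on C, the edges gained by saturating pay for the additional edge. If it
  -- is saturated and still exceeds the plain bound, it is tight, and the extremal analysis supplies
  -- the pairs of paths.
  component : ∀ {C P σ} → Conn G C → Free G C P → P ≡ 2 * σ + 1 ⊎ P ≡ 2 * σ + 2 → P ≤ card C →
    ¬ ¬ ComponentBound P σ (card C) (edges₂ G C)
  component {C} {P} {σ} conn free par Pc k = saturate C P (card C * (card C ∸ 1)) G free (m≤n+m _ _) λ
      { (inj₁ sat) → k (own (kopylov G conn free sat (proj₁ (parity-bounds σ par)) (proj₂ (parity-bounds σ par)) Pc))
      ; (inj₂ (G′ , le , free′ , sat , more)) → k (above {G′} more (kopylov G′ (conn-⊑ {G = G} {G′} le conn) free′ sat (proj₁ (parity-bounds σ par)) (proj₂ (parity-bounds σ par)) Pc)) }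
    where
    c = card C
    E = edges₂ G C
    above : ∀ {G′} → 2 + E ≤ edges₂ G′ C → edges₂ G′ C + σ * suc σ ≤ 2 * σ * c ⊎ Kopylov₂ G′ C P σ → ComponentBound P σ c E
    above more (inj₁ b) = inj₂ (inj₁ (≤-trans (+-monoˡ-≤ (σ * suc σ) (≤-trans (m≤n+m E 2) more)) b))
    above {G′} more (inj₂ (D , a , _ , _ , d≥ , da , bd)) with kopylov-bound {E = edges₂ G′ C} par da d≥ Pc bd
    ... | inj₁ q = inj₁ (≤-trans (m≤n+m E 2) (≤-trans more q))
    ... | inj₂ (inj₁ b) = inj₂ (inj₁ (≤-trans (+-monoˡ-≤ (σ * suc σ) (≤-trans (m≤n+m E 2) more)) b))
    ... | inj₂ (inj₂ (_ , _ , b)) = inj₂ (inj₁ (≤-from (+-mono-≤ more b) 0 (lem E σ c (edges₂ G′ C))))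
      where
      lem : ∀ E σ c F → E + σ * suc σ + (F + (2 * σ * c + 2)) + 0 ≡ 2 * σ * c + (2 + E + (F + σ * suc σ))
      lem = solve-∀
    own : E + σ * suc σ ≤ 2 * σ * c ⊎ Kopylov₂ G C P σ → ComponentBound P σ c E
    own (inj₁ b) = inj₂ (inj₁ b)
    own (inj₂ (D , a , isCore , cp , d≥ , da , bd)) with kopylov-bound {E = E} par da d≥ Pc bd
    ... | inj₁ q = inj₁ q
    ... | inj₂ (inj₁ b) = inj₂ (inj₁ b)
    ... | inj₂ (inj₂ (P≡ , d≡ , b)) with E + σ * suc σ ≤? 2 * σ * c | c ≤? P
    ...   | yes b′ | _ = inj₂ (inj₁ b′)
    -- On exactly P vertices the clique bound is trivial. The next case thus has |C| ≥ 2σ + 3, as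
    -- the extremal analysis requires.
    ...   | no _ | yes c≤P = inj₁ (subst (λ z → E ≤ z * (z ∸ 1)) (≤-antisym c≤P Pc) (edges₂≤ G C))
    ...   | no over | no c≰P = inj₂ (inj₂ (P≡ , b , λ i j s≡ kk →
              extremal-two-paths G cp d≡ (c ∸ (2 * σ + 3)) conn (subst (Free G C) P≡ free) isCore
                (sym (m∸n+n≡m (subst (_≤ c) (trans (cong suc P≡) (sym (+-suc (2 * σ) 2))) (≰⇒> c≰P)))) tight i j s≡
                λ (l₁ , l₂ , k₁ , k₂ , sm , e₁ , e₂) → kk (l₁ , l₂ , k₁ , k₂ , simple-⊆ (λ _ _ → refl) sm , e₁ , e₂)))
      where
      even : 2 * σ * c + 2 ≤ E + σ * suc σ
      even with edges₂-even G c C ≤-refl | n*suc-even σ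
      ... | h , eh | t , et = subst₂ _≤_ (lem σ c) (trans (*-distribˡ-+ 2 h t) (sym (cong₂ _+_ eh et)))
          (*-monoʳ-≤ 2 (*-cancelˡ-< 2 (σ * c) (h + t) (subst₂ _<_ (*-assoc 2 σ c) (trans (cong₂ _+_ eh et) (sym (*-distribˡ-+ 2 h t))) (≰⇒> over))))
        where
        lem : ∀ s c → 2 * suc (s * c) ≡ 2 * s * c + 2
        lem = solve-∀
      tight : Tight G C σ
      tight = ≤-from even 0 (lem σ c E)
        where
        lem : ∀ s c E → suc (suc s) * suc s + 2 * s * c + (E + s * suc s) + 0 ≡ E + 2 * s * suc (suc s) + (2 * s * c + 2)
        lem = solve-∀

  module _ (l : ℕ) where
    open Merge l LongPairs

    component-agg : ∀ {C S} → Conn G C → Free G C (S + suc l) → S ≤ card C → S ≡ 0 ⊎ suc l < S → ¬ ¬ Agg S (card C) (edges₂ G C)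
    component-agg {C} {.0} conn free S≤ (inj₁ refl) k with card C ≤? suc l
    ... | yes c≤ = k (inj₁ (refl , subst (edges₂ G C ≤_) (sym (H-clique l c≤)) (edges₂≤ G C)))
    ... | no c≰ with half (suc l) (s≤s z≤n) | ≤⇒∃+ (<⇒≤ (≰⇒> c≰))
    ...   | σ , par | y , c≡ = component conn free par (<⇒≤ (≰⇒> c≰)) λ b → k (inj₁ (refl , bound b))
      where
      E = edges₂ G C
      c = card C
      bound : ComponentBound (suc l) σ c E → E ≤ H l c
      bound (inj₁ q) = ≤-trans q (≤-trans (≤-reflexive (sym (H-clique l ≤-refl))) (subst (λ z → H l (suc l) ≤ H l z) (sym c≡) (H-mono l (suc l) y)))
      bound (inj₂ (inj₁ b)) = +-cancelʳ-≤ (σ * suc σ) _ _ (≤-trans b (H-linear l {σ} (proj₁ (parity-bounds σ par)) c))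
      -- Here w = 2σ + 2 and l = 2σ + 1, so w · l exceeds 2σw by 2σ + 2, which covers the additional
      -- 2.
      bound (inj₂ (inj₂ (P≡ , b , _))) = ≤-trans (≤-from (+-mono-≤ b (H-linear l {σ} (proj₁ (parity-bounds σ par)) y)) (2 * σ) eq)
          (≤-reflexive (trans (sym (H-+w l y)) (cong (H l) (trans (+-comm y (suc l)) (sym c≡)))))
        where
        lem : ∀ E s y h → E + (2 * s * (2 * s + 2 + y) + 2 + (h + s * suc s)) + 2 * s ≡ h + (2 * s + 2) * (2 * s + 1) + (E + s * suc s + 2 * s * y)
        lem = solve-∀
        l≡ : l ≡ 2 * σ + 1
        l≡ = suc-injective (trans P≡ (+-suc (2 * σ) 1))
        eq : E + (2 * σ * c + 2 + (H l y + σ * suc σ)) + 2 * σ ≡ H l y + suc l * l + (E + σ * suc σ + 2 * σ * y)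
        eq = trans (cong (λ z → E + (2 * σ * z + 2 + (H l y + σ * suc σ)) + 2 * σ) (trans c≡ (cong (_+ y) P≡)))
          (trans (lem E σ y (H l y)) (cong₂ (λ a b → H l y + a * b + (E + σ * suc σ + 2 * σ * y)) (sym P≡) (sym l≡)))
    component-agg {C} {S} conn free S≤ (inj₂ w<S) k with card C ≤? S + suc l
    ... | yes c≤ = k (inj₂ ((w<S , S≤) , inj₁ (card C , 0 , S≤ , c≤ , +-identityʳ _ , ≤-trans (edges₂≤ G C) (≤-reflexive (sym (+-identityʳ _))))))
    ... | no c≰ with half (S + suc l) (≤-trans (s≤s z≤n) (m≤n+m (suc l) S)) | ≤⇒∃+ (<⇒≤ (≰⇒> c≰))
    ...   | σ , par | y , c≡ = component conn free par (<⇒≤ (≰⇒> c≰)) λ b → k (inj₂ ((w<S , S≤) , bound b))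
      where
      bound : ComponentBound (S + suc l) σ (card C) (edges₂ G C) → Clq S (card C) (edges₂ G C) ⊎ Bs S (card C) (edges₂ G C) ⊎ Sp S (card C) (edges₂ G C)
      bound (inj₁ q) = inj₁ (S + suc l , y , m≤m+n S _ , ≤-refl , sym c≡ , ≤-trans q (m≤m+n _ _))
      bound (inj₂ (inj₁ b)) = inj₂ (inj₁ (σ , parity-bounds σ par , b))
      bound (inj₂ (inj₂ (P≡ , b , z))) = inj₂ (inj₂ (σ , P≡ , b , z))

  -- Components with their longest paths, and first fit

  -- Packing cuts pieces off the front of a longest path, and `r` is what remains of it. The sum S +
  -- length r stays equal to the order of that path, so `free` and `room` are invariant under
  -- packing.
  record Bin : Set where
    constructor bin
    field
      C    : Sub n
      S    : ℕ
      r    : List (Fin n)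
      conn : Conn G C
      path : IsPath G C r
      free : Free G C (S + length r)
      room : S + length r ≤ card C

  open Bin

  total : (Bin → ℕ) → List Bin → ℕ
  total f [] = 0
  total f (b ∷ bs) = f b + total f bs

  total-++ : ∀ f xs {ys} → total f (xs ++ ys) ≡ total f xs + total f ys
  total-++ f [] = refl
  total-++ f (x ∷ xs) = trans (cong (f x +_) (total-++ f xs)) (sym (+-assoc (f x) _ _))

  rems : List Bin → List (Fin n)
  rems [] = []
  rems (b ∷ bs) = r b ++ rems bs

  rems-++ : ∀ xs {ys} → rems (xs ++ ys) ≡ rems xs ++ rems ys
  rems-++ [] = refl
  rems-++ (x ∷ xs) = trans (cong (r x ++_) (rems-++ xs)) (sym (++-assoc (r x) _ _))

  vertices edgesIn : Bin → ℕ
  vertices b = card (C b)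
  edgesIn b = edges₂ G (C b)

  Splits : Sub n → Set
  Splits A = ∃ λ T → (∃ λ u → u ∈ₛ (A ∩ T)) × (∃ λ v → v ∈ₛ (A ∖ T)) × (∀ i j → i ∈ₛ (A ∩ T) → j ∈ₛ (A ∖ T) → adj G i j ≡ false)

  ¬splits⇒conn : ∀ {A} → ¬ Splits A → Conn G A
  ¬splits⇒conn {A} ¬s T u v u∈ u∈T v∈ v∉T
    with any? (λ a → any? (λ b → ((A ∩ T) a Bool.≟ true) ×-dec ((A ∖ T) b Bool.≟ true) ×-dec (adj G a b Bool.≟ true)))
  ... | yes (a , b , a∈ , b∈ , ab) = let (p , q) = ∧-true {A a} a∈ ; (p′ , q′) = ∧-true {A b} b∈ in
          a , b , (p , q) , (p′ , true-not q′) , ab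
  ... | no none = ⊥-elim (¬s (T , (u , true-∧ u∈ u∈T) , (v , true-∧ v∈ (not-true v∉T)) ,
          λ i j i∈ j∈ → ¬true⇒false λ e → none (i , j , i∈ , j∈ , e)))

  -- The existence of a split quantifies over all vertex sets. The continuation form with result ⊥
  -- allows a classical case distinction on it.
  decompose : ∀ f A → card A ≤ f → (∀ bs → total vertices bs ≡ card A → total edgesIn bs ≡ edges₂ G A →
    All (λ b → S b ≡ 0) bs → Simple A (rems bs) → ⊥) → ⊥
  decompose f A le k with card A in eq
  ... | zero = k [] refl (sym (n≤0⇒n≡0 (subst (λ c → edges₂ G A ≤ c * (c ∸ 1)) eq (edges₂≤ G A)))) [] ([] , [])
  decompose (suc f) A (s≤s le) k | suc c = ¬¬-excluded-middle λ
      { (no ¬s) → leaf (¬splits⇒conn ¬s)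
      ; (yes s) → node s }
    where
    v₀ = card>0⇒∃ A (subst (0 <_) (sym eq) z<s)
    leaf : Conn G A → ⊥
    leaf conn = longest G {A} {card A} (λ l (_ , (u , a)) → unique-length≤card A l u a) (card A) [ proj₁ v₀ ]
        ([-] , ([] ∷ [] , proj₂ v₀ ∷ [])) (m≤n+m _ 1) λ (l , path , free) →
      k [ bin A 0 l conn path free (unique-length≤card A l (proj₁ (proj₂ path)) (proj₂ (proj₂ path))) ]
        (trans (+-identityʳ _) eq) (+-identityʳ _) (refl ∷ []) (subst (Simple A) (sym (++-identityʳ l)) (proj₂ path))
    node : Splits A → ⊥
    node (T , (u , u∈) , (v , v∈) , none) =
      decompose f (A ∩ T) (≤-pred (begin
          suc (card (A ∩ T))             ≡⟨ +-comm 1 (card (A ∩ T)) ⟩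
          card (A ∩ T) + 1               ≤⟨ +-monoʳ-≤ (card (A ∩ T)) (∃⇒card>0 {A = A ∖ T} v∈) ⟩
          card (A ∩ T) + card (A ∖ T)    ≡⟨ card-split A T ⟨
          card A                         ≡⟨ eq ⟩
          suc c                          ≤⟨ s≤s le ⟩
          suc f                          ∎)) λ bs₁ v₁ e₁ z₁ s₁ →
      decompose f (A ∖ T) (≤-pred (begin
          suc (card (A ∖ T))             ≤⟨ +-monoˡ-≤ (card (A ∖ T)) (∃⇒card>0 {A = A ∩ T} u∈) ⟩
          card (A ∩ T) + card (A ∖ T)    ≡⟨ card-split A T ⟨
          card A                         ≡⟨ eq ⟩
          suc c                          ≤⟨ s≤s le ⟩
          suc f                          ∎)) λ bs₂ v₂ e₂ z₂ s₂ →
      k (bs₁ ++ bs₂) (trans (total-++ vertices bs₁) (trans (cong₂ _+_ v₁ v₂) (trans (sym (card-split A T)) eq)))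
        (trans (total-++ edgesIn bs₁) (trans (cong₂ _+_ e₁ e₂) (sym (edges₂-split G A T none))))
        (All.++⁺ z₁ z₂)
        (subst (Simple A) (sym (rems-++ bs₁)) (simple-++⁺ (simple-⊆ (λ j p → proj₁ (∧-true {A j} p)) s₁) (simple-⊆ (λ j p → proj₁ (∧-true {A j} p)) s₂)
          λ {j} p q → true≢false (proj₂ (∧-true {A j} (All.lookup (proj₂ s₁) p))) (true-not (proj₂ (∧-true {A j} (All.lookup (proj₂ s₂) q))))))
      where open ≤-Reasoning

  bins-agg : ∀ l bs → All (λ b → length (r b) ≤ suc l) bs → All (λ b → S b ≡ 0 ⊎ suc l < S b) bs →
    ¬ ¬ Merge.Agg l LongPairs (total S bs) (total vertices bs) (total edgesIn bs)
  bins-agg l [] _ _ k = k (inj₁ (refl , z≤n))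
  bins-agg l (b ∷ bs) (len ∷ lens) (s ∷ ss) k =
    component-agg l (conn b) (λ p pp → ≤-trans (free b p pp) (+-monoʳ-≤ (S b) len)) (≤-trans (m≤m+n (S b) _) (room b)) s λ a₁ →
    bins-agg l bs lens ss λ a₂ → k (Merge.merge l LongPairs a₁ a₂)

  -- Embeddings of linear forests into the vertices of a list

  Embed : ∀ {m} → (Fin m → ℕ) → List (Fin n) → Set
  Embed {m} k l = Σ ((i : Fin m) → Fin (k i) → Fin n) λ f → (∀ i p → f i p ∈ l) ×
    (∀ i p q → toℕ q ≡ suc (toℕ p) → Adj G (f i p) (f i q)) ×
    (∀ {i j} p q → f i p ≡ f j q → _≡_ {A = Σ (Fin m) (λ i → Fin (k i))} (i , p) (j , q))

  at : ∀ {k} (l : List (Fin n)) → length l ≡ k → Fin k → Fin n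
  at (x ∷ l) refl zero = x
  at (x ∷ l) refl (suc p) = at l refl p

  at-∈ : ∀ {k} (l : List (Fin n)) (e : length l ≡ k) p → at l e p ∈ l
  at-∈ (x ∷ l) refl zero = here refl
  at-∈ (x ∷ l) refl (suc p) = there (at-∈ l refl p)

  at-linked : ∀ {k} (l : List (Fin n)) (e : length l ≡ k) → Linked (Adj G) l → ∀ p q → toℕ q ≡ suc (toℕ p) → Adj G (at l e p) (at l e q)
  at-linked (x ∷ y ∷ l) refl (a ∷ _) zero (suc zero) _ = a
  at-linked (x ∷ y ∷ l) refl (_ ∷ k) (suc p) (suc q) eq = at-linked (y ∷ l) refl k p q (suc-injective eq)

  at-injective : ∀ {k} (l : List (Fin n)) (e : length l ≡ k) → Unique l → ∀ p q → at l e p ≡ at l e q → p ≡ q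
  at-injective (x ∷ l) refl _ zero zero _ = refl
  at-injective (x ∷ l) refl (x∉ ∷ _) zero (suc q) eq = ⊥-elim (All.lookup x∉ (at-∈ l refl q) eq)
  at-injective (x ∷ l) refl (x∉ ∷ _) (suc p) zero eq = ⊥-elim (All.lookup x∉ (at-∈ l refl p) (sym eq))
  at-injective (x ∷ l) refl (_ ∷ u) (suc p) (suc q) eq = cong suc (at-injective l refl u p q eq)

  embed-∷ : ∀ {m} {k : Fin (suc m) → ℕ} t {l l′} → length t ≡ k zero → Linked (Adj G) t → Unique t →
    (∀ {v} → v ∈ t → v ∈ l) → (∀ {v} → v ∈ l′ → v ∈ l) → (∀ {v} → v ∈ t → v ∈ l′ → ⊥) → Embed (k ∘ suc) l′ → Embed k l
  embed-∷ {m} {k} t {l} {l′} len lk un t⊆ l⊆ dis (f , f∈ , fa , fi) = g , g∈ , ga , gi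
    where
    g : (i : Fin (suc m)) → Fin (k i) → Fin n
    g zero p = at t len p
    g (suc i) p = f i p
    g∈ : ∀ i p → g i p ∈ l
    g∈ zero p = t⊆ (at-∈ t len p)
    g∈ (suc i) p = l⊆ (f∈ i p)
    ga : ∀ i p q → toℕ q ≡ suc (toℕ p) → Adj G (g i p) (g i q)
    ga zero = at-linked t len lk
    ga (suc i) = fa i
    gi : ∀ {i j} p q → g i p ≡ g j q → _≡_ {A = Σ (Fin (suc m)) (λ i → Fin (k i))} (i , p) (j , q)
    gi {zero} {zero} p q eq = cong (zero ,_) (at-injective t len un p q eq)
    gi {zero} {suc j} p q eq = ⊥-elim (dis (at-∈ t len p) (subst (_∈ l′) (sym eq) (f∈ j q)))
    gi {suc i} {zero} p q eq = ⊥-elim (dis (at-∈ t len q) (subst (_∈ l′) eq (f∈ i p)))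
    gi {suc i} {suc j} p q eq = cong (λ (i , p) → suc i , p) (fi p q eq)

  embed-[] : ∀ {k : Fin 0 → ℕ} {l} → Embed k l
  embed-[] = (λ ()) , (λ ()) , (λ ()) , λ { {()} }

  embed⇒contains : ∀ {m} {k : Fin m → ℕ} {l} → Embed k l → Contains G (LinearForest m k)
  embed⇒contains {m} {k} (f , _ , fa , fi) = (λ (i , p) → f i p) , (λ { {i , p} {j , q} → fi p q }) , ad
    where
    ad : ∀ u v → Pattern.Adj (LinearForest m k) u v → Adj G (f (proj₁ u) (proj₂ u)) (f (proj₁ v) (proj₂ v))
    ad (i , p) (j , q) (refl , inj₁ e) = fa i p q e
    ad (i , p) (j , q) (refl , inj₂ e) = adj-sym G (fa i q p e)

  find-bin : ∀ k bs → All (λ b → length (r b) < k) bs ⊎ (∃ λ xs → ∃₂ λ b ys → bs ≡ xs ++ b ∷ ys × k ≤ length (r b))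
  find-bin k [] = inj₁ []
  find-bin k (b ∷ bs) with k ≤? length (r b) | find-bin k bs
  ... | yes le | _ = inj₂ ([] , b , bs , refl , le)
  ... | no ¬le | inj₁ a = inj₁ (≰⇒> ¬le ∷ a)
  ... | no ¬le | inj₂ (xs , b′ , ys , refl , le) = inj₂ (b ∷ xs , b′ , ys , refl , le)

  -- A used bin holds an earlier, hence at least equally long path; this is the alternative S = 0 or
  -- k_j ≤ S on which the merging rests.
  Fail : ∀ {m} → (Fin m → ℕ) → List Bin → Set
  Fail k bs = ∃₂ λ j bs′ → All (λ b → length (r b) < k j) bs′ × All (λ b → S b ≡ 0 ⊎ k j ≤ S b) bs′ ×
    total S bs′ ≡ total S bs + psum k (toℕ j) × total vertices bs′ ≡ total vertices bs × total edgesIn bs′ ≡ total edgesIn bs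

  first-fit : ∀ {m} (k : Fin m → ℕ) bs → (∀ i j → toℕ i ≤ toℕ j → k j ≤ k i) → Unique (rems bs) →
    (∀ i → All (λ b → S b ≡ 0 ⊎ k i ≤ S b) bs) → Embed k (rems bs) ⊎ Fail k bs
  first-fit {zero} k bs dec un inv = inj₁ embed-[]
  first-fit {suc m} k bs dec un inv with find-bin (k zero) bs
  ... | inj₁ small = inj₂ (zero , bs , small , inv zero , sym (+-identityʳ _) , refl , refl)
  ... | inj₂ (xs , b , ys , refl , le) = go (first-fit (k ∘ suc) bs′ (λ i j ij → dec (suc i) (suc j) (s≤s ij)) (unique-++⁻ʳ t un′) inv′)
    where
    k₀ = k zero
    t = take k₀ (r b)
    d = drop k₀ (r b)
    td : t ++ d ≡ r b
    td = take++drop≡id k₀ (r b)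
    lt : length t ≡ k₀
    lt = trans (length-take k₀ (r b)) (m≤n⇒m⊓n≡m le)
    kk = linked-++⁻ t (subst (Linked (Adj G)) (sym td) (proj₁ (path b)))
    len : length t + length d ≡ length (r b)
    len = trans (sym (length-++ t)) (cong length td)
    len′ : S b + k₀ + length d ≡ S b + length (r b)
    len′ = trans (+-assoc (S b) k₀ _) (cong (S b +_) (trans (cong (_+ length d) (sym lt)) len))
    b′ : Bin
    b′ = bin (C b) (S b + k₀) d (conn b) (proj₂ kk , simple-++⁻ʳ t (subst (Simple (C b)) (sym td) (proj₂ (path b))))
      (subst (Free G (C b)) (sym len′) (free b)) (≤-trans (≤-reflexive len′) (room b))
    bs′ = xs ++ b′ ∷ ys
    perm : rems bs ↭ t ++ rems bs′
    perm = ↭-trans (↭-reflexive (trans (rems-++ xs) (cong (λ z → rems xs ++ z ++ rems ys) (sym td))))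
      (↭-trans (↭-reflexive (trans (cong (rems xs ++_) (++-assoc t d (rems ys))) (sym (++-assoc (rems xs) t _))))
      (↭-trans (++⁺ʳ (d ++ rems ys) (++-comm-↭ (rems xs) t))
        (↭-reflexive (trans (++-assoc t (rems xs) _) (cong (t ++_) (sym (rems-++ xs)))))))
    un′ : Unique (t ++ rems bs′)
    un′ = unique-↭ perm un
    inv′ : ∀ i → All (λ b → S b ≡ 0 ⊎ k (suc i) ≤ S b) bs′
    inv′ i with All.++⁻ xs (inv (suc i))
    ... | ax , _ ∷ ay = All.++⁺ ax (inj₂ (≤-trans (dec zero (suc i) z≤n) (m≤n+m k₀ (S b))) ∷ ay)
    same : ∀ f → f b′ ≡ f b → total f bs′ ≡ total f bs
    same f e = trans (total-++ f xs) (trans (cong (λ z → total f xs + (z + total f ys)) e) (sym (total-++ f xs)))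
    totalS : total S bs′ ≡ total S bs + k₀
    totalS = trans (total-++ S xs) (trans (lem (total S xs) (S b) k₀ (total S ys)) (cong (_+ k₀) (sym (total-++ S xs))))
      where
      lem : ∀ a b c d → a + (b + c + d) ≡ a + (b + d) + c
      lem = solve-∀
    go : Embed (k ∘ suc) (rems bs′) ⊎ Fail (k ∘ suc) bs′ → Embed k (rems bs) ⊎ Fail k bs
    go (inj₁ emb) = inj₁ (embed-∷ t lt (proj₁ kk) (unique-++⁻ˡ t un′) (λ p → ∈-resp-↭ (↭-sym perm) (∈-++⁺ˡ p))
      (λ p → ∈-resp-↭ (↭-sym perm) (∈-++⁺ʳ t p)) (unique-disjoint t un′) emb)
    go (inj₂ (j , bs″ , small , iv , eS , ev , ee)) = inj₂ (suc j , bs″ , small , iv ,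
      trans eS (trans (cong (_+ psum (k ∘ suc) (toℕ j)) totalS) (+-assoc (total S bs) k₀ _)) ,
      trans ev (same vertices refl) , trans ee (same edgesIn refl))

  embed-path : ∀ {m} (k : Fin m → ℕ) l → Linked (Adj G) l → Unique l → psum k m ≤ length l → Embed k l
  embed-path {zero} k l lk un le = embed-[]
  embed-path {suc m} k l lk un le = embed-∷ t (trans (length-take k₀ l) (m≤n⇒m⊓n≡m (≤-trans (m≤m+n k₀ _) le))) (proj₁ kk)
      (Unique.take⁺ k₀ un) (λ p → subst (_ ∈_) td (∈-++⁺ˡ p)) (λ p → subst (_ ∈_) td (∈-++⁺ʳ t p))
      (unique-disjoint t (subst Unique (sym td) un))
      (embed-path (k ∘ suc) (drop k₀ l) (proj₂ kk) (Unique.drop⁺ k₀ un)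
        (≤-trans (m+n≤o⇒m≤o∸n _ (≤-trans (≤-reflexive (+-comm _ k₀)) le)) (≤-reflexive (sym (length-drop k₀ l)))))
    where
    k₀ = k zero
    t = take k₀ l
    td : t ++ drop k₀ l ≡ l
    td = take++drop≡id k₀ l
    kk = linked-++⁻ t (subst (Linked (Adj G)) (sym td) lk)

-- Values of the two brackets

2*nC2 : ∀ a → 2 * (a choose 2) ≡ a * (a ∸ 1)
2*nC2 zero = refl
2*nC2 (suc a) = begin
  2 * (suc a choose 2)              ≡⟨ cong (2 *_) (nCk+nC[k+1]≡[n+1]C[k+1] a 1) ⟨
  2 * (a choose 1 + a choose 2)          ≡⟨ cong (λ z → 2 * (z + a choose 2)) (nC1≡n a) ⟩
  2 * (a + a choose 2)              ≡⟨ *-distribˡ-+ 2 a (a choose 2) ⟩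
  2 * a + 2 * (a choose 2)          ≡⟨ cong (2 * a +_) (2*nC2 a) ⟩
  2 * a + a * (a ∸ 1)          ≡⟨ lem a ⟩
  suc a * a                    ∎
  where
  open ≡-Reasoning
  lem : ∀ a → 2 * a + a * (a ∸ 1) ≡ suc a * a
  lem zero = refl
  lem (suc a) = lem′ a
    where
    lem′ : ∀ a → 2 * suc a + suc a * a ≡ suc (suc a) * suc a
    lem′ = solve-∀

H-+*w : ∀ l r t → H l (r + t * suc l) ≡ H l r + t * (suc l * l)
H-+*w l r zero = trans (cong (H l) (+-identityʳ r)) (sym (+-identityʳ _))
H-+*w l r (suc t) = begin
  H l (r + (suc l + t * suc l))              ≡⟨ cong (H l) (lem r (suc l) (t * suc l)) ⟩
  H l (r + t * suc l + suc l)                ≡⟨ H-+w l (r + t * suc l) ⟩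
  H l (r + t * suc l) + suc l * l            ≡⟨ cong (_+ suc l * l) (H-+*w l r t) ⟩
  H l r + t * (suc l * l) + suc l * l        ≡⟨ lem′ (H l r) (t * (suc l * l)) (suc l * l) ⟩
  H l r + (suc l * l + t * (suc l * l))      ∎
  where
  open ≡-Reasoning
  lem : ∀ a b c → a + (b + c) ≡ a + c + b
  lem = solve-∀
  lem′ : ∀ a b c → a + b + c ≡ a + (c + b)
  lem′ = solve-∀

H-divMod : ∀ l q → 2 * ((q / suc l) * (suc l choose 2)) + 2 * ((q % suc l) choose 2) ≡ H l q
H-divMod l q = begin
  2 * (t * (suc l choose 2)) + 2 * (r choose 2)        ≡⟨ cong₂ _+_ (trans (lem t (suc l choose 2)) (cong (t *_) (2*nC2 (suc l)))) (2*nC2 r) ⟩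
  t * (suc l * l) + r * (r ∸ 1)              ≡⟨ +-comm (t * (suc l * l)) _ ⟩
  r * (r ∸ 1) + t * (suc l * l)              ≡⟨ cong (_+ t * (suc l * l)) (H-clique l (<⇒≤ (m%n<n q (suc l)))) ⟨
  H l r + t * (suc l * l)                    ≡⟨ H-+*w l r t ⟨
  H l (r + t * suc l)                        ≡⟨ cong (H l) (m≡m%n+[m/n]*n q (suc l)) ⟨
  H l q                                      ∎
  where
  open ≡-Reasoning
  r = q % suc l
  t = q / suc l
  lem : ∀ t c → 2 * (t * c) ≡ t * (2 * c)
  lem = solve-∀

bracket3-value : ∀ n m l → m ∸ 1 < n → 2 * bracket3 n m (suc (suc l)) ≡ (m ∸ 1) * (m ∸ 1 ∸ 1) + H l (n ∸ (m ∸ 1))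
bracket3-value n m l lt with n ≤? m ∸ 1
... | yes le = ⊥-elim (<⇒≱ lt le)
... | no _ = begin
  2 * ((m ∸ 1) choose 2 + (q / suc l) * (suc l choose 2) + (q % suc l) choose 2)              ≡⟨ lem ((m ∸ 1) choose 2) ((q / suc l) * (suc l choose 2)) ((q % suc l) choose 2) ⟩
  2 * ((m ∸ 1) choose 2) + (2 * ((q / suc l) * (suc l choose 2)) + 2 * ((q % suc l) choose 2)) ≡⟨ cong₂ _+_ (2*nC2 (m ∸ 1)) (H-divMod l q) ⟩
  (m ∸ 1) * (m ∸ 1 ∸ 1) + H l q                                                ∎
  where
  open ≡-Reasoning
  q = n ∸ (m ∸ 1)
  lem : ∀ a b c → 2 * (a + b + c) ≡ 2 * a + (2 * b + 2 * c)
  lem = solve-∀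

half-even : ∀ s → (2 * s) / 2 ≡ s
half-even s = trans (cong (_/ 2) (*-comm 2 s)) (m*n/n≡m s 2)

half-odd : ∀ s → suc (2 * s) / 2 ≡ s
half-odd zero = refl
half-odd (suc s) = begin
  suc (2 * suc s) / 2                ≡⟨ m/n≡1+[m∸n]/n {suc (2 * suc s)} {2} (s≤s (≤-trans (s≤s z≤n) (m≤m+n (suc s) _))) ⟩
  suc ((suc (2 * suc s) ∸ 2) / 2)    ≡⟨ cong (λ z → suc ((suc z ∸ 2) / 2)) (lem s) ⟩
  suc (suc (2 * s) / 2)              ≡⟨ cong suc (half-odd s) ⟩
  suc s                              ∎
  where
  open ≡-Reasoning
  lem : ∀ s → 2 * suc s ≡ suc (suc (2 * s))
  lem = solve-∀

-- The parameter s is ⌊m / 2⌋ - 1. The hypothesis s + 1 ≤ n makes the truncated difference exact, so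
-- that with the `+ 1` it equals n - s.
bracket2-value : ∀ n m s → m ≡ 2 * s + 2 ⊎ m ≡ 2 * s + 3 → suc s ≤ n → 2 * bracket2 n m + s * suc s ≡ 2 * s * n
bracket2-value n m s par le with ≤⇒∃+ le
... | x , refl = begin
  2 * (((m / 2) ∸ 1) choose 2 + ((m ∸ 2) / 2) * ((suc s + x ∸ (m / 2)) + 1)) + s * suc s
    ≡⟨ cong₂ (λ a b → 2 * ((a ∸ 1) choose 2 + b * ((suc s + x ∸ a) + 1)) + s * suc s) (halves par) (halves′ par) ⟩
  2 * (s choose 2 + s * ((suc s + x ∸ suc s) + 1)) + s * suc s   ≡⟨ cong (λ z → 2 * (s choose 2 + s * (z + 1)) + s * suc s) (m+n∸m≡n (suc s) x) ⟩
  2 * (s choose 2 + s * (x + 1)) + s * suc s                     ≡⟨ lem₁ (s choose 2) s x ⟩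
  2 * (s choose 2) + s + (2 * (s * (x + 1)) + s * s)             ≡⟨ cong (λ z → z + s + (2 * (s * (x + 1)) + s * s)) (2*nC2 s) ⟩
  s * (s ∸ 1) + s + (2 * (s * (x + 1)) + s * s)             ≡⟨ cong (_+ (2 * (s * (x + 1)) + s * s)) (n*pred s) ⟩
  s * s + (2 * (s * (x + 1)) + s * s)                       ≡⟨ lem₂ s x ⟩
  2 * s * (suc s + x)                                       ∎
  where
  open ≡-Reasoning
  lem₁ : ∀ c s x → 2 * (c + s * (x + 1)) + s * suc s ≡ 2 * c + s + (2 * (s * (x + 1)) + s * s)
  lem₁ = solve-∀
  lem₂ : ∀ s x → s * s + (2 * (s * (x + 1)) + s * s) ≡ 2 * s * (suc s + x)
  lem₂ = solve-∀
  e₂ : ∀ s → 2 * s + 2 ≡ 2 * suc s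
  e₂ = solve-∀
  e₃ : ∀ s → 2 * s + 3 ≡ suc (2 * suc s)
  e₃ = solve-∀
  halves : m ≡ 2 * s + 2 ⊎ m ≡ 2 * s + 3 → m / 2 ≡ suc s
  halves (inj₁ refl) = trans (cong (_/ 2) (e₂ s)) (half-even (suc s))
  halves (inj₂ refl) = trans (cong (_/ 2) (e₃ s)) (half-odd (suc s))
  halves′ : m ≡ 2 * s + 2 ⊎ m ≡ 2 * s + 3 → (m ∸ 2) / 2 ≡ s
  halves′ (inj₁ refl) = trans (cong (_/ 2) (m+n∸n≡m (2 * s) 2)) (half-even s)
  halves′ (inj₂ refl) = trans (cong (λ z → (z ∸ 2) / 2) (trans (+-suc (2 * s) 2) (cong suc (+-comm (2 * s) 2)))) (half-odd s)

<ᵇ-true : ∀ {a b} → a < b → (a <ᵇ b) ≡ true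
<ᵇ-true {a} {b} p with a <ᵇ b | <⇒<ᵇ p
... | true | _ = refl

<ᵇ-false : ∀ {a b} → ¬ a < b → (a <ᵇ b) ≡ false
<ᵇ-false {a} {b} p with a <ᵇ b | <ᵇ⇒< a b
... | true | q = ⊥-elim (p (q tt))
... | false | _ = refl

sum-tabulate : ∀ {n} (f : Fin n → ℕ) {m} (g : Fin m → Fin n) → sum (map f (tabulate g)) ≡ ∑ (f ∘ g)
sum-tabulate f {zero} g = refl
sum-tabulate f {suc m} g = cong (f (g zero) +_) (sum-tabulate f (g ∘ suc))

2*edges : ∀ {n} (G : Graph n) → 2 * edges G ≡ edges₂ G full
2*edges {n} G = begin
  2 * edges G                                                ≡⟨ cong (2 *_) edges≡ ⟩
  2 * ∑ (λ i → ∑ (up i))                                     ≡⟨ lem (∑ λ i → ∑ (up i)) ⟩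
  ∑ (λ i → ∑ (up i)) + ∑ (λ i → ∑ (up i))                    ≡⟨ cong (∑ (λ i → ∑ (up i)) +_) (∑-comm up) ⟩
  ∑ (λ i → ∑ (up i)) + ∑ (λ i → ∑ (λ j → up j i))            ≡⟨ ∑-distrib-+ (λ i → ∑ (up i)) (λ i → ∑ (λ j → up j i)) ⟨
  ∑ (λ i → ∑ (up i) + ∑ (λ j → up j i))                      ≡⟨ sum-cong-≗ (λ i → trans (sym (∑-distrib-+ (up i) _)) (sum-cong-≗ (pt i))) ⟩
  edges₂ G full                                              ∎
  where
  open ≡-Reasoning
  up : Fin n → Fin n → ℕ
  up i j = ⟦ (toℕ i <ᵇ toℕ j) ∧ adj G i j ⟧
  lem : ∀ a → 2 * a ≡ a + a
  lem = solve-∀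
  sum-concatMap : ∀ {m} (h : Fin m → Fin n) → sum (concatMap (λ i → map (up i) (allFin n)) (tabulate h)) ≡ ∑ (λ i → ∑ (up (h i)))
  sum-concatMap {zero} h = refl
  sum-concatMap {suc m} h = trans (sum-++ (map (up (h zero)) (allFin n)) _) (cong₂ _+_ (sum-tabulate (up (h zero)) id) (sum-concatMap (h ∘ suc)))
  edges≡ : edges G ≡ ∑ (λ i → ∑ (up i))
  edges≡ = sum-concatMap id
  pt : ∀ i j → up i j + up j i ≡ ⟦ adj G i j ⟧
  pt i j with <-cmp (toℕ i) (toℕ j)
  ... | tri< lt _ ¬gt rewrite <ᵇ-true lt | <ᵇ-false ¬gt = +-identityʳ _
  ... | tri> ¬lt _ gt rewrite <ᵇ-true gt | <ᵇ-false ¬lt = cong ⟦_⟧ (Graph.sym G j i)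
  ... | tri≈ _ eq _ with toℕ-injective eq
  ...   | refl rewrite irrefl G i = ∧f (toℕ i <ᵇ toℕ i)
    where
    ∧f : ∀ b → ⟦ b ∧ false ⟧ + ⟦ b ∧ false ⟧ ≡ 0
    ∧f true = refl
    ∧f false = refl

psum-0 : ∀ {m} (k : Fin m → ℕ) → psum k 0 ≡ 0
psum-0 {zero} k = refl
psum-0 {suc m} k = refl

psum-suc : ∀ {m} (k : Fin m → ℕ) j → psum k (suc (toℕ j)) ≡ psum k (toℕ j) + k j
psum-suc k zero = trans (cong (k zero +_) (psum-0 (k ∘ suc))) (+-identityʳ _)
psum-suc k (suc j) = trans (cong (k zero +_) (psum-suc (k ∘ suc) j)) (sym (+-assoc (k zero) _ _))

psum-mono : ∀ {m} (k : Fin m → ℕ) {a b} → a ≤ b → psum k a ≤ psum k b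
psum-mono {zero} k le = z≤n
psum-mono {suc m} k {zero} le = z≤n
psum-mono {suc m} k {suc a} {suc b} (s≤s le) = +-monoʳ-≤ (k zero) (psum-mono (k ∘ suc) le)

psum≥3 : ∀ {m} (k : Fin m → ℕ) → 1 ≤ m → (∀ i → 3 ≤ k i) → 3 ≤ psum k m
psum≥3 {suc m} k _ k≥3 = ≤-trans (k≥3 zero) (m≤m+n _ _)

half₂ : ∀ {K} → 3 ≤ K → ∃ λ s → K ≡ 2 * s + 2 ⊎ K ≡ 2 * s + 3
half₂ {suc K} (s≤s 2≤K) with half K (≤-trans (s≤s z≤n) 2≤K)
... | s , inj₁ e = s , inj₁ (trans (cong suc e) (sym (+-suc (2 * s) 1)))
... | s , inj₂ e = s , inj₂ (trans (cong suc e) (sym (+-suc (2 * s) 2)))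

half₂-≤ : ∀ {K} s → K ≡ 2 * s + 2 ⊎ K ≡ 2 * s + 3 → 2 * s + 2 ≤ K
half₂-≤ s (inj₁ refl) = ≤-refl
half₂-≤ s (inj₂ refl) = +-monoʳ-≤ (2 * s) (n≤1+n 2)

≤-half₂ : ∀ {K} s → K ≡ 2 * s + 2 ⊎ K ≡ 2 * s + 3 → K ≤ 2 * s + 3
≤-half₂ s (inj₁ refl) = +-monoʳ-≤ (2 * s) (n≤1+n 2)
≤-half₂ s (inj₂ refl) = ≤-refl

half₂-< : ∀ {K} s → K ≡ 2 * s + 2 ⊎ K ≡ 2 * s + 3 → s < K
half₂-< s e = ≤-trans (≤-trans (s≤s (m≤m+n s _)) (m<m+n (2 * s) {2} z<s)) (half₂-≤ s e)

≤-maximum : ∀ {A : Set} (f : A → ℕ) {x xs} → x ∈ xs → f x ≤ maximum (map f xs)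
≤-maximum f (here refl) = m≤m⊔n _ _
≤-maximum f {xs = y ∷ _} (there p) = ≤-trans (≤-maximum f p) (m≤n⊔m (f y) _)

-- Parity of the orders and the upper bound

even-or-odd : ∀ x → (∃ λ h → x ≡ 2 * h) ⊎ (∃ λ h → x ≡ suc (2 * h))
even-or-odd zero = inj₁ (0 , refl)
even-or-odd (suc x) with even-or-odd x
... | inj₁ (h , e) = inj₂ (h , cong suc e)
... | inj₂ (h , e) = inj₁ (suc h , trans (cong suc e) (lem h))
  where
  lem : ∀ h → suc (suc (2 * h)) ≡ 2 * suc h
  lem = solve-∀

odd%2 : ∀ {x} h → x ≡ suc (2 * h) → x % 2 ≡ 1
odd%2 h refl = trans (cong (λ z → suc z % 2) (*-comm 2 h)) ([m+kn]%n≡m%n 1 h 2)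

split-odd : ∀ {σ i r} → 2 + 2 * i + r ≡ 2 * σ + 3 → 3 ≤ r → ∃ λ j → σ ≡ suc (i + j) × r ≡ 3 + 2 * j
split-odd {σ} {i} {r} eq 3≤r with ≤⇒∃+ 3≤r
... | t , refl with ≤⇒∃+ (half-≤ {suc i} {σ} (≤-from (≤-reflexive eq) (t + 1) (lem i t σ)))
  where
  lem : ∀ i t σ → 2 * suc i + (2 * σ + 3) + (t + 1) ≡ 2 * σ + 1 + (2 + 2 * i + (3 + t))
  lem = solve-∀
...   | j , refl = j , refl , cong (3 +_) (+-cancelˡ-≡ (2 * i + 5) t (2 * j) (trans (lem₁ i t) (trans eq (lem₂ i j))))
  where
  lem₁ : ∀ i t → 2 * i + 5 + t ≡ 2 + 2 * i + (3 + t)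
  lem₁ = solve-∀
  lem₂ : ∀ i j → 2 * (suc i + j) + 3 ≡ 2 * i + 5 + 2 * j
  lem₂ = solve-∀

even⇒2+2* : ∀ {x h} → x ≡ 2 * h → 3 ≤ x → ∃ λ i → x ≡ 2 + 2 * i
even⇒2+2* {h = zero} refl ()
even⇒2+2* {h = suc h} refl _ = h , lem h
  where
  lem : ∀ h → 2 * suc h ≡ 2 + 2 * h
  lem = solve-∀

module _ {n : ℕ} (G : Graph n) where

  -- One of the first two orders is even and receives a path of its own. All the others are laid
  -- consecutively along the odd path.
  embed-pairs : ∀ {m} (k : Fin (suc (suc m)) → ℕ) → (∀ i → 3 ≤ k i) → (∀ i j → k i % 2 ≡ 1 → k j % 2 ≡ 1 → i ≡ j) →
    ∀ {σ} → psum k (suc (suc m)) ≡ 2 * σ + 3 → LongPairs G σ → ¬ ¬ Contains G (LinearForest (suc (suc m)) k)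
  embed-pairs {m} k k≥3 odd {σ} total pairs kont with even-or-odd (k zero)
  ... | inj₁ (h , e) with even⇒2+2* {h = h} e (k≥3 zero)
  ...   | i , k₀≡ with split-odd {σ} {i} (trans (cong (_+ psum (k ∘ suc) (suc m)) (sym k₀≡)) total) (≤-trans (k≥3 (suc zero)) (m≤m+n _ _))
  ...     | j , σ≡ , r≡ = pairs i j σ≡ λ (l₁ , l₂ , k₁ , k₂ , (un , _) , e₁ , e₂) → kont (embed⇒contains G {l = l₁ ++ l₂}
            (embed-∷ G l₁ (trans e₁ (sym k₀≡)) k₁ (unique-++⁻ˡ l₁ un) ∈-++⁺ˡ (∈-++⁺ʳ l₁) (unique-disjoint l₁ un)
              (embed-path G (k ∘ suc) l₂ k₂ (unique-++⁻ʳ l₁ un) (≤-reflexive (trans r≡ (sym e₂))))))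
  embed-pairs {m} k k≥3 odd {σ} total pairs kont | inj₂ (h , e) with even-or-odd (k (suc zero))
  ... | inj₂ (h′ , e′) = case odd zero (suc zero) (odd%2 h e) (odd%2 h′ e′) of λ ()
  ... | inj₁ (h′ , e′) with even⇒2+2* {h = h′} e′ (k≥3 (suc zero))
  ...   | i , k₁≡ with split-odd {σ} {i} {k zero + rest} (trans (cong (_+ (k zero + rest)) (sym k₁≡)) (trans (lem (k zero) (k (suc zero)) rest) total)) (≤-trans (k≥3 zero) (m≤m+n _ _))
    where
    rest = psum (λ i → k (suc (suc i))) m
    lem : ∀ a b c → b + (a + c) ≡ a + (b + c)
    lem = solve-∀
  ...     | j , σ≡ , r≡ = pairs i j σ≡ λ (l₁ , l₂ , lk₁ , lk₂ , (un , _) , e₁ , e₂) → kont (build l₁ l₂ lk₁ lk₂ un e₁ e₂)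
    where
    rest = psum (λ i → k (suc (suc i))) m
    build : ∀ l₁ l₂ → Linked (Adj G) l₁ → Linked (Adj G) l₂ → Unique (l₁ ++ l₂) → length l₁ ≡ 2 + 2 * i → length l₂ ≡ 3 + 2 * j → Contains G (LinearForest (suc (suc m)) k)
    build l₁ l₂ lk₁ lk₂ un e₁ e₂ = embed⇒contains G {l = l₁ ++ l₂}
        (embed-∷ G t lt (proj₁ kk) (unique-++⁻ˡ t un′) (λ p → ∈-resp-↭ (↭-sym perm) (∈-++⁺ˡ p)) (λ p → ∈-resp-↭ (↭-sym perm) (∈-++⁺ʳ t p)) (unique-disjoint t un′)
          (embed-∷ G l₁ (trans e₁ (sym k₁≡)) lk₁ (unique-++⁻ˡ l₁ (unique-++⁻ʳ t un′)) ∈-++⁺ˡ (∈-++⁺ʳ l₁) (unique-disjoint l₁ (unique-++⁻ʳ t un′))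
            (embed-path G (λ i → k (suc (suc i))) d (proj₂ kk) (unique-++⁻ʳ l₁ (unique-++⁻ʳ t un′)) (≤-reflexive (sym ld)))))
      where
      k₀ = k zero
      t = take k₀ l₂
      d = drop k₀ l₂
      td : t ++ d ≡ l₂
      td = take++drop≡id k₀ l₂
      len : length l₂ ≡ k₀ + rest
      len = trans e₂ (sym r≡)
      lt : length t ≡ k₀
      lt = trans (length-take k₀ l₂) (m≤n⇒m⊓n≡m (subst (k₀ ≤_) (sym len) (m≤m+n k₀ rest)))
      ld : length d ≡ rest
      ld = trans (length-drop k₀ l₂) (trans (cong (_∸ k₀) len) (m+n∸m≡n k₀ rest))
      kk = linked-++⁻ t (subst (Linked (Adj G)) (sym td) lk₂)
      perm : l₁ ++ l₂ ↭ t ++ l₁ ++ d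
      perm = ↭-trans (↭-reflexive (trans (cong (l₁ ++_) (sym td)) (sym (++-assoc l₁ t d)))) (↭-trans (++⁺ʳ d (++-comm-↭ l₁ t)) (↭-reflexive (++-assoc t l₁ d)))
      un′ : Unique (t ++ l₁ ++ d)
      un′ = unique-↭ perm un

upper-bound : ∀ {m n} (k : Fin m → ℕ) → 1 ≤ m → (∀ i j → toℕ i ≤ toℕ j → k j ≤ k i) → (∀ i → 3 ≤ k i) →
  (∀ i j → k i % 2 ≡ 1 → k j % 2 ≡ 1 → i ≡ j) → psum k m ≤ n → (G : Graph n) → ¬ Contains G (LinearForest m k) →
  edges G ≤ exValue n m k
upper-bound {m} {n} k 1≤m dec k≥3 odd K≤n G F-free = ≮⇒≥ contra
  where
  E = edges₂ G full
  contra : ¬ (exValue n m k < edges G)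
  contra over = decompose G n full (≤-reflexive (card-full n)) λ bs v≡ e≡ S≡0 (un , _) →
      go (first-fit G k bs dec un (λ i → All.map inj₁ S≡0)) v≡ e≡ S≡0
    where
    clq-over : ∀ j → E ≤ 2 * bracket3 n (psum k (suc (toℕ j))) (k j) → ⊥
    clq-over j le = <⇒≱ over (≤-trans (*-cancelˡ-≤ 2 (≤-trans (≤-reflexive (2*edges G)) le))
      (≤-trans (≤-maximum (λ j → bracket3 n (psum k (suc (toℕ j))) (k j)) (∈-allFin j)) (m≤m⊔n _ _)))
    K = psum k m
    halfK = half₂ (psum≥3 k 1≤m k≥3)
    s = proj₁ halfK
    K≤ : K ≤ 2 * s + 3
    K≤ = ≤-half₂ s (proj₂ halfK)
    s<n : suc s ≤ n
    s<n = ≤-trans (half₂-< s (proj₂ halfK)) K≤n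
    -- Raised to s = ⌊K / 2⌋ - 1, the bound becomes the second bracket.
    bs-over : ∀ {σ} → σ ≤ s → E + σ * suc σ ≤ 2 * σ * n → ⊥
    bs-over {σ} σ≤s b = <⇒≱ over (≤-trans (*-cancelˡ-≤ {edges G} {bracket2 n K} 2 (+-cancelʳ-≤ (s * suc s) _ _ (begin
        2 * edges G + s * suc s              ≡⟨ cong (_+ s * suc s) (2*edges G) ⟩
        E + s * suc s                        ≤⟨ bs-raise σ≤s (<⇒≤ s<n) b ⟩
        2 * s * n                            ≡⟨ bracket2-value n K s (proj₂ halfK) s<n ⟨
        2 * bracket2 n K + s * suc s         ∎))) (m≤n⊔m (maximum (map (λ j → bracket3 n (psum k (suc (toℕ j))) (k j)) (allFin m))) (bracket2 n K)))
      where open ≤-Reasoning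
    finish : ∀ j T l → k j ≡ suc (suc l) → T ≡ psum k (toℕ j) → Merge.Agg l (LongPairs G) T n E → ⊥
    finish j T l kj T≡ agg with ≤⇒∃+ Tw≤n
      where
      Tw≤n : T + suc l ≤ n
      Tw≤n = ≤-trans (n≤1+n _) (≤-trans (≤-reflexive (trans (sym (+-suc T (suc l))) (trans (cong₂ _+_ T≡ (sym kj)) (sym (psum-suc k j))))) (≤-trans (psum-mono k (toℕ<n j)) K≤n))
    ... | x , n≡ = bound (Merge.agg-bound l (LongPairs G) (subst (λ z → Merge.Agg l (LongPairs G) T z E) n≡ agg))
      where
      M = psum k (suc (toℕ j))
      M≡ : M ≡ suc (T + suc l)
      M≡ = trans (psum-suc k j) (trans (cong₂ _+_ (sym T≡) kj) (+-suc T (suc l)))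
      M≤K : M ≤ K
      M≤K = psum-mono k (toℕ<n j)
      open Merge l (LongPairs G)
      bound : E ≤ (T + suc l) * (T + suc l ∸ 1) + H l x ⊎ (suc l < T × (Bs T (T + suc l + x) E ⊎ Sp T (T + suc l + x) E)) → ⊥
      bound (inj₁ q) = clq-over j (≤-trans q (≤-reflexive (sym (begin
          2 * bracket3 n M (k j)                                    ≡⟨ cong₂ (λ a b → 2 * bracket3 n a b) M≡ kj ⟩
          2 * bracket3 n (suc (T + suc l)) (suc (suc l))            ≡⟨ bracket3-value n (suc (T + suc l)) l (≤-trans (≤-reflexive (sym M≡)) (≤-trans M≤K K≤n)) ⟩
          (T + suc l) * (T + suc l ∸ 1) + H l (n ∸ (T + suc l))     ≡⟨ cong (λ z → (T + suc l) * (T + suc l ∸ 1) + H l z) (trans (cong (_∸ (T + suc l)) n≡) (m+n∸m≡n (T + suc l) x)) ⟩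
          (T + suc l) * (T + suc l ∸ 1) + H l x                     ∎))))
        where open ≡-Reasoning
      bound (inj₂ (_ , inj₁ (σ , (lo , hi) , b))) = bs-over {σ} (half-≤ {σ} {s} (≤-from (+-mono-≤ (+-mono-≤ lo (≤-reflexive (sym M≡))) (≤-trans M≤K K≤)) 0 (lem σ (T + suc l) M s)))
          (subst (λ z → E + σ * suc σ ≤ 2 * σ * z) (sym n≡) b)
        where
        lem : ∀ σ t M s → 2 * σ + ((t + M) + (2 * s + 3)) + 0 ≡ 2 * s + 1 + ((suc (2 * σ) + suc t) + M)
        lem = solve-∀
      bound (inj₂ (w<T , inj₂ (σ , eq , b , pairs))) with m ≟ℕ suc (toℕ j)
      -- When the last path is the one that fails to fit, T + w + 1 is the sum of all orders, so
      -- this sum is 2σ + 3 and the pairs of paths accommodate the forest.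
      ... | yes last = lastItem m k k≥3 odd (trans (cong (psum k) last) (trans M≡ (trans (cong suc eq) (sym (+-suc (2 * σ) 2))))) F-free 2≤m
        where
        -- A positive T excludes j = 0.
        2≤m : 2 ≤ m
        2≤m = subst (2 ≤_) (sym last) (s≤s (n≢0⇒n>0 λ j≡0 → n≮0 (subst (suc l <_) (trans T≡ (trans (cong (psum k) j≡0) (psum-0 k))) w<T)))
        lastItem : ∀ m (k : Fin m → ℕ) → (∀ i → 3 ≤ k i) → (∀ i j → k i % 2 ≡ 1 → k j % 2 ≡ 1 → i ≡ j) → psum k m ≡ 2 * σ + 3 →
          ¬ Contains G (LinearForest m k) → 2 ≤ m → ⊥
        lastItem (suc zero) _ _ _ _ _ (s≤s ())
        lastItem (suc (suc m)) k k≥3 odd total F-free _ = embed-pairs G k k≥3 odd total pairs F-free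
      -- A further path on at least 3 vertices is still to come, hence n ≥ K ≥ 2σ + 6. This permits
      -- σ + 1, and n ≥ σ + 2 is enough for the gain to cover the additional 2.
      ... | no ¬last = bs-over {suc σ} (half-≤ {suc σ} {s} (≤-from (+-mono-≤ bigger K≤) 2 (lem₁ σ K s)))
            (≤-from (+-mono-≤ (subst (λ z → E + σ * suc σ ≤ 2 * σ * z + 2) (sym n≡) b) (≤-trans bigger K≤n)) n′ lem₃)
        where
        lem₁ : ∀ σ K s → 2 * suc σ + (K + (2 * s + 3)) + 2 ≡ 2 * s + 1 + (2 * σ + 6 + K)
        lem₁ = solve-∀
        j′<m : suc (suc (toℕ j)) ≤ m
        j′<m = ≤∧≢⇒< (toℕ<n j) (λ e → ¬last (sym e))
        bigger : 2 * σ + 6 ≤ K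
        bigger = ≤-trans (≤-reflexive (trans (lem₂ σ) (cong (_+ 3) (sym (trans M≡ (cong suc eq)))))) (≤-trans (next k (suc (toℕ j)) j′<m k≥3) (psum-mono k j′<m))
          where
          lem₂ : ∀ σ → 2 * σ + 6 ≡ suc (2 * σ + 2) + 3
          lem₂ = solve-∀
          next : ∀ {m} (k : Fin m → ℕ) a → a < m → (∀ i → 3 ≤ k i) → psum k a + 3 ≤ psum k (suc a)
          next {suc m} k zero _ k≥3 = ≤-trans (k≥3 zero) (m≤m+n _ _)
          next {suc m} k (suc a) (s≤s lt) k≥3 = ≤-trans (≤-reflexive (+-assoc (k zero) _ 3)) (+-monoʳ-≤ (k zero) (next (k ∘ suc) a lt (λ i → k≥3 (suc i))))
        n′ = n + 2
        lem₃ : E + suc σ * suc (suc σ) + (2 * σ * n + 2 + n) + n′ ≡ 2 * suc σ * n + (E + σ * suc σ + (2 * σ + 6))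
        lem₃ = lem E σ n
          where
          lem : ∀ E s n → E + suc s * suc (suc s) + (2 * s * n + 2 + n) + (n + 2) ≡ 2 * suc s * n + (E + s * suc s + (2 * s + 6))
          lem = solve-∀
    go : ∀ {bs} → Embed G k (rems G bs) ⊎ Fail G k bs → total G (vertices G) bs ≡ card (full {n}) → total G (edgesIn G) bs ≡ E → All (λ b → Bin.S b ≡ 0) bs → ⊥
    go (inj₁ emb) _ _ _ = F-free (embed⇒contains G emb)
    go {bs} (inj₂ (j , bs′ , small , inv , eS , ev , ee)) v≡ e≡ S≡0 with ≤⇒∃+ (≤-trans (s≤s (s≤s z≤n)) (k≥3 j))
    ... | l , kj = bins-agg G l bs′ (All.map (λ lt → ≤-pred (≤-trans lt (≤-reflexive kj))) small)
          (All.map (λ { (inj₁ z) → inj₁ z ; (inj₂ p) → inj₂ (≤-trans (≤-reflexive (sym kj)) p) }) inv) λ agg →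
          finish j (total G Bin.S bs′) l kj (trans eS (cong (_+ psum k (toℕ j)) (zeros bs S≡0)))
            (subst₂ (Merge.Agg l (LongPairs G) (total G Bin.S bs′)) (trans ev (trans v≡ (card-full n))) (trans ee e≡) agg)
      where
      zeros : ∀ bs → All (λ b → Bin.S b ≡ 0) bs → total G Bin.S bs ≡ 0
      zeros [] [] = refl
      zeros (b ∷ bs) (z ∷ zs) = cong₂ _+_ z (zeros bs zs)

-- Extremal graphs

symGraph : ∀ {n} (R : Fin n → Fin n → Bool) → (∀ i j → R i j ≡ R j i) → Graph n
symGraph R R-sym = record
  { adj    = λ i j → not (does (i ≟ j)) ∧ R i j
  ; sym    = λ i j → cong₂ (λ a b → not a ∧ b) (does-sym i j) (R-sym i j)
  ; irrefl = λ i → cong (λ a → not a ∧ R i i) (∈｛｝ i)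
  }
  where
  does-sym : ∀ i j → does (i ≟ j) ≡ does (j ≟ i)
  does-sym i j with i ≟ j | j ≟ i
  ... | yes _ | yes _ = refl
  ... | no _ | no _ = refl
  ... | yes p | no q = ⊥-elim (q (sym p))
  ... | no p | yes q = ⊥-elim (p (sym q))

symGraph-adj : ∀ {n} (R : Fin n → Fin n → Bool) s i j → ¬ i ≡ j → R i j ≡ true → Adj (symGraph R s) i j
symGraph-adj R s i j i≢j r = true-∧ (not-true (∉｛｝ i≢j)) r

seg : ∀ {n} → ℕ → Sub n
seg x v = toℕ v <ᵇ x

∈seg : ∀ {n x} (v : Fin n) → toℕ v < x → v ∈ₛ seg x
∈seg v = <ᵇ-true

seg⇒< : ∀ {n} x (v : Fin n) → v ∈ₛ seg x → toℕ v < x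
seg⇒< x v p = ≰⇒> λ le → true≢false p (<ᵇ-false (≤⇒≯ le))

card-interval≤ : ∀ {n} (A : Sub n) lo len → (∀ v → v ∈ₛ A → lo ≤ toℕ v × toℕ v < lo + len) → card A ≤ len
card-interval≤ {zero} A lo len h = z≤n
card-interval≤ {suc n} A lo len h with A zero in eq
card-interval≤ {suc n} A (suc lo) len h | true = case proj₁ (h zero eq) of λ ()
card-interval≤ {suc n} A zero zero h | true = case proj₂ (h zero eq) of λ ()
card-interval≤ {suc n} A zero (suc len) h | true = s≤s (card-interval≤ (A ∘ suc) zero len λ v p → z≤n , ≤-pred (proj₂ (h (suc v) p)))
card-interval≤ {suc n} A zero len h | false = ≤-trans (card-interval≤ (A ∘ suc) zero (len ∸ 1) λ v p → z≤n , ∸-monoˡ-≤ 1 (proj₂ (h (suc v) p))) (m∸n≤m len 1)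
card-interval≤ {suc n} A (suc lo) len h | false = card-interval≤ (A ∘ suc) lo len λ v p → let (a , b) = h (suc v) p in ≤-pred a , ≤-pred b

card-interval≥ : ∀ {n} (A : Sub n) lo len → lo + len ≤ n → (∀ v → lo ≤ toℕ v → toℕ v < lo + len → v ∈ₛ A) → len ≤ card A
card-interval≥ A lo zero le h = z≤n
card-interval≥ {suc n} A zero (suc len) (s≤s le) h rewrite h zero z≤n z<s = s≤s (card-interval≥ (A ∘ suc) zero len le λ v _ lt → h (suc v) z≤n (s≤s lt))
card-interval≥ {suc n} A (suc lo) (suc len) (s≤s le) h = ≤-trans (card-interval≥ (A ∘ suc) lo (suc len) le λ v a b → h (suc v) (s≤s a) (s≤s b)) (m≤n+m _ ⟦ A zero ⟧)

sumTo : (ℕ → ℕ) → ℕ → ℕ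
sumTo d zero = 0
sumTo d (suc x) = sumTo d x + d x

-- Each edge is counted at its later end, where `d` bounds the number of earlier neighbours from
-- below.
sumTo≤edges₂ : ∀ {n} (G : Graph n) (d : ℕ → ℕ) → (∀ v → d (toℕ v) ≤ deg G (seg (toℕ v)) v) → ∀ x → x ≤ n → 2 * sumTo d x ≤ edges₂ G (seg x)
sumTo≤edges₂ G d h zero le = z≤n
sumTo≤edges₂ {n} G d h (suc x) le = begin
  2 * (sumTo d x + d x)                                      ≡⟨ *-distribˡ-+ 2 (sumTo d x) (d x) ⟩
  2 * sumTo d x + 2 * d x                                    ≤⟨ +-mono-≤ (sumTo≤edges₂ G d h x (<⇒≤ le)) (*-monoʳ-≤ 2 dx) ⟩
  edges₂ G (seg x) + 2 * deg G (seg (suc x)) v               ≤⟨ +-monoˡ-≤ _ (edges₂-mono G {seg x} {seg (suc x) ─ v} seg⊆) ⟩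
  edges₂ G (seg (suc x) ─ v) + 2 * deg G (seg (suc x)) v     ≡⟨ edges₂-remove G (seg (suc x)) (∈seg v (s≤s (≤-reflexive v≡))) ⟨
  edges₂ G (seg (suc x))                                     ∎
  where
  open ≤-Reasoning
  v : Fin n
  v = fromℕ< le
  v≡ : toℕ v ≡ x
  v≡ = toℕ-fromℕ< le
  seg⊆ : seg x ⊆ₛ (seg (suc x) ─ v)
  seg⊆ u p = ∈-─ {A = seg (suc x)} {v} {u} (∈seg u (m≤n⇒m≤1+n (seg⇒< x u p))) λ { refl → <-irrefl v≡ (seg⇒< x u p) }
  dx : d x ≤ deg G (seg (suc x)) v
  dx = ≤-trans (subst (λ z → d z ≤ deg G (seg z) v) v≡ (h v)) (deg-mono G {seg x} {seg (suc x)} v λ u p → ∈seg u (m≤n⇒m≤1+n (seg⇒< x u p)))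

deg-interval : ∀ {n} (G : Graph n) v lo len → lo + len ≤ toℕ v → (∀ u → lo ≤ toℕ u → toℕ u < lo + len → Adj G v u) → len ≤ deg G (seg (toℕ v)) v
deg-interval G v lo len le h = card-interval≥ (seg (toℕ v) ∩ adj G v) lo len (≤-trans le (<⇒≤ (toℕ<n v)))
  λ u a b → true-∧ (∈seg u (≤-trans b le)) (h u a b)

2*sumTo-id : ∀ d x → (∀ y → y < x → d y ≡ y) → 2 * sumTo d x ≡ x * (x ∸ 1)
2*sumTo-id d zero h = refl
2*sumTo-id d (suc x) h = begin
  2 * (sumTo d x + d x)        ≡⟨ *-distribˡ-+ 2 (sumTo d x) (d x) ⟩
  2 * sumTo d x + 2 * d x      ≡⟨ cong₂ (λ a b → a + 2 * b) (2*sumTo-id d x (λ y lt → h y (m≤n⇒m≤1+n lt))) (h x ≤-refl) ⟩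
  x * (x ∸ 1) + 2 * x          ≡⟨ lem (x * (x ∸ 1)) x ⟩
  x * (x ∸ 1) + x + x          ≡⟨ cong (_+ x) (n*pred x) ⟩
  x * x + x                    ≡⟨ +-comm (x * x) x ⟩
  suc x * x                    ∎
  where
  open ≡-Reasoning
  lem : ∀ a x → a + 2 * x ≡ a + x + x
  lem = solve-∀

module _ {n : ℕ} where

  imgs : ∀ {m} (k : Fin m → ℕ) → ((i : Fin m) → Fin (k i) → Fin n) → ℕ → List (Fin n)
  imgs {zero} k g _ = []
  imgs {suc m} k g zero = []
  imgs {suc m} k g (suc j) = tabulate (g zero) ++ imgs (k ∘ suc) (λ i → g (suc i)) j

  imgs-length : ∀ {m} (k : Fin m → ℕ) g j → length (imgs k g j) ≡ psum k j
  imgs-length {zero} k g j = refl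
  imgs-length {suc m} k g zero = refl
  imgs-length {suc m} k g (suc j) = trans (length-++ (tabulate (g zero))) (cong₂ _+_ (length-tabulate (g zero)) (imgs-length (k ∘ suc) (λ i → g (suc i)) j))

  imgs-All : ∀ {P : Fin n → Set} {m} (k : Fin m → ℕ) g j → (∀ i p → toℕ i < j → P (g i p)) → All P (imgs k g j)
  imgs-All {m = zero} k g j h = []
  imgs-All {m = suc m} k g zero h = []
  imgs-All {m = suc m} k g (suc j) h = All.++⁺ (All.tabulate⁺ (λ p → h zero p z<s)) (imgs-All (k ∘ suc) (λ i → g (suc i)) j λ i p lt → h (suc i) p (s≤s lt))

  JointlyInjective : ∀ {m} (k : Fin m → ℕ) → ((i : Fin m) → Fin (k i) → Fin n) → Set
  JointlyInjective {m} k g = ∀ {i j} p q → g i p ≡ g j q → _≡_ {A = Σ (Fin m) (λ i → Fin (k i))} (i , p) (j , q)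

  tail-injective : ∀ {m} {k : Fin (suc m) → ℕ} {g} → JointlyInjective k g → JointlyInjective (k ∘ suc) (λ i → g (suc i))
  tail-injective inj p q e with inj p q e
  ... | refl = refl

  imgs-unique : ∀ {m} (k : Fin m → ℕ) g j → JointlyInjective k g → Unique (imgs k g j)
  imgs-unique {zero} k g j inj = []
  imgs-unique {suc m} k g zero inj = []
  imgs-unique {suc m} k g (suc j) inj = Unique.++⁺ (Unique.tabulate⁺ λ {p} {q} e → same (inj p q e)) (imgs-unique (k ∘ suc) (λ i → g (suc i)) j (tail-injective {g = g} inj))
      λ {v} (a , b) → let (p , e) = ∈-tabulate⁻ a in All.lookup (imgs-All {P = λ v → ∀ p → ¬ v ≡ g zero p} (k ∘ suc) (λ i → g (suc i)) j λ i q _ p e → case inj q p e of λ ()) b p e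
    where
    same : ∀ {p q} → _≡_ {A = Σ (Fin (suc m)) (λ i → Fin (k i))} (zero , p) (zero , q) → p ≡ q
    same refl = refl

tabulate-linked : ∀ {A : Set} {R : A → A → Set} {k} (g : Fin k → A) → (∀ p q → toℕ q ≡ suc (toℕ p) → R (g p) (g q)) → Linked R (tabulate g)
tabulate-linked {k = zero} g h = []
tabulate-linked {k = suc zero} g h = [-]
tabulate-linked {k = suc (suc k)} g h = h zero (suc zero) refl ∷ tabulate-linked (g ∘ suc) λ p q e → h (suc p) (suc q) (cong suc e)

path-constant : ∀ {A : Set} {k} (g : Fin (suc k) → A) → (∀ p q → toℕ q ≡ suc (toℕ p) → g p ≡ g q) → ∀ p → g p ≡ g zero
path-constant g h zero = refl
path-constant {k = suc k} g h (suc p) = trans (path-constant (g ∘ suc) (λ p q e → h (suc p) (suc q) (cong suc e)) p) (sym (h zero (suc zero) refl))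

-- K_Q together with disjoint copies of K_w on the remaining vertices, w = l + 1.
module Cliques (Q l : ℕ) where

  blk : ℕ → ℕ
  blk x = if x <ᵇ Q then 0 else suc ((x ∸ Q) / suc l)

  blk-small : ∀ {x} → x < Q → blk x ≡ 0
  blk-small lt rewrite <ᵇ-true lt = refl

  blk-large : ∀ y → blk (Q + y) ≡ suc (y / suc l)
  blk-large y rewrite <ᵇ-false (≤⇒≯ (m≤m+n Q y)) = cong (λ z → suc (z / suc l)) (m+n∸m≡n Q y)

  -- The number of earlier vertices in the same block, hence a degree into the preceding segment.
  back : ℕ → ℕ
  back x = if x <ᵇ Q then x else (x ∸ Q) % suc l

  back-small : ∀ {x} → x < Q → back x ≡ x
  back-small lt rewrite <ᵇ-true lt = refl

  back-large : ∀ y → back (Q + y) ≡ y % suc l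
  back-large y rewrite <ᵇ-false (≤⇒≯ (m≤m+n Q y)) = cong (_% suc l) (m+n∸m≡n Q y)

  2*sumTo-back : ∀ y → 2 * sumTo back (Q + y) ≡ Q * (Q ∸ 1) + H l y
  2*sumTo-back zero = trans (cong (λ z → 2 * sumTo back z) (+-identityʳ Q)) (trans (2*sumTo-id back Q (λ _ → back-small)) (sym (+-identityʳ _)))
  2*sumTo-back (suc y) = begin
    2 * sumTo back (Q + suc y)                        ≡⟨ cong (λ z → 2 * sumTo back z) (+-suc Q y) ⟩
    2 * (sumTo back (Q + y) + back (Q + y))           ≡⟨ *-distribˡ-+ 2 (sumTo back (Q + y)) _ ⟩
    2 * sumTo back (Q + y) + 2 * back (Q + y)         ≡⟨ cong₂ (λ a b → a + 2 * b) (2*sumTo-back y) (back-large y) ⟩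
    Q * (Q ∸ 1) + H l y + 2 * (y % suc l)             ≡⟨ +-assoc (Q * (Q ∸ 1)) _ _ ⟩
    Q * (Q ∸ 1) + H l (suc y)                         ∎
    where open ≡-Reasoning

  div-block : ∀ {z} t → z < suc l → (z + t * suc l) / suc l ≡ t
  div-block {z} t lt = trans (+-distrib-/-∣ʳ z {t * suc l} {suc l} (divides-refl t)) (cong₂ _+_ (m<n⇒m/n≡0 lt) (m*n/n≡m t (suc l)))

  module _ (n : ℕ) where

    same : Fin n → Fin n → Bool
    same i j = does (blk (toℕ i) ≟ℕ blk (toℕ j))

    same-intro : ∀ {i j} → blk (toℕ i) ≡ blk (toℕ j) → same i j ≡ true
    same-intro {i} {j} = dec-true (blk (toℕ i) ≟ℕ blk (toℕ j))

    same-elim : ∀ {i j} → same i j ≡ true → blk (toℕ i) ≡ blk (toℕ j)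
    same-elim {i} {j} = does⇒ (blk (toℕ i) ≟ℕ blk (toℕ j))

    same-sym : ∀ i j → same i j ≡ same j i
    same-sym i j with bool-cases (same i j) | bool-cases (same j i)
    ... | inj₁ p | _ = trans p (sym (same-intro {j} {i} (sym (same-elim {i} {j} p))))
    ... | inj₂ p | inj₂ q = trans p (sym q)
    ... | inj₂ p | inj₁ q = ⊥-elim (true≢false (same-intro {i} {j} (sym (same-elim {j} {i} q))) p)

    graph : Graph n
    graph = symGraph same same-sym

    back≤deg : ∀ v → back (toℕ v) ≤ deg graph (seg (toℕ v)) v
    back≤deg v with toℕ v <? Q
    ... | yes lt = subst (_≤ deg graph (seg (toℕ v)) v) (sym (back-small lt)) (deg-interval graph v 0 (toℕ v) ≤-refl λ u _ u<v →
            symGraph-adj same same-sym v u (λ { refl → <-irrefl refl u<v }) (same-intro {v} {u} (trans (blk-small lt) (sym (blk-small (<-trans u<v lt))))))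
    ... | no ¬lt with ≤⇒∃+ (≮⇒≥ ¬lt)
    ...   | y , v≡ = subst (_≤ deg graph (seg (toℕ v)) v) (sym (trans (cong back v≡) (back-large y)))
            (deg-interval graph v (Q + t * suc l) r (≤-reflexive v≡′) λ u lo hi →
              symGraph-adj same same-sym v u (λ { refl → <-irrefl refl (<-≤-trans hi (≤-reflexive v≡′)) }) (same-intro {v} {u} (trans (trans (cong blk v≡) (blk-large y)) (sym (blk-u u lo hi)))))
      where
      r = y % suc l
      t = y / suc l
      v≡′ : Q + t * suc l + r ≡ toℕ v
      v≡′ = trans (+-assoc Q _ r) (trans (cong (Q +_) (trans (+-comm (t * suc l) r) (sym (m≡m%n+[m/n]*n y (suc l))))) (sym v≡))
      blk-u : ∀ u → Q + t * suc l ≤ toℕ u → toℕ u < Q + t * suc l + r → blk (toℕ u) ≡ suc t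
      blk-u u lo hi with ≤⇒∃+ lo
      ... | z , u≡ = begin
          blk (toℕ u)                   ≡⟨ cong blk (trans u≡ (trans (+-assoc Q _ z) (cong (Q +_) (+-comm (t * suc l) z)))) ⟩
          blk (Q + (z + t * suc l))     ≡⟨ blk-large (z + t * suc l) ⟩
          suc ((z + t * suc l) / suc l) ≡⟨ cong suc (div-block t (<-trans (+-cancelˡ-< (Q + t * suc l) z r (subst (_< Q + t * suc l + r) u≡ hi)) (m%n<n y (suc l)))) ⟩
          suc t                         ∎
        where open ≡-Reasoning

    edges-graph : Q ≤ n → Q * (Q ∸ 1) + H l (n ∸ Q) ≤ 2 * edges graph
    edges-graph Q≤n = begin
      Q * (Q ∸ 1) + H l (n ∸ Q)          ≡⟨ 2*sumTo-back (n ∸ Q) ⟨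
      2 * sumTo back (Q + (n ∸ Q))       ≡⟨ cong (λ z → 2 * sumTo back z) (m+[n∸m]≡n Q≤n) ⟩
      2 * sumTo back n                   ≤⟨ sumTo≤edges₂ graph back back≤deg n ≤-refl ⟩
      edges₂ graph (seg n)               ≤⟨ edges₂-mono graph {seg n} {full} (λ _ _ → refl) ⟩
      edges₂ graph full                  ≡⟨ 2*edges graph ⟨
      2 * edges graph                    ∎
      where open ≤-Reasoning

    block : ℕ → Sub n
    block b v = does (blk (toℕ v) ≟ℕ suc b)

    card-block : ∀ b → card (block b) ≤ suc l
    card-block b = card-interval≤ (block b) (Q + b * suc l) (suc l) bounds
      where
      bounds : ∀ v → v ∈ₛ block b → Q + b * suc l ≤ toℕ v × toℕ v < Q + b * suc l + suc l
      bounds v p with does⇒ (blk (toℕ v) ≟ℕ suc b) p | toℕ v <? Q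
      ... | e | yes lt = case trans (sym (blk-small lt)) e of λ ()
      ... | e | no ¬lt with ≤⇒∃+ (≮⇒≥ ¬lt)
      ...   | y , v≡ = subst (λ z → Q + b * suc l ≤ z × z < Q + b * suc l + suc l) (sym (trans v≡ (trans (cong (Q +_) y≡) (trans (cong (Q +_) (+-comm (y % suc l) _)) (sym (+-assoc Q _ _))))))
                (m≤m+n _ _ , +-monoʳ-< (Q + b * suc l) (m%n<n y (suc l)))
        where
        y≡ : y ≡ y % suc l + b * suc l
        y≡ = trans (m≡m%n+[m/n]*n y (suc l)) (cong (λ z → y % suc l + z * suc l) (suc-injective (trans (sym (blk-large y)) (trans (cong blk (sym v≡)) e))))

    -- A path stays within one block, and the paths up to index j have more than w vertices. So all
    -- of them must lie in K_Q, which is too small for their total order.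
    graph-free : ∀ {m} (k : Fin m → ℕ) (j : Fin m) → (∀ i j → toℕ i ≤ toℕ j → k j ≤ k i) → k j ≡ suc (suc l) →
      Q < psum k (suc (toℕ j)) → ¬ Contains graph (LinearForest m k)
    graph-free {m} k j dec kj Q< (f , inj , ad) = <⇒≱ Q< (begin
        psum k (suc (toℕ j))                ≡⟨ imgs-length k g (suc (toℕ j)) ⟨
        length (imgs k g (suc (toℕ j)))     ≤⟨ unique-length≤card (seg Q) _ (imgs-unique k g (suc (toℕ j)) (λ p q e → inj e))
                                                 (imgs-All k g (suc (toℕ j)) λ i p lt → ∈seg (g i p) (inQ i (≤-pred lt) p)) ⟩
        card (seg {n} Q)                    ≤⟨ card-interval≤ (seg {n} Q) 0 Q (λ v p → z≤n , seg⇒< Q v p) ⟩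
        Q                                   ∎)
      where
      open ≤-Reasoning
      g : (i : Fin m) → Fin (k i) → Fin n
      g i p = f (i , p)
      step : ∀ i p q → toℕ q ≡ suc (toℕ p) → blk (toℕ (g i p)) ≡ blk (toℕ (g i q))
      step i p q e = same-elim {g i p} {g i q} (proj₂ (∧-true {not (does (g i p ≟ g i q))} (ad (i , p) (i , q) (refl , inj₁ e))))
      constant : ∀ {k} (h : Fin k → ℕ) → (∀ p q → toℕ q ≡ suc (toℕ p) → h p ≡ h q) → ∀ p q → h p ≡ h q
      constant {suc k} h hs p q = trans (path-constant h hs p) (sym (path-constant h hs q))
      inQ : ∀ i → toℕ i ≤ toℕ j → ∀ p → toℕ (g i p) < Q
      inQ i i≤j p with toℕ (g i p) <? Q
      ... | yes lt = lt
      ... | no ¬lt with ≤⇒∃+ (≮⇒≥ ¬lt)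
      ...   | y , e = ⊥-elim (<⇒≱ (≤-trans (≤-reflexive (sym kj)) (dec i j i≤j)) (begin
                k i                       ≡⟨ length-tabulate (g i) ⟨
                length (tabulate (g i))   ≤⟨ unique-length≤card (block (y / suc l)) _ (Unique.tabulate⁺ λ {p} {q} e → samePos (inj e)) (All.tabulate⁺ λ q → inBlock q) ⟩
                card (block (y / suc l))  ≤⟨ card-block (y / suc l) ⟩
                suc l                     ∎))
        where
        samePos : ∀ {p q} → _≡_ {A = Σ (Fin m) (λ i → Fin (k i))} (i , p) (i , q) → p ≡ q
        samePos refl = refl
        inBlock : ∀ q → g i q ∈ₛ block (y / suc l)
        inBlock q = dec-true (blk (toℕ (g i q)) ≟ℕ suc (y / suc l))
          (trans (constant (λ p → blk (toℕ (g i p))) (step i) q p) (trans (cong blk e) (blk-large y)))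

-- K_s + K̄_{n−s}, which is extremal for s = ⌊∑ k_i / 2⌋ − 1.
module Join (s n : ℕ) where

  near : Fin n → Fin n → Bool
  near i j = (toℕ i <ᵇ s) ∨ (toℕ j <ᵇ s)

  near-sym : ∀ i j → near i j ≡ near j i
  near-sym i j = ∨-comm (toℕ i <ᵇ s) (toℕ j <ᵇ s)

  graph : Graph n
  graph = symGraph near near-sym

  cover : ∀ {i j} → Adj graph i j → i ∈ₛ seg s ⊎ j ∈ₛ seg s
  cover {i} {j} p = ∪-elim (proj₂ (∧-true {not (does (i ≟ j))} p))

  back : ℕ → ℕ
  back x = x ⊓ s

  back≤deg : ∀ v → back (toℕ v) ≤ deg graph (seg (toℕ v)) v
  back≤deg v = deg-interval graph v 0 (toℕ v ⊓ s) (m⊓n≤m _ s) λ u _ lt →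
    symGraph-adj near near-sym v u (λ { refl → <-irrefl refl (<-≤-trans lt (m⊓n≤m _ s)) }) (∪-right {toℕ v <ᵇ s} (<ᵇ-true (<-≤-trans lt (m⊓n≤n (toℕ v) s))))

  2*sumTo-back : ∀ y → 2 * sumTo back (s + y) + s * suc s ≡ 2 * s * (s + y)
  2*sumTo-back zero = begin
    2 * sumTo back (s + 0) + s * suc s   ≡⟨ cong (λ z → 2 * sumTo back z + s * suc s) (+-identityʳ s) ⟩
    2 * sumTo back s + s * suc s         ≡⟨ cong (_+ s * suc s) (2*sumTo-id back s (λ y lt → m≤n⇒m⊓n≡m (<⇒≤ lt))) ⟩
    s * (s ∸ 1) + s * suc s              ≡⟨ lem₁ (s * (s ∸ 1)) s ⟩
    s * (s ∸ 1) + s + s * s              ≡⟨ cong (_+ s * s) (n*pred s) ⟩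
    s * s + s * s                        ≡⟨ lem₂ s ⟩
    2 * s * (s + 0)                      ∎
    where
    open ≡-Reasoning
    lem₁ : ∀ a s → a + s * suc s ≡ a + s + s * s
    lem₁ = solve-∀
    lem₂ : ∀ s → s * s + s * s ≡ 2 * s * (s + 0)
    lem₂ = solve-∀
  2*sumTo-back (suc y) = begin
    2 * sumTo back (s + suc y) + s * suc s               ≡⟨ cong (λ z → 2 * sumTo back z + s * suc s) (+-suc s y) ⟩
    2 * (sumTo back (s + y) + back (s + y)) + s * suc s  ≡⟨ cong (λ z → 2 * (sumTo back (s + y) + z) + s * suc s) (m≥n⇒m⊓n≡n (m≤m+n s y)) ⟩
    2 * (sumTo back (s + y) + s) + s * suc s             ≡⟨ lem₁ (sumTo back (s + y)) s ⟩
    2 * sumTo back (s + y) + s * suc s + 2 * s           ≡⟨ cong (_+ 2 * s) (2*sumTo-back y) ⟩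
    2 * s * (s + y) + 2 * s                              ≡⟨ lem₂ s y ⟩
    2 * s * (s + suc y)                                  ∎
    where
    open ≡-Reasoning
    lem₁ : ∀ a s → 2 * (a + s) + s * suc s ≡ 2 * a + s * suc s + 2 * s
    lem₁ = solve-∀
    lem₂ : ∀ s y → 2 * s * (s + y) + 2 * s ≡ 2 * s * (s + suc y)
    lem₂ = solve-∀

  edges-graph : s ≤ n → 2 * s * n ≤ 2 * edges graph + s * suc s
  edges-graph s≤n = begin
    2 * s * n                                      ≡⟨ cong (2 * s *_) (m+[n∸m]≡n s≤n) ⟨
    2 * s * (s + (n ∸ s))                          ≡⟨ 2*sumTo-back (n ∸ s) ⟨
    2 * sumTo back (s + (n ∸ s)) + s * suc s       ≡⟨ cong (λ z → 2 * sumTo back z + s * suc s) (m+[n∸m]≡n s≤n) ⟩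
    2 * sumTo back n + s * suc s                   ≤⟨ +-monoˡ-≤ (s * suc s) (sumTo≤edges₂ graph back back≤deg n ≤-refl) ⟩
    edges₂ graph (seg n) + s * suc s               ≤⟨ +-monoˡ-≤ (s * suc s) (edges₂-mono graph {seg n} {full} (λ _ _ → refl)) ⟩
    edges₂ graph full + s * suc s                  ≡⟨ cong (_+ s * suc s) (2*edges graph) ⟨
    2 * edges graph + s * suc s                    ∎
    where open ≤-Reasoning

  -- Of two consecutive vertices one lies in K_s.
  linked-count : ∀ {l} → Linked (Adj graph) l → length l ≤ suc (2 * count (seg s) l)
  linked-count [] = z≤n
  linked-count [-] = s≤s z≤n
  linked-count {x ∷ y ∷ l} (xy ∷ k) = ≤-from (+-mono-≤ (linked-count (proj₂ (linked-++⁻ [ y ] k))) (*-monoʳ-≤ 2 (one (cover xy)))) 0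
      (lem (length l) (count (seg s) l) ⟦ seg s x ⟧ ⟦ seg s y ⟧)
    where
    one : x ∈ₛ seg s ⊎ y ∈ₛ seg s → 1 ≤ ⟦ seg s x ⟧ + ⟦ seg s y ⟧
    one (inj₁ p) = ≤-trans (≤-reflexive (cong ⟦_⟧ (sym p))) (m≤m+n _ _)
    one (inj₂ p) = ≤-trans (≤-reflexive (cong ⟦_⟧ (sym p))) (m≤n+m _ ⟦ seg s x ⟧)
    lem : ∀ l c a b → suc (suc l) + (suc (2 * c) + 2 * (a + b)) + 0 ≡ suc (2 * (a + (b + c))) + (l + 2 * 1)
    lem = solve-∀

  count-unique : ∀ (A : Sub n) l → Unique l → count A l ≤ card A
  count-unique A [] _ = z≤n
  count-unique A (v ∷ l) (v∉ ∷ u) = begin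
    ⟦ A v ⟧ + count A l          ≡⟨ cong (⟦ A v ⟧ +_) (skip l v∉) ⟩
    ⟦ A v ⟧ + count (A ─ v) l    ≤⟨ +-monoʳ-≤ ⟦ A v ⟧ (count-unique (A ─ v) l u) ⟩
    ⟦ A v ⟧ + card (A ─ v)       ≡⟨ card-remove A v ⟨
    card A                       ∎
    where
    open ≤-Reasoning
    skip : ∀ l → All (λ x → ¬ v ≡ x) l → count A l ≡ count (A ─ v) l
    skip [] [] = refl
    skip (x ∷ l) (v≢ ∷ a) = cong₂ _+_ (cong ⟦_⟧ (eq x v≢)) (skip l a)
      where
      eq : ∀ x → ¬ v ≡ x → A x ≡ (A ─ v) x
      eq x v≢ with bool-cases (A x)
      ... | inj₁ p = trans p (sym (∈-─ {A = A} p (λ e → v≢ (sym e))))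
      ... | inj₂ p = trans p (cong (_∧ not (｛ v ｝ x)) (sym p))

  even-≤ : ∀ {x h c} → x ≡ 2 * h → x ≤ suc (2 * c) → x ≤ 2 * c
  even-≤ {h = h} {c} refl le = *-monoʳ-≤ 2 (half-≤ {h} {c} (≤-trans le (≤-reflexive (+-comm 1 (2 * c)))))

  PathImages : ∀ {m} (k : Fin m → ℕ) → ((i : Fin m) → Fin (k i) → Fin n) → Set
  PathImages k g = ∀ i p q → toℕ q ≡ suc (toℕ p) → Adj graph (g i p) (g i q)

  first-path : ∀ {k} (h : Fin k → Fin n) → (∀ p q → toℕ q ≡ suc (toℕ p) → Adj graph (h p) (h q)) → k ≤ suc (2 * count (seg s) (tabulate h))
  first-path h ad = ≤-trans (≤-reflexive (sym (length-tabulate h))) (linked-count (tabulate-linked h ad))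

  count-split : ∀ {m} (k : Fin (suc m) → ℕ) (g : (i : Fin (suc m)) → Fin (k i) → Fin n) → 2 * count (seg s) (imgs k g (suc m)) ≡
    2 * count (seg s) (tabulate (g zero)) + 2 * count (seg s) (imgs (k ∘ suc) (λ i → g (suc i)) m)
  count-split k g = trans (cong (2 *_) (count-++ (seg s) (tabulate (g zero)))) (*-distribˡ-+ 2 (count (seg s) (tabulate (g zero))) _)

  psum-even : ∀ {m} (k : Fin m → ℕ) g → PathImages k g → (∀ i → ¬ k i % 2 ≡ 1) → psum k m ≤ 2 * count (seg s) (imgs k g m)
  psum-even {zero} k g ad even = z≤n
  psum-even {suc m} k g ad even with even-or-odd (k zero)
  ... | inj₂ (h , e) = ⊥-elim (even zero (odd%2 h e))
  ... | inj₁ (h , e) = ≤-trans (+-mono-≤ (even-≤ {h = h} {count (seg s) (tabulate (g zero))} e (first-path (g zero) (ad zero))) (psum-even (k ∘ suc) (λ i → g (suc i)) (λ i → ad (suc i)) (λ i → even (suc i))))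
        (≤-reflexive (sym (count-split k g)))

  -- A path of even order cannot attain the odd bound 2c + 1, so the unit of slack is needed for at
  -- most one path. This is where the parity hypothesis enters the lower bound.
  psum-odd : ∀ {m} (k : Fin m → ℕ) g → PathImages k g → (∀ i j → k i % 2 ≡ 1 → k j % 2 ≡ 1 → i ≡ j) → psum k m ≤ suc (2 * count (seg s) (imgs k g m))
  psum-odd {zero} k g ad odd = z≤n
  psum-odd {suc m} k g ad odd with even-or-odd (k zero)
  ... | inj₁ (h , e) = ≤-trans (+-mono-≤ (even-≤ {h = h} {count (seg s) (tabulate (g zero))} e (first-path (g zero) (ad zero))) (psum-odd (k ∘ suc) (λ i → g (suc i)) (λ i → ad (suc i)) λ i j p q → case odd (suc i) (suc j) p q of λ { refl → refl }))
        (≤-reflexive (trans (+-suc (2 * count (seg s) (tabulate (g zero))) _) (cong suc (sym (count-split k g)))))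
  ... | inj₂ (h , e) = ≤-trans (+-mono-≤ (first-path (g zero) (ad zero)) (psum-even (k ∘ suc) (λ i → g (suc i)) (λ i → ad (suc i)) λ i p → case odd zero (suc i) (odd%2 h e) p of λ ()))
        (≤-reflexive (cong suc (sym (count-split k g))))

  graph-free : ∀ {m} (k : Fin m → ℕ) → (∀ i j → k i % 2 ≡ 1 → k j % 2 ≡ 1 → i ≡ j) → 2 * s + 2 ≤ psum k m → ¬ Contains graph (LinearForest m k)
  graph-free {m} k odd K≥ (f , inj , ad) = 1+n≰n (begin
      suc (2 * s + 1)                                ≡⟨ +-suc (2 * s) 1 ⟨
      2 * s + 2                                      ≤⟨ K≥ ⟩
      psum k m                                       ≤⟨ psum-odd k g (λ i p q e → ad (i , p) (i , q) (refl , inj₁ e)) odd ⟩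
      suc (2 * count (seg s) (imgs k g m))           ≤⟨ s≤s (*-monoʳ-≤ 2 (≤-trans (count-unique (seg s) _ (imgs-unique k g m (λ p q e → inj e)))
                                                          (card-interval≤ (seg {n} s) 0 s (λ v p → z≤n , seg⇒< s v p)))) ⟩
      suc (2 * s)                                    ≡⟨ +-comm 1 (2 * s) ⟩
      2 * s + 1                                      ∎)
    where
    open ≤-Reasoning
    g : (i : Fin m) → Fin (k i) → Fin n
    g i p = f (i , p)

-- The lower bound and the conclusion

maximum-attained : ∀ {A : Set} (f : A → ℕ) xs → maximum (map f xs) ≡ 0 ⊎ (∃ λ x → maximum (map f xs) ≡ f x)
maximum-attained f [] = inj₁ refl
maximum-attained f (x ∷ xs) with ⊔-sel (f x) (maximum (map f xs)) | maximum-attained f xs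
... | inj₁ e | _ = inj₂ (x , e)
... | inj₂ e | inj₁ z = inj₁ (trans e z)
... | inj₂ e | inj₂ (y , e′) = inj₂ (y , trans e e′)

lower-bound : ∀ {m n} (k : Fin m → ℕ) → 1 ≤ m → (∀ i j → toℕ i ≤ toℕ j → k j ≤ k i) → (∀ i → 3 ≤ k i) →
  (∀ i j → k i % 2 ≡ 1 → k j % 2 ≡ 1 → i ≡ j) → psum k m ≤ n →
  ∃ λ (G : Graph n) → ¬ Contains G (LinearForest m k) × exValue n m k ≤ edges G
lower-bound {m} {n} k 1≤m dec k≥3 odd K≤n = choose (⊔-sel (maximum (map f (allFin m))) (bracket2 n K)) (maximum-attained f (allFin m))
  where
  open ≤-Reasoning
  f : Fin m → ℕ
  f j = bracket3 n (psum k (suc (toℕ j))) (k j)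
  K = psum k m
  Extremal-graph : Set
  Extremal-graph = ∃ λ (G : Graph n) → ¬ Contains G (LinearForest m k) × exValue n m k ≤ edges G
  cliques : ∀ j → exValue n m k ≡ f j → Extremal-graph
  cliques j e with ≤⇒∃+ (≤-trans (s≤s (s≤s z≤n)) (k≥3 j))
  ... | l , kj = Cliques.graph Q l n , Cliques.graph-free Q l n k j dec kj (≤-reflexive (sym M≡)) , *-cancelˡ-≤ 2 (begin
      2 * exValue n m k                   ≡⟨ cong (2 *_) e ⟩
      2 * bracket3 n M (k j)              ≡⟨ cong (λ z → 2 * bracket3 n M z) kj ⟩
      2 * bracket3 n M (suc (suc l))      ≡⟨ bracket3-value n M l (≤-trans (≤-reflexive (sym M≡)) M≤n) ⟩
      Q * (Q ∸ 1) + H l (n ∸ Q)           ≤⟨ Cliques.edges-graph Q l n (≤-trans (m∸n≤m M 1) M≤n) ⟩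
      2 * edges (Cliques.graph Q l n)     ∎)
    where
    M = psum k (suc (toℕ j))
    Q = M ∸ 1
    M≤n : M ≤ n
    M≤n = ≤-trans (psum-mono k (toℕ<n j)) K≤n
    M≡ : M ≡ suc Q
    M≡ = sym (m+[n∸m]≡n {1} (≤-trans (≤-trans (s≤s z≤n) (k≥3 j)) (≤-trans (m≤n+m (k j) (psum k (toℕ j))) (≤-reflexive (sym (psum-suc k j))))))
  join : exValue n m k ≤ bracket2 n K → Extremal-graph
  join le with half₂ (psum≥3 k 1≤m k≥3)
  ... | s , K≡ = Join.graph s n , Join.graph-free s n k odd (half₂-≤ s K≡) , *-cancelˡ-≤ 2 (+-cancelʳ-≤ (s * suc s) _ _ (begin
      2 * exValue n m k + s * suc s            ≤⟨ +-monoˡ-≤ (s * suc s) (*-monoʳ-≤ 2 le) ⟩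
      2 * bracket2 n K + s * suc s             ≡⟨ bracket2-value n K s K≡ s<n ⟩
      2 * s * n                                ≤⟨ Join.edges-graph s n (<⇒≤ s<n) ⟩
      2 * edges (Join.graph s n) + s * suc s   ∎))
    where
    s<n : suc s ≤ n
    s<n = ≤-trans (half₂-< s K≡) K≤n
  choose : _ → _ → Extremal-graph
  choose (inj₁ e) (inj₂ (j , e′)) = cliques j (trans e e′)
  -- The value 0 is the default of `maximum`; any second bracket is at least that large.
  choose (inj₁ e) (inj₁ z) = join (≤-trans (≤-reflexive (trans e z)) z≤n)
  choose (inj₂ e) _ = join (≤-reflexive e)

theorem1p7 : (m : ℕ) → 1 ≤ m → (k : Fin m → ℕ) →
    (∀ i j → toℕ i ≤ toℕ j → k j ≤ k i) →
    (∀ i → 3 ≤ k i) →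
    (∀ i j → k i % 2 ≡ 1 → k j % 2 ≡ 1 → i ≡ j) →
    (n : ℕ) → psum k m ≤ n →
    IsEx n (LinearForest m k) (exValue n m k)
theorem1p7 m 1≤m k dec k≥3 odd n K≤n =
  let upper = upper-bound k 1≤m dec k≥3 odd K≤n
      (G , F-free , lower) = lower-bound k 1≤m dec k≥3 odd K≤n
  in (G , F-free , ≤-antisym (upper G F-free) lower) , upper
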